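{- Let $\mathbf{P}=(X,P)$ be a finite poset. Then $\mathbf{P}$ is strongly-CPT if and only if $\mathbf{P}$ is dually-CPT.
   Context: A finite poset $\mathbf{P}=(X,P)$ is CPT (containment order of paths in a tree) if there is a tree $T$ and a family $\{W_x\}_{x\in X}$ of paths of $T$ (each path identified with its vertex set) such that for all $x,y\in X$: $x<y$ in $\mathbf{P}$ if and only if $W_x\subsetneq W_y$. The dual $\mathbf{P}^d$ of $\mathbf{P}$ is the poset on $X$ with $x\le y$ in $\mathbf{P}^d$ iff $y\le x$ in $\mathbf{P}$. $\mathbf{P}$ is dually-CPT if both $\mathbf{P}$ and $\mathbf{P}^d$ are CPT. The comparability graph $G_{\mathbf{P}}$ has vertex set $X$ and an edge $xy$ whenever $x\neq y$ are comparable in $\mathbf{P}$. $\mathbf{P}$ is strongly-CPT if every poset $\mathbf{Q}$ on $X$ with $G_{\mathbf{Q}}=G_{\mathbf{P}}$ (i.e. every transitive orientation of $G_{\mathbf{P}}$) is CPT. -}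

module Defs where

open import Level using (0ℓ)
open import Data.Nat using (ℕ; suc; _≤_)
open import Data.Fin using (Fin)
open import Data.List using (List; []; _∷_; length)
open import Data.List.Relation.Unary.Unique.Propositional using (Unique)
open import Data.List.Relation.Unary.Linked using (Linked)
open import Data.List.Membership.Propositional using (_∈_; _∉_)
open import Data.List.Relation.Unary.Any using (here; there)
open import Data.Product using (Σ; ∃; _×_; _,_)
open import Data.Sum using (_⊎_)
open import Relation.Nullary using (¬_)
open import Relation.Binary using (Rel; IsStrictPartialOrder)
open import Relation.Binary.PropositionalEquality using (_≡_; isEquivalence; subst; sym; refl)
open import Function.Bundles using (_⇔_)

record Poset (n : ℕ) : Set₁ where
  field
    _≺_      : Rel (Fin n) 0ℓ
    isStrict : IsStrictPartialOrder _≡_ _≺_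
open Poset public

dual : ∀ {n} → Poset n → Poset n
dual {n} P = record
  { _≺_ = λ x y → _≺_ P y x
  ; isStrict = record
      { isEquivalence = isEquivalence
      ; irrefl = λ { refl yx → S.irrefl refl yx }
      ; trans = λ xy yz → S.trans yz xy
      ; <-resp-≈ = (λ { refl p → p }) , (λ { refl p → p })
      }
  }
  where module S = IsStrictPartialOrder (isStrict P)

-- Comparability graph: x and y adjacent iff x ≠ y and comparable.
-- (For a strict order, comparability already forces x ≠ y.)
Comparable : ∀ {n} → Poset n → Fin n → Fin n → Set
Comparable P x y = _≺_ P x y ⊎ _≺_ P y x

SameComparabilityGraph : ∀ {n} → Poset n → Poset n → Set
SameComparabilityGraph P Q = ∀ x y → Comparable Q x y ⇔ Comparable P x y

record Graph (m : ℕ) : Set₁ where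
  field
    Adj     : Rel (Fin m) 0ℓ
    sym-adj : ∀ {u v} → Adj u v → Adj v u
    irr-adj : ∀ {u} → ¬ Adj u u
open Graph public

record Path {m : ℕ} (G : Graph m) : Set where
  field
    verts    : List (Fin m)
    nonempty : 1 ≤ length verts
    distinct : Unique verts
    linked   : Linked (Adj G) verts
open Path public

data Last {A : Set} : List A → A → Set where
  last-one  : ∀ {a} → Last (a ∷ []) a
  last-more : ∀ {a b xs z} → Last (b ∷ xs) z → Last (a ∷ b ∷ xs) z

Connected : ∀ {m} → Graph m → Set
Connected {m} G = ∀ (u v : Fin m) →
  Σ (Path G) λ p → Σ (List (Fin m)) λ rest → verts p ≡ u ∷ rest × Last (verts p) v

HasCycle : ∀ {m} → Graph m → Set
HasCycle {m} G = Σ (Path G) λ p → 3 ≤ length (verts p) ×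
  Σ (Fin m) λ u → Σ (List (Fin m)) λ rest → Σ (Fin m) λ v →
    verts p ≡ u ∷ rest × Last (verts p) v × Adj G v u

IsTree : ∀ {m} → Graph m → Set
IsTree {m} G = 1 ≤ m × Connected G × ¬ HasCycle G

_⊆ᵥ_ : ∀ {m} {G : Graph m} → Path G → Path G → Set
p ⊆ᵥ q = ∀ v → v ∈ verts p → v ∈ verts q

_⊊ᵥ_ : ∀ {m} {G : Graph m} → Path G → Path G → Set
p ⊊ᵥ q = p ⊆ᵥ q × ∃ λ v → v ∈ verts q × v ∉ verts p

CPT : ∀ {n} → Poset n → Set₁
CPT {n} P = Σ ℕ λ m → Σ (Graph m) λ T → IsTree T ×
  Σ (Fin n → Path T) λ W → ∀ x y → _≺_ P x y ⇔ (W x ⊊ᵥ W y)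

DuallyCPT : ∀ {n} → Poset n → Set₁
DuallyCPT P = CPT P × CPT (dual P)

StronglyCPT : ∀ {n} → Poset n → Set₁
StronglyCPT {n} P = (Q : Poset n) → SameComparabilityGraph P Q → CPT Q

{-# OPTIONS --safe #-}

{-
Let Q be another transitive orientation of the comparability graph of P. Colour the edges on which P and Q disagree,
those on which they agree, and the non-edges: no triangle is rainbow, so by Gallai one colour is disconnected.

If the disagreeing edges are disconnected (if the agreeing ones are, exchange P with its dual), each component C of
the disagreement graph is a proper module on which P can be replaced by Q. When some z outside C is comparable to C,
all paths of C (in the representation of P or of its dual) are segments of the path of z, so P has a conjugate order
on C, i.e. dimension at most 2 there, and so has Q. Then a single path of C can be replaced by slightly longer and
shorter variants, obtained by splitting the edges at its two ends, which represent Q on C. When no such z exists, C is a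
union of connected components of the comparability graph, and induction on the ground set applies.

If the non-edges are disconnected, every element lies in a set of elements comparable to a common z, so the whole poset
has a conjugate order, and Q is represented by subpaths of one path.

A one-vertex path {a} with a at the end of the paths of C cannot be shortened. Either some path of C continues beyond
a, and the edge split is the one leading there, or all paths of C end at a; then Q is a weak order on C and splitting at
the other end suffices.
-}
module Submission where

open import Defs
open import Level using (0ℓ)
open import Data.Bool using (Bool; true; false)
import Data.Bool.Properties as Bool
open import Data.Empty using (⊥; ⊥-elim)
open import Data.Fin using (Fin; zero; suc; toℕ; _↑ˡ_; _↑ʳ_; splitAt)
import Data.Fin.Properties as Fin
open import Data.Fin.Properties using (_≟_)
open import Data.Fin.Subset using (Subset; _∪_; ⁅_⁆; _⊂_; ∣_∣) renaming (_∈_ to _∈ˢ_; _∉_ to _∉ˢ_)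
import Data.Fin.Subset as Sets
open import Data.Fin.Subset.Induction using (⊂-wellFounded; ⊃-wellFounded; Acc; acc)
import Data.Fin.Subset.Properties as Subset
open import Data.Fin.Subset.Properties using () renaming (_∈?_ to _∈ˢ?_)
open import Data.List using (List; []; _∷_; length; map; allFin; _ʳ++_)
import Data.List.Properties as List
import Data.List.Membership.DecPropositional as DecMembership
open import Data.List.Membership.Propositional using (_∈_; _∉_; lose) renaming (find to find-∈)
open import Data.List.Membership.Propositional.Properties using (∈-map⁺; ∈-map⁻; ∈-allFin)
open import Data.List.Relation.Unary.All using (All; []; _∷_)
import Data.List.Relation.Unary.All as All
open import Data.List.Relation.Unary.AllPairs using ([]; _∷_)
open import Data.List.Relation.Unary.Any using (here; there; any?)
import Data.List.Relation.Unary.Any as Any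
open import Data.List.Relation.Unary.Linked using (Linked; []; [-]; _∷_)
import Data.List.Relation.Unary.Linked as Linked
import Data.List.Relation.Unary.Linked.Properties as Linkedₚ
open import Data.List.Relation.Unary.Unique.Propositional using (Unique)
import Data.List.Relation.Unary.Unique.Propositional.Properties as Uniqueₚ
open import Data.Nat using (ℕ; zero; suc; _+_; _≤_; _<_; z≤n; s≤s)
import Data.Nat.Properties as ℕ
open import Data.Product using (Σ; ∃; _×_; _,_; proj₁; proj₂; Σ-syntax; ∃-syntax)
open import Data.Sum using (_⊎_; inj₁; inj₂; swap)
open import Data.Unit using (⊤; tt)
open import Data.Vec using (tabulate)
import Data.Vec.Properties as Vec
open import Function.Base using (_∘_; flip)
open import Function.Bundles using (_⇔_; mk⇔; Equivalence)
open import Relation.Binary using (Rel; Decidable; IsStrictPartialOrder; tri<; tri≈; tri>)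
open import Relation.Binary.Construct.Closure.ReflexiveTransitive using (Star; ε; _◅_; _◅◅_; kleisliStar)
import Relation.Binary.Construct.Closure.ReflexiveTransitive as Star
open import Relation.Binary.PropositionalEquality using (_≡_; _≢_; refl; sym; trans; cong; subst)
open import Relation.Nullary using (¬_; Dec; yes; no; does; map′; ¬?; _×-dec_; _⊎-dec_)

-- Paths in trees

-- The delicate point is what a cut at one end of the paths of `C` does to the elements outside `C`.
-- An element below `C` whose path reaches that end would fall out of the shortened paths, so it is
-- cut as well, and further than every member of `C`. Any other outsider containing the end vertex
-- keeps it, and therefore lies in no path of `C`. The new vertex on the split edge stays in every
-- path that ran along the edge, which prevents a cut from creating containments. One path can serve
-- all of `C` because the members of a module have the same relations to the outside. It is taken
-- from a non-minimal element `c`: its path then has an edge, and an element `c₀` below `c` turns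
-- containment of the path of `c` into strict containment of that of `c₀`. The two coordinates of a
-- two-dimensional order become the lengths cut at the two ends. Each replacement is carried out in
-- `R` and in its dual, because the segments of the path of `z` account only for the elements below
-- `z`; those above `z` are seen in the dual.

_∈?_ : ∀ {m} (v : Fin m) (l : List (Fin m)) → Dec (v ∈ l)
_∈?_ = DecMembership._∈?_ _≟_

unique-∷ : ∀ {A : Set} {x : A} {l} → x ∉ l → Unique l → Unique (x ∷ l)
unique-∷ x∉l u = All.tabulate (λ { y∈l refl → x∉l y∈l }) ∷ u

unique-head : ∀ {A : Set} {x : A} {l} → Unique (x ∷ l) → x ∉ l
unique-head (h ∷ _) x∈l = All.lookup h x∈l refl

unique-tail : ∀ {A : Set} {x : A} {l} → Unique (x ∷ l) → Unique l
unique-tail (_ ∷ u) = u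

last-∈ : ∀ {A : Set} {l : List A} {v} → Last l v → v ∈ l
last-∈ last-one = here refl
last-∈ (last-more e) = there (last-∈ e)

linked-ʳ++ : ∀ {A : Set} {R : Rel A 0ℓ} → (∀ {x y} → R x y → R y x) →
  ∀ {a} xs {ys} → Linked R (a ∷ xs) → Linked R (a ∷ ys) → Linked R (xs ʳ++ (a ∷ ys))
linked-ʳ++ s [] _ l₂ = l₂
linked-ʳ++ s (x ∷ xs) (r ∷ l₁) l₂ = linked-ʳ++ s xs l₁ (s r ∷ l₂)

∈-ʳ++⁺ˡ : ∀ {A : Set} {v : A} xs {ys} → v ∈ xs → v ∈ (xs ʳ++ ys)
∈-ʳ++⁺ʳ : ∀ {A : Set} {v : A} xs {ys} → v ∈ ys → v ∈ (xs ʳ++ ys)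
∈-ʳ++⁺ˡ (x ∷ xs) (here refl) = ∈-ʳ++⁺ʳ xs (here refl)
∈-ʳ++⁺ˡ (x ∷ xs) (there v∈) = ∈-ʳ++⁺ˡ xs v∈
∈-ʳ++⁺ʳ [] v∈ = v∈
∈-ʳ++⁺ʳ (x ∷ xs) v∈ = ∈-ʳ++⁺ʳ xs (there v∈)

∈-ʳ++⁻ : ∀ {A : Set} {v : A} xs {ys} → v ∈ (xs ʳ++ ys) → v ∈ xs ⊎ v ∈ ys
∈-ʳ++⁻ [] v∈ = inj₂ v∈
∈-ʳ++⁻ (x ∷ xs) v∈ with ∈-ʳ++⁻ xs v∈
... | inj₁ v∈xs = inj₁ (there v∈xs)
... | inj₂ (here refl) = inj₁ (here refl)
... | inj₂ (there v∈ys) = inj₂ v∈ys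

unique-ʳ++ : ∀ {A : Set} (xs : List A) {ys} → Unique xs → Unique ys →
  (∀ {v} → v ∈ xs → v ∉ ys) → Unique (xs ʳ++ ys)
unique-ʳ++ [] _ u _ = u
unique-ʳ++ (x ∷ xs) u₁ u₂ d = unique-ʳ++ xs (unique-tail u₁) (unique-∷ (d (here refl)) u₂)
  λ { v∈xs (here refl) → unique-head u₁ v∈xs ; v∈xs (there v∈ys) → d (there v∈xs) v∈ys }

ʳ++-last : ∀ {A : Set} {l : List A} {v} → Last l v → ∀ ys → ∃[ r ] l ʳ++ ys ≡ v ∷ r
ʳ++-last last-one ys = ys , refl
ʳ++-last (last-more {a} e) ys = ʳ++-last e (a ∷ ys)

last-ʳ++ : ∀ {A : Set} xs {y : A} {ys v} → Last (y ∷ ys) v → Last (xs ʳ++ (y ∷ ys)) v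
last-ʳ++ [] e = e
last-ʳ++ (x ∷ xs) e = last-ʳ++ xs (last-more e)

last-unique : ∀ {A : Set} {l : List A} {u v} → Last l u → Last l v → u ≡ v
last-unique last-one last-one = refl
last-unique (last-more e) (last-more f) = last-unique e f

last-exists : ∀ {A : Set} (x : A) l → ∃ (Last (x ∷ l))
last-exists x [] = x , last-one
last-exists x (y ∷ l) with last-exists y l
... | v , e = v , last-more e

record Simple {m : ℕ} (G : Graph m) (l : List (Fin m)) : Set where
  constructor _,_
  field
    links : Linked (Adj G) l
    unique : Unique l
open Simple public

private variable
  m : ℕ
  G : Graph m
  a b u v w : Fin m
  l r : List (Fin m)

path : Simple G (a ∷ l) → Path G
path (k , u) = record { verts = _ ; nonempty = s≤s z≤n ; distinct = u ; linked = k }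

simple : (p : Path G) → Simple G (verts p)
simple p = linked p , distinct p

simple-tail : Simple G (a ∷ l) → Simple G l
simple-tail (k , u) = Linked.tail k , unique-tail u

simple-∷ : Adj G a b → Simple G (b ∷ l) → a ∉ (b ∷ l) → Simple G (a ∷ b ∷ l)
simple-∷ e (k , u) n = e ∷ k , unique-∷ n u

simple-head≢ : Simple G (a ∷ l) → v ∈ l → a ≢ v
simple-head≢ (_ , u) v∈ refl = unique-head u v∈

path-cases : (p : Path G) → ∃[ a ] ∃[ l ] verts p ≡ a ∷ l
path-cases p with verts p | nonempty p
... | a ∷ l | _ = a , l , refl

simple-reverse : Simple G (a ∷ l) → Simple G (l ʳ++ (a ∷ []))
simple-reverse {G = G} {a = a} {l = l} s@(k , u) =
  linked-ʳ++ (sym-adj G) l k [-] ,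
  unique-ʳ++ l (unique-tail u) ([] ∷ []) λ { v∈ (here refl) → unique-head u v∈ }

reverse-from-last : Simple G (a ∷ l) → Last (a ∷ l) v →
  ∃[ r ] Simple G (v ∷ r) × Last (v ∷ r) a × (∀ {w} → w ∈ a ∷ l → w ∈ v ∷ r) × (∀ {w} → w ∈ v ∷ r → w ∈ a ∷ l)
reverse-from-last {G = G} {a = a} {l = l} s e with ʳ++-last e []
... | r , eq = r , subst (Simple G) eq (simple-reverse s) ,
  subst (λ z → Last z a) eq (last-ʳ++ l last-one) ,
  (λ w∈ → subst (_ ∈_) eq (∈-ʳ++⁺ˡ (a ∷ l) w∈)) ,
  λ w∈ → back (∈-ʳ++⁻ (a ∷ l) (subst (_ ∈_) (sym eq) w∈))
  where
  back : ∀ {w} → w ∈ (a ∷ l) ⊎ w ∈ [] → w ∈ a ∷ l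
  back (inj₁ x) = x

upto : v ∈ (a ∷ l) → Simple G (a ∷ l) →
  ∃[ r ] Simple G (a ∷ r) × Last (a ∷ r) v × (∀ {w} → w ∈ a ∷ r → w ∈ a ∷ l)
upto (here refl) s = [] , ([-] , ([] ∷ [])) , last-one , λ { (here refl) → here refl }
upto {l = b ∷ l} (there v∈) s@(e ∷ _ , u) with upto v∈ (simple-tail s)
... | r , s' , la , sub = b ∷ r , simple-∷ e s' (λ a∈ → unique-head u (sub a∈)) , last-more la ,
  λ { (here refl) → here refl ; (there w∈) → there (sub w∈) }

-- Otherwise the initial segment up to v, closed by the edge va, is a cycle.
second-unique : ¬ HasCycle G → Simple G (a ∷ b ∷ l) → v ∈ (b ∷ l) → Adj G a v → v ≡ b
second-unique acyclic s (here refl) _ = refl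
second-unique {G = G} {a} {b} {v = v} acyclic s@(e ∷ _ , u) (there v∈) av with upto (there v∈) (simple-tail s)
... | [] , _ , last-one , _ = ⊥-elim (unique-head (unique-tail u) v∈)
... | c ∷ r , s' , la , sub =
  ⊥-elim (acyclic (path (simple-∷ {G = G} e s' (λ a∈ → unique-head u (sub a∈))) ,
    s≤s (s≤s (s≤s z≤n)) , a , b ∷ c ∷ r , v , refl , last-more la , sym-adj G av))

head-neighbour : ¬ HasCycle G → Simple G (a ∷ b ∷ l) → v ∈ (a ∷ b ∷ l) → Adj G a v → v ≡ b
head-neighbour {G = G} acyclic s (here refl) av = ⊥-elim (irr-adj G av)
head-neighbour acyclic s (there v∈) av = second-unique acyclic s v∈ av

walk : Star (Adj G) u v → ∃[ r ] Simple G (u ∷ r) × Last (u ∷ r) v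
walk ε = [] , ([-] , ([] ∷ [])) , last-one
walk {G = G} {u = u} (_◅_ {j = w} e p) with walk p
... | r , s , la with u ∈? (w ∷ r)
...   | no u∉ = w ∷ r , simple-∷ e s u∉ , last-more la
-- The walk returns to `u`: the loop is dropped by keeping the suffix that starts at `u`.
...   | yes u∈ = from u∈ s la
  where
  from : ∀ {u w r v} → u ∈ (w ∷ r) → Simple G (w ∷ r) → Last (w ∷ r) v →
    ∃[ r' ] Simple G (u ∷ r') × Last (u ∷ r') v
  from (here refl) s la = _ , s , la
  from {r = _ ∷ _} (there u∈) s (last-more la) = from u∈ (simple-tail s) la

linked-star : Linked (Adj G) (u ∷ l) → Last (u ∷ l) v → Star (Adj G) u v
linked-star [-] last-one = ε
linked-star {G = G} (e ∷ k) (last-more la) = e ◅ linked-star {G = G} k la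

connected-star : Connected G → ∀ u v → Star (Adj G) u v
connected-star {G = G} c u v with c u v
... | p , r , eq , la with verts p | linked p
connected-star {G = G} c u v | p , r , refl , la | _ | k = linked-star {G = G} k la

star-connected : (∀ u v → Star (Adj G) u v) → Connected G
star-connected h u v with walk (h u v)
... | r , s , la = path s , r , refl , la

-- A `Graph` carries no decision procedure for adjacency. In a tree, a path from `u` to `v` with
-- three or more vertices refutes the edge, which would close it to a cycle.
adj? : IsTree G → ∀ u v → Dec (Adj G u v)
adj? {G = G} (_ , conn , acyclic) u v with walk (connected-star conn u v)
... | [] , _ , last-one = no (irr-adj G)
... | w ∷ [] , (e ∷ _ , _) , last-more last-one = yes e
... | w ∷ x ∷ r , s , la = no λ uv →
  acyclic (path s , s≤s (s≤s (s≤s z≤n)) , u , w ∷ x ∷ r , v , refl , la , sym-adj G uv)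

-- Ends are described through the vertex set alone, since containment of paths ignores the direction
-- in which a list runs. The neighbour `p` forces a second vertex.
record EndAt (G : Graph m) (X : List (Fin m)) (e p : Fin m) : Set where
  field
    end∈ : e ∈ X
    next∈ : p ∈ X
    end-adj : Adj G e p
    only-next : ∀ {v} → v ∈ X → Adj G e v → v ≡ p
open EndAt public

head-endAt : ¬ HasCycle G → Simple G (a ∷ b ∷ l) → EndAt G (a ∷ b ∷ l) a b
head-endAt acyclic s@(e ∷ _ , _) = record
  { end∈ = here refl ; next∈ = there (here refl) ; end-adj = e
  ; only-next = head-neighbour acyclic s }

endAt-⊆ : ∀ {X Y : List (Fin m)} → EndAt G Y a b → a ∈ X → b ∈ X → (∀ {w} → w ∈ X → w ∈ Y) → EndAt G X a b
endAt-⊆ E a∈ b∈ sub = record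
  { end∈ = a∈ ; next∈ = b∈ ; end-adj = end-adj E ; only-next = λ v∈ → only-next E (sub v∈) }

-- A vertex inside the list has a predecessor and a successor, which are distinct, whereas
-- `only-next` would make both equal to `b`.
endAt-extreme : EndAt G l a b → Simple G l → (∃[ r ] l ≡ a ∷ r) ⊎ Last l a
endAt-extreme {G = G} {a = a} {b = b} E s = go s (end∈ E) (only-next E)
  where
  go : ∀ {l} → Simple G l → a ∈ l → (∀ {v} → v ∈ l → Adj G a v → v ≡ b) → (∃[ r ] l ≡ a ∷ r) ⊎ Last l a
  go s (here refl) _ = inj₁ (_ , refl)
  go {x ∷ l} s (there a∈) o with go (simple-tail s) a∈ (o ∘ there)
  go {x ∷ y ∷ l} s (there a∈) o | inj₂ la = inj₂ (last-more la)
  go {x ∷ _ ∷ []} s (there a∈) o | inj₁ (_ , refl) = inj₂ (last-more last-one)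
  go {x ∷ _ ∷ y ∷ l} s@(e ∷ e' ∷ _ , u) (there a∈) o | inj₁ (_ , refl)
    with trans (o (here refl) (sym-adj G e)) (sym (o (there (there (here refl))) e'))
  ... | refl = ⊥-elim (unique-head u (there (here refl)))

endAt-head : (p : Path G) → EndAt G (verts p) a b →
  ∃[ r ] Simple G (a ∷ b ∷ r) × (∀ {w} → w ∈ verts p → w ∈ a ∷ b ∷ r) × (∀ {w} → w ∈ a ∷ b ∷ r → w ∈ verts p)
endAt-head {G = G} {a = a} {b = b} p E = orient (endAt-extreme E (simple p))
  where
  Goal = ∃[ r ] Simple G (a ∷ b ∷ r) × (∀ {w} → w ∈ verts p → w ∈ a ∷ b ∷ r) × (∀ {w} → w ∈ a ∷ b ∷ r → w ∈ verts p)
  finish : ∀ r → Simple G (a ∷ r) → (∀ {w} → w ∈ verts p → w ∈ a ∷ r) → (∀ {w} → w ∈ a ∷ r → w ∈ verts p) → Goal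
  finish [] s to from with to (next∈ E)
  ... | here refl = ⊥-elim (irr-adj G (end-adj E))
  finish (c ∷ r) s@(e ∷ _ , _) to from with only-next E (from (there (here refl))) e
  ... | refl = r , s , to , from
  orient : (∃[ r ] verts p ≡ a ∷ r) ⊎ Last (verts p) a → Goal
  orient (inj₁ (r , eq)) = finish r (subst (Simple G) eq (simple p)) (subst (_ ∈_) eq) (subst (_ ∈_) (sym eq))
  orient (inj₂ la) with verts p | simple p | path-cases p | finish
  ... | _ | s | x , l , refl | fin with reverse-from-last s la
  ...   | r , s' , _ , to , from = fin r s' to from

-- Subdividing an edge

module Subdivide {m : ℕ} (G : Graph m) (e p : Fin m) where

  Split : Fin m → Fin m → Set
  Split u v = (u ≡ e × v ≡ p) ⊎ (u ≡ p × v ≡ e)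

  split? : ∀ u v → Dec (Split u v)
  split? u v = (u ≟ e ×-dec v ≟ p) ⊎-dec (u ≟ p ×-dec v ≟ e)

  split-sym : ∀ {u v} → Split u v → Split v u
  split-sym (inj₁ (a , b)) = inj₂ (b , a)
  split-sym (inj₂ (a , b)) = inj₁ (b , a)

  End : Fin m → Set
  End v = v ≡ e ⊎ v ≡ p

  split-end : ∀ {u v} → Split u v → End u
  split-end (inj₁ (a , _)) = inj₁ a
  split-end (inj₂ (a , _)) = inj₂ a

  ends-split : ∀ {u v} → End u → End v → u ≢ v → Split u v
  ends-split (inj₁ refl) (inj₁ refl) n = ⊥-elim (n refl)
  ends-split (inj₁ a) (inj₂ b) n = inj₁ (a , b)
  ends-split (inj₂ a) (inj₁ b) n = inj₂ (a , b)
  ends-split (inj₂ refl) (inj₂ refl) n = ⊥-elim (n refl)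

  SubAdj : Fin (suc m) → Fin (suc m) → Set
  SubAdj zero zero = ⊥
  SubAdj zero (suc v) = End v
  SubAdj (suc u) zero = End u
  SubAdj (suc u) (suc v) = Adj G u v × ¬ Split u v

  subdivision : Graph (suc m)
  subdivision = record
    { Adj = SubAdj
    ; sym-adj = λ { {zero} {suc v} h → h ; {suc u} {zero} h → h
                  ; {suc u} {suc v} (h , n) → sym-adj G h , n ∘ split-sym }
    ; irr-adj = λ { {suc u} (h , _) → irr-adj G h } }

  module _ (ep : Adj G e p) where

    split-adj : ∀ {u v} → Split u v → Adj G u v
    split-adj (inj₁ (refl , refl)) = ep
    split-adj (inj₂ (refl , refl)) = sym-adj G ep

    subdivision-star : (∀ u v → Star (Adj G) u v) → ∀ u v → Star SubAdj u v
    subdivision-star conn = go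
      where
      edge : ∀ {u v} → Adj G u v → Star SubAdj (suc u) (suc v)
      edge {u} {v} uv with split? u v
      ... | yes h = _◅_ {j = zero} (split-end h) (split-end (split-sym h) ◅ ε)
      ... | no h = (uv , h) ◅ ε
      old : ∀ u v → Star SubAdj (suc u) (suc v)
      old u v = kleisliStar suc edge (conn u v)
      go : ∀ u v → Star SubAdj u v
      go zero zero = ε
      go zero (suc v) = _◅_ {j = suc e} (inj₁ refl) (old e v)
      go (suc u) zero = old u e ◅◅ (_◅_ {j = zero} (inj₁ refl) ε)
      go (suc u) (suc v) = old u v

    erase : List (Fin (suc m)) → List (Fin m)
    erase [] = []
    erase (zero ∷ l) = erase l
    erase (suc v ∷ l) = v ∷ erase l

    erase-∈ : ∀ {v} l → v ∈ erase l → suc v ∈ l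
    erase-∈ (zero ∷ l) v∈ = there (erase-∈ l v∈)
    erase-∈ (suc u ∷ l) (here refl) = here refl
    erase-∈ (suc u ∷ l) (there v∈) = there (erase-∈ l v∈)

    erase-unique : ∀ l → Unique l → Unique (erase l)
    erase-unique [] u = []
    erase-unique (zero ∷ l) u = erase-unique l (unique-tail u)
    erase-unique (suc v ∷ l) u =
      unique-∷ (λ v∈ → unique-head u (erase-∈ l v∈)) (erase-unique l (unique-tail u))

    -- The neighbours of an erased `zero` are distinct ends of the split edge, hence adjacent in
    -- `G`; their distinctness comes from the uniqueness part of `Simple`.
    erase-linked : ∀ l → Simple subdivision l → Linked (Adj G) (erase l)
    erase-linked [] _ = []
    erase-linked (zero ∷ l) s = erase-linked l (simple-tail s)
    erase-linked (suc u ∷ []) s = [-]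
    erase-linked (suc u ∷ suc v ∷ l) s@((uv ∷ _) , _) = proj₁ uv ∷ erase-linked (suc v ∷ l) (simple-tail s)
    erase-linked (suc u ∷ zero ∷ []) s = [-]
    erase-linked (suc u ∷ zero ∷ suc v ∷ l) s@((h ∷ k ∷ _) , q) =
      split-adj (ends-split h k λ { refl → unique-head q (there (here refl)) }) ∷
      erase-linked (suc v ∷ l) (simple-tail (simple-tail s))
    erase-linked (suc u ∷ zero ∷ zero ∷ l) ((h ∷ k ∷ _) , q) = ⊥-elim k

    erase-last : ∀ {l v} → Last l (suc v) → Last (erase l) v
    erase-last last-one = last-one
    erase-last {zero ∷ l} (last-more la) = erase-last la
    erase-last {suc u ∷ zero ∷ []} (last-more (la)) with erase-last la
    ... | ()
    erase-last {suc u ∷ zero ∷ zero ∷ l} {v} (last-more (last-more la)) = push (erase-last la)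
      where
      push : ∀ {l} → Last l v → Last (u ∷ l) v
      push last-one = last-more last-one
      push (last-more x) = last-more (last-more x)
    erase-last {suc u ∷ zero ∷ suc w ∷ l} (last-more (last-more la)) = last-more (erase-last la)
    erase-last {suc u ∷ suc w ∷ l} (last-more la) = last-more (erase-last la)

    -- Only a triangle through the new vertex could shrink to two vertices. Its closing edge would
    -- be the split edge, which the subdivision no longer has.
    erase-length : ∀ {u v} a b r → Simple subdivision (suc u ∷ a ∷ b ∷ r) → Last (b ∷ r) (suc v) → SubAdj (suc v) (suc u) →
      3 ≤ length (erase (suc u ∷ a ∷ b ∷ r))
    erase-length (suc a) (suc b) r s la c = s≤s (s≤s (s≤s z≤n))
    erase-length (suc a) zero (suc c ∷ r) s la _ = s≤s (s≤s (s≤s z≤n))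
    erase-length (suc a) zero (zero ∷ r) s@((_ ∷ _ ∷ () ∷ _) , _) la _
    erase-length zero (suc b) [] ((h ∷ k ∷ _) , q) last-one (_ , n) =
      ⊥-elim (n (ends-split k h λ { refl → unique-head q (there (here refl)) }))
    erase-length zero (suc b) (suc c ∷ r) s la _ = s≤s (s≤s (s≤s z≤n))
    erase-length zero (suc b) (zero ∷ r) s la _ = ⊥-elim (unique-head (unique-tail (unique s)) (there (here refl)))
    erase-length zero zero r ((_ ∷ () ∷ _) , _) la _

    -- A cycle of the subdivision becomes one of G by erasing the new vertex; if that vertex starts
    -- or ends the list, the split edge closes the rest.
    subdivision-acyclic : ¬ HasCycle G → ¬ HasCycle subdivision
    subdivision-acyclic acyclic (q , len , u , r , v , eq , la , vu) with verts q | simple q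
    subdivision-acyclic acyclic (q , len , u , [] , v , refl , la , vu) | _ | s with len
    ... | s≤s ()
    subdivision-acyclic acyclic (q , len , u , a ∷ [] , v , refl , la , vu) | _ | s with len
    ... | s≤s (s≤s ())
    subdivision-acyclic acyclic (q , len , u , a ∷ b ∷ r , v , refl , last-more (last-more la) , vu) | _ | s =
      cases u v s (last-more la) vu
      where
      new-first : ∀ {v a b r} → Simple subdivision (zero ∷ a ∷ b ∷ r) → Last (a ∷ b ∷ r) (suc v) → End v → ⊥
      new-first {v} {zero} ((() ∷ _) , _) la h
      new-first {v} {suc a} {zero} {r} s la h = unique-head (unique s) (there (here refl))
      new-first {v} {suc a} {suc b} {[]} ((k ∷ (_ , n) ∷ _) , q) (last-more last-one) h = n (ends-split k h λ { refl → unique-head (unique-tail q) (here refl) })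
      new-first {v} {suc a} {suc b} {zero ∷ r} s la h = unique-head (unique s) (there (there (here refl)))
      new-first {v} {suc a} {suc b} {suc c ∷ r} s@((k ∷ _) , q) la h =
        acyclic (path {G = G} {l = b ∷ c ∷ erase r} (erase-linked _ (simple-tail s) , erase-unique _ (unique-tail q)) ,
          s≤s (s≤s (s≤s z≤n)) , a , b ∷ c ∷ erase r , v , refl , erase-last la ,
          split-adj (ends-split h k λ { refl → unique-head (unique-tail q) (tail-last la) }))
        where
        tail-last : ∀ {x y l v} → Last (x ∷ y ∷ l) v → v ∈ (y ∷ l)
        tail-last (last-more la) = last-∈ la
      cases : ∀ u v → Simple subdivision (u ∷ a ∷ b ∷ r) → Last (a ∷ b ∷ r) v → SubAdj v u → ⊥
      cases zero (suc v) s la h = new-first s la h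
      cases (suc u) (suc v) s (last-more la) h =
        acyclic (path {G = G} (erase-linked _ s , erase-unique _ (unique s)) ,
          erase-length a b r s la h , u , erase (a ∷ b ∷ r) , v , refl , erase-last {suc u ∷ a ∷ b ∷ r} (last-more (last-more la)) , proj₁ h)
      cases (suc u) zero s la h with reverse-from-last s (last-more la)
      ... | [] , _ , () , _
      ... | x ∷ [] , _ , last-more last-one , to , _ = two to (unique s)
        where
        two : (∀ {w} → w ∈ suc u ∷ a ∷ b ∷ r → w ∈ zero ∷ suc u ∷ []) → Unique (suc u ∷ a ∷ b ∷ r) → ⊥
        two to q with to (there (here refl)) | to (there (there (here refl)))
        ... | there (here refl) | _ = unique-head q (here refl)
        ... | here refl | there (here refl) = unique-head q (there (here refl))
        ... | here refl | here refl = unique-head (unique-tail q) (here refl)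
      ... | x ∷ y ∷ r' , s' , last-more la' , _ = new-first s' la' h

    subdivision-tree : IsTree G → IsTree subdivision
    subdivision-tree (_ , conn , acyclic) =
      s≤s z≤n , star-connected (subdivision-star (connected-star conn)) , subdivision-acyclic acyclic

    insert : Fin m → List (Fin m) → List (Fin (suc m))
    insert x [] = []
    insert x (y ∷ r) with split? x y
    ... | yes _ = zero ∷ suc y ∷ insert y r
    ... | no _ = suc y ∷ insert y r

    insert⁺ : ∀ {v} x r → v ∈ r → suc v ∈ insert x r
    insert⁺ x (y ∷ r) v∈ with split? x y
    insert⁺ x (y ∷ r) (here refl) | yes _ = there (here refl)
    insert⁺ x (y ∷ r) (there v∈) | yes _ = there (there (insert⁺ y r v∈))
    insert⁺ x (y ∷ r) (here refl) | no _ = here refl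
    insert⁺ x (y ∷ r) (there v∈) | no _ = there (insert⁺ y r v∈)

    insert⁻ : ∀ {v} x r → suc v ∈ insert x r → v ∈ r
    insert⁻ x (y ∷ r) v∈ with split? x y
    insert⁻ x (y ∷ r) (there (here refl)) | yes _ = here refl
    insert⁻ x (y ∷ r) (there (there v∈)) | yes _ = there (insert⁻ y r v∈)
    insert⁻ x (y ∷ r) (here refl) | no _ = here refl
    insert⁻ x (y ∷ r) (there v∈) | no _ = there (insert⁻ y r v∈)

    insert-new⁻ : ∀ x r → zero ∈ insert x r → e ∈ x ∷ r × p ∈ x ∷ r
    insert-new⁻ x (y ∷ r) z∈ with split? x y
    ... | yes (inj₁ (refl , refl)) = here refl , there (here refl)
    ... | yes (inj₂ (refl , refl)) = there (here refl) , here refl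
    insert-new⁻ x (y ∷ r) (there z∈) | no _ with insert-new⁻ y r z∈
    ... | e∈ , p∈ = there e∈ , there p∈

    -- A path of a tree containing both ends of an edge runs along that edge, for otherwise the
    -- segment between them and the edge would form a cycle.
    insert-new⁺ : ¬ HasCycle G → ∀ x r → Simple G (x ∷ r) → e ∈ x ∷ r → p ∈ x ∷ r → zero ∈ insert x r
    insert-new⁺ acyclic x [] s (here refl) (here refl) = ⊥-elim (irr-adj G ep)
    insert-new⁺ acyclic x (y ∷ r) s e∈ p∈ with split? x y
    ... | yes _ = here refl
    insert-new⁺ acyclic x (y ∷ r) s (here refl) p∈ | no n = ⊥-elim (n (inj₁ (refl , sym (head-neighbour acyclic s p∈ ep))))
    insert-new⁺ acyclic x (y ∷ r) s (there e∈) (here refl) | no n =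
      ⊥-elim (n (inj₂ (refl , sym (head-neighbour acyclic s (there e∈) (sym-adj G ep)))))
    insert-new⁺ acyclic x (y ∷ r) s (there e∈) (there p∈) | no n =
      there (insert-new⁺ acyclic y r (simple-tail s) e∈ p∈)

    insert-simple : ∀ x r → Simple G (x ∷ r) → Simple subdivision (suc x ∷ insert x r)
    insert-simple x [] s = [-] , ([] ∷ [])
    insert-simple x (y ∷ r) s@((xy ∷ _) , u) with split? x y | insert-simple y r (simple-tail s)
    ... | no n | s' = simple-∷ (xy , n) s'
      λ { (here refl) → unique-head u (here refl) ; (there z∈) → unique-head u (there (insert⁻ y r z∈)) }
    ... | yes h | s' = simple-∷ (split-end h) (simple-∷ (split-end (split-sym h)) s'
        λ { (there z∈) → once h (insert-new⁻ y r z∈) })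
      λ { (there (here refl)) → unique-head u (here refl) ; (there (there z∈)) → unique-head u (there (insert⁻ y r z∈)) }
      where
      once : Split x y → e ∈ y ∷ r × p ∈ y ∷ r → ⊥
      once (inj₁ (refl , _)) (e∈ , _) = unique-head u e∈
      once (inj₂ (refl , _)) (_ , p∈) = unique-head u p∈

    -- `trunc` says whether `e` is cut off. The new vertex stays in either case, so a truncated path
    -- ends at `zero` and can be truncated again on the edge from `zero` to `suc p`.
    record Image (X : Path G) (trunc : Set) (Y : Path subdivision) : Set where
      field
        old⁺ : ∀ {v} → v ∈ verts X → ¬ (trunc × v ≡ e) → suc v ∈ verts Y
        old⁻ : ∀ {v} → suc v ∈ verts Y → v ∈ verts X × ¬ (trunc × v ≡ e)
        new⁺ : e ∈ verts X → p ∈ verts X → zero ∈ verts Y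
        new⁻ : zero ∈ verts Y → e ∈ verts X × p ∈ verts X

    subdivide : ¬ HasCycle G → (X : Path G) → {t : Set} → ¬ t → Σ (Path subdivision) (Image X t)
    subdivide acyclic X ¬t with verts X in eq | simple X | path-cases X
    ... | _ | s | x , r , refl = path (insert-simple x r s) , record
      { old⁺ = λ v∈ _ → suc⁺ (subst (_ ∈_) eq v∈)
      ; old⁻ = λ v∈ → subst (_ ∈_) (sym eq) (suc⁻ v∈) , λ { (t , _) → ¬t t }
      ; new⁺ = λ e∈ p∈ → there (insert-new⁺ acyclic x r s (subst (_ ∈_) eq e∈) (subst (_ ∈_) eq p∈))
      ; new⁻ = λ { (there z∈) → let e∈ , p∈ = insert-new⁻ x r z∈ in
                   subst (_ ∈_) (sym eq) e∈ , subst (_ ∈_) (sym eq) p∈ } }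
      where
      suc⁺ : ∀ {v} → v ∈ x ∷ r → suc v ∈ suc x ∷ insert x r
      suc⁺ (here refl) = here refl
      suc⁺ (there v∈) = there (insert⁺ x r v∈)
      suc⁻ : ∀ {v} → suc v ∈ suc x ∷ insert x r → v ∈ x ∷ r
      suc⁻ (here refl) = here refl
      suc⁻ (there v∈) = there (insert⁻ x r v∈)

    truncate : ¬ HasCycle G → (X : Path G) → {t : Set} → EndAt G (verts X) e p → t → Σ (Path subdivision) (Image X t)
    truncate acyclic X E t with endAt-head X E
    ... | r , s , to , from with insert-simple e (p ∷ r) s
    ...   | s' with split? e p
    ...     | no n = ⊥-elim (n (inj₁ (refl , refl)))
    ...     | yes _ = path (simple-tail s') , record
      { old⁺ = λ v∈ n → suc⁺ n (to v∈)
      ; old⁻ = λ v∈ → suc⁻ v∈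
      ; new⁺ = λ _ _ → here refl
      ; new⁻ = λ _ → end∈ E , next∈ E }
      where
      suc⁺ : ∀ {v} → ¬ (_ × v ≡ e) → v ∈ e ∷ p ∷ r → suc v ∈ zero ∷ suc p ∷ insert p r
      suc⁺ n (here refl) = ⊥-elim (n (t , refl))
      suc⁺ n (there (here refl)) = there (here refl)
      suc⁺ n (there (there v∈)) = there (there (insert⁺ p r v∈))
      suc⁻ : ∀ {v} → suc v ∈ zero ∷ suc p ∷ insert p r → v ∈ verts X × ¬ (_ × v ≡ e)
      suc⁻ (there (here refl)) = from (there (here refl)) , λ { (_ , refl) → irr-adj G ep }
      suc⁻ (there (there v∈)) = from (there (there (insert⁻ p r v∈))) ,
        λ { (_ , refl) → unique-head (unique s) (there (insert⁻ p r v∈)) }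

-- Joining trees

module _ {m k : ℕ} {G : Graph m} {K : Graph k} (f : Fin m → Fin k) where

  simple-map : (∀ {x y} → f x ≡ f y → x ≡ y) → (∀ {x y} → Adj G x y → Adj K (f x) (f y)) →
    ∀ {l} → Simple G l → Simple K (map f l)
  simple-map inj pres (k , u) = Linkedₚ.map⁺ (Linked.map pres k) , Uniqueₚ.map⁺ inj u

  path-map : (∀ {x y} → f x ≡ f y → x ≡ y) → (∀ {x y} → Adj G x y → Adj K (f x) (f y)) →
    (X : Path G) → Σ (Path K) λ Y → verts Y ≡ map f (verts X)
  path-map inj pres X with verts X | simple X | path-cases X
  ... | _ | s | a , l , refl = path (simple-map inj pres s) , refl

  last-map⁻ : ∀ {l v} → Last (map f l) (f v) → (∀ {x y} → f x ≡ f y → x ≡ y) → Last l v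
  last-map⁻ {a ∷ []} la inj with inj (last-unique la last-one)
  ... | refl = last-one
  last-map⁻ {a ∷ b ∷ l} (last-more la) inj = last-more (last-map⁻ la inj)

  map-preimage : ∀ l → (∀ {w} → w ∈ l → ∃[ x ] w ≡ f x) → ∃[ l' ] l ≡ map f l'
  map-preimage [] h = [] , refl
  map-preimage (w ∷ l) h with h (here refl) | map-preimage l (h ∘ there)
  ... | x , refl | l' , refl = x ∷ l' , refl

  unique-map⁻ : ∀ l → Unique (map f l) → Unique l
  unique-map⁻ [] _ = []
  unique-map⁻ (x ∷ l) u = unique-∷ (λ x∈ → unique-head u (∈-map⁺ f x∈)) (unique-map⁻ l (unique-tail u))

  cycle-map⁻ : (∀ {x y} → f x ≡ f y → x ≡ y) → (∀ {x y} → Adj K (f x) (f y) → Adj G x y) →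
    ((q , _) : HasCycle K) → (∀ {w} → w ∈ verts q → ∃[ x ] w ≡ f x) → HasCycle G
  cycle-map⁻ inj refl-adj (q , len , u , r , v , eq , la , vu) h with map-preimage (verts q) h
  cycle-map⁻ inj refl-adj (q , len , u , r , v , eq , la , vu) h | l' , eq' with verts q | simple q
  cycle-map⁻ inj refl-adj (q , len , u , r , v , refl , la , vu) h | [] , () | _ | _
  cycle-map⁻ inj refl-adj (q , len , u , r , v , refl , la , vu) h | x ∷ l' , refl | _ | (k , un) with h (last-∈ la)
  ... | y , refl = path {G = G} (Linked.map refl-adj (Linkedₚ.map⁻ k) , unique-map⁻ (x ∷ l') un) ,
    subst (3 ≤_) (List.length-map f (x ∷ l')) len , x , l' , y , refl , last-map⁻ la inj , refl-adj vu

≢-≢⇒≡ : ∀ {a b c : Bool} → a ≢ b → b ≢ c → a ≡ c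
≢-≢⇒≡ p q = trans (Bool.¬-not p) (sym (Bool.¬-not (q ∘ sym)))

Crossing : ∀ {m} → Graph m → (Fin m → Bool) → Fin m → Fin m → Set
Crossing G χ α β = ∀ {x y} → Adj G x y → χ x ≡ χ α → χ y ≡ χ β → x ≡ α × y ≡ β

module _ {m : ℕ} {G : Graph m} (χ : Fin m → Bool) where

  -- Crossing the bridge back would visit `α` a second time, so a simple path crosses at most once.
  -- The last clause prepares for cycles: a crossing path from `α` to `β` is just the bridge.
  bridge-crossing : ∀ {α β u r v} → χ α ≢ χ β → Crossing G χ α β → Crossing G χ β α →
    Simple G (u ∷ r) → χ u ≡ χ α → Last (u ∷ r) v →
    (∀ {w} → w ∈ u ∷ r → χ w ≡ χ α) ⊎
    (α ∈ u ∷ r × β ∈ u ∷ r × χ v ≡ χ β × (u ≡ α → v ≡ β → length r ≤ 1))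
  bridge-crossing ne c c' s cu last-one = inj₁ λ { (here refl) → cu }
  bridge-crossing {α} {β} {u} {y ∷ r} ne c c' s@((uy ∷ _) , un) cu (last-more la) with χ y Bool.≟ χ α
  ... | yes cy with bridge-crossing ne c c' (simple-tail s) cy la
  ...   | inj₁ h = inj₁ λ { (here refl) → cu ; (there w∈) → h w∈ }
  ...   | inj₂ (α∈ , β∈ , cv , _) = inj₂ (there α∈ , there β∈ , cv , λ { refl → ⊥-elim (unique-head un α∈) })
  bridge-crossing {α} {β} {u} {y ∷ r} {v} ne c c' s@((uy ∷ _) , un) cu (last-more la) | no cy
    with cyβ ← ≢-≢⇒≡ cy ne
    with c uy cu cyβ
  ... | refl , refl with bridge-crossing (ne ∘ sym) c' c (simple-tail s) cyβ la
  ...   | inj₂ (_ , α∈ , _) = ⊥-elim (unique-head un α∈)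
  ...   | inj₁ h = inj₂ (here refl , there (here refl) , h (last-∈ la) , λ _ → ends la)
    where
    ends : ∀ {v} → Last (y ∷ r) v → v ≡ y → length (y ∷ r) ≤ 1
    ends last-one _ = s≤s z≤n
    ends (last-more l) refl = ⊥-elim (unique-head (unique-tail un) (last-∈ l))

  -- If the cycle left the side of `u`, its closing edge would have to cross back, hence be the
  -- bridge too; the cycle would then have only the two vertices of the bridge.
  bridge-cycle : ∀ {α β} → χ α ≢ χ β → Crossing G χ α β → Crossing G χ β α →
    ((q , _ , u , _) : HasCycle G) → χ u ≡ χ α → ∀ {w} → w ∈ verts q → χ w ≡ χ α
  bridge-cycle ne c c' (q , len , u , r , v , eq , la , vu) cu w∈ with verts q | simple q
  bridge-cycle ne c c' (q , len , u , r , v , refl , la , vu) cu w∈ | _ | s with bridge-crossing ne c c' s cu la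
  ... | inj₁ h = h w∈
  ... | inj₂ (_ , _ , cv , short) with c' vu cv cu
  ...   | v≡ , u≡ with ℕ.≤-trans len (s≤s (short u≡ v≡))
  ...     | s≤s (s≤s ())

module Join {m k : ℕ} (G : Graph m) (K : Graph k) (a : Fin m) (b : Fin k) where

  JoinAdj : Fin m ⊎ Fin k → Fin m ⊎ Fin k → Set
  JoinAdj (inj₁ x) (inj₁ y) = Adj G x y
  JoinAdj (inj₁ x) (inj₂ y) = x ≡ a × y ≡ b
  JoinAdj (inj₂ x) (inj₁ y) = y ≡ a × x ≡ b
  JoinAdj (inj₂ x) (inj₂ y) = Adj K x y

  joinAdj-sym : ∀ x y → JoinAdj x y → JoinAdj y x
  joinAdj-sym (inj₁ x) (inj₁ y) h = sym-adj G h
  joinAdj-sym (inj₁ x) (inj₂ y) h = h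
  joinAdj-sym (inj₂ x) (inj₁ y) h = h
  joinAdj-sym (inj₂ x) (inj₂ y) h = sym-adj K h

  joinAdj-irr : ∀ x → ¬ JoinAdj x x
  joinAdj-irr (inj₁ x) h = irr-adj G h
  joinAdj-irr (inj₂ x) h = irr-adj K h

  join : Graph (m + k)
  join = record
    { Adj = λ x y → JoinAdj (splitAt m x) (splitAt m y)
    ; sym-adj = λ {x} {y} → joinAdj-sym (splitAt m x) (splitAt m y)
    ; irr-adj = λ {x} → joinAdj-irr (splitAt m x) }

  left : Fin m → Fin (m + k)
  left = _↑ˡ k

  right : Fin k → Fin (m + k)
  right = m ↑ʳ_

  left-injective : ∀ {x y} → left x ≡ left y → x ≡ y
  left-injective {x} {y} = Fin.↑ˡ-injective k x y

  right-injective : ∀ {x y} → right x ≡ right y → x ≡ y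
  right-injective {x} {y} = Fin.↑ʳ-injective m x y

  left≢right : ∀ {x y} → left x ≢ right y
  left≢right {x} {y} eq with trans (sym (Fin.splitAt-↑ˡ m x k)) (trans (cong (splitAt m) eq) (Fin.splitAt-↑ʳ m k y))
  ... | ()

  left-adj : ∀ {x y} → Adj G x y → Adj join (left x) (left y)
  left-adj {x} {y} h rewrite Fin.splitAt-↑ˡ m x k | Fin.splitAt-↑ˡ m y k = h

  left-adj⁻ : ∀ {x y} → Adj join (left x) (left y) → Adj G x y
  left-adj⁻ {x} {y} h rewrite Fin.splitAt-↑ˡ m x k | Fin.splitAt-↑ˡ m y k = h

  right-adj : ∀ {x y} → Adj K x y → Adj join (right x) (right y)
  right-adj {x} {y} h rewrite Fin.splitAt-↑ʳ m k x | Fin.splitAt-↑ʳ m k y = h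

  right-adj⁻ : ∀ {x y} → Adj join (right x) (right y) → Adj K x y
  right-adj⁻ {x} {y} h rewrite Fin.splitAt-↑ʳ m k x | Fin.splitAt-↑ʳ m k y = h

  bridge-adj : Adj join (left a) (right b)
  bridge-adj rewrite Fin.splitAt-↑ˡ m a k | Fin.splitAt-↑ʳ m k b = refl , refl

  side : ∀ x → (∃[ y ] x ≡ left y) ⊎ (∃[ y ] x ≡ right y)
  side x with splitAt m x | Fin.join-splitAt m k x
  ... | inj₁ y | eq = inj₁ (y , sym eq)
  ... | inj₂ y | eq = inj₂ (y , sym eq)

  join-star : (∀ x y → Star (Adj G) x y) → (∀ x y → Star (Adj K) x y) → ∀ x y → Star (Adj join) x y
  join-star g h x y with side x | side y
  ... | inj₁ (x' , refl) | inj₁ (y' , refl) = Star.gmap left left-adj (g x' y')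
  ... | inj₂ (x' , refl) | inj₂ (y' , refl) = Star.gmap right right-adj (h x' y')
  ... | inj₁ (x' , refl) | inj₂ (y' , refl) =
    Star.gmap left left-adj (g x' a) ◅◅ bridge-adj ◅ Star.gmap right right-adj (h b y')
  ... | inj₂ (x' , refl) | inj₁ (y' , refl) =
    Star.gmap right right-adj (h x' b) ◅◅ sym-adj join bridge-adj ◅ Star.gmap left left-adj (g a y')

  isLeft : Fin m ⊎ Fin k → Bool
  isLeft (inj₁ _) = true
  isLeft (inj₂ _) = false

  χ : Fin (m + k) → Bool
  χ x = isLeft (splitAt m x)

  χ-left : ∀ x → χ (left x) ≡ true
  χ-left x rewrite Fin.splitAt-↑ˡ m x k = refl

  χ-right : ∀ x → χ (right x) ≡ false
  χ-right x rewrite Fin.splitAt-↑ʳ m k x = refl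

  crossing : ∀ {x y} → Adj join x y → χ x ≡ true → χ y ≡ false → x ≡ left a × y ≡ right b
  crossing {x} {y} h cx cy with side x | side y
  ... | inj₁ (x' , refl) | inj₁ (y' , refl) with trans (sym cy) (χ-left y')
  ...   | ()
  crossing h cx cy | inj₂ (x' , refl) | _ with trans (sym cx) (χ-right x')
  ...   | ()
  crossing h cx cy | inj₁ (x' , refl) | inj₂ (y' , refl)
    rewrite Fin.splitAt-↑ˡ m x' k | Fin.splitAt-↑ʳ m k y' = cong left (proj₁ h) , cong right (proj₂ h)

  χ-ends : χ (left a) ≢ χ (right b)
  χ-ends eq with trans (sym (χ-left a)) (trans eq (χ-right b))
  ... | ()

  crossing-lr : Crossing join χ (left a) (right b)
  crossing-lr h cx cy = crossing h (trans cx (χ-left a)) (trans cy (χ-right b))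

  crossing-rl : Crossing join χ (right b) (left a)
  crossing-rl h cx cy with crossing-lr (sym-adj join h) cy cx
  ... | x≡ , y≡ = y≡ , x≡

  join-acyclic : ¬ HasCycle G → ¬ HasCycle K → ¬ HasCycle join
  join-acyclic ag ak cyc@(_ , _ , u , _) with side u
  ... | inj₁ (u' , refl) = ag (cycle-map⁻ left left-injective left-adj⁻ cyc λ {w} w∈ → isLeft-all {w}
      (bridge-cycle χ χ-ends crossing-lr crossing-rl cyc (trans (χ-left u') (sym (χ-left a))) w∈))
    where
    isLeft-all : ∀ {w} → χ w ≡ χ (left a) → ∃[ x ] w ≡ left x
    isLeft-all {w} c with side w
    ... | inj₁ h = h
    ... | inj₂ (x , refl) with trans (sym (χ-right x)) (trans c (χ-left a))
    ...   | ()
  ... | inj₂ (u' , refl) = ak (cycle-map⁻ right right-injective right-adj⁻ cyc λ {w} w∈ → isRight-all {w}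
      (bridge-cycle χ (χ-ends ∘ sym) crossing-rl crossing-lr cyc (trans (χ-right u') (sym (χ-right b))) w∈))
    where
    isRight-all : ∀ {w} → χ w ≡ χ (right b) → ∃[ x ] w ≡ right x
    isRight-all {w} c with side w
    ... | inj₂ h = h
    ... | inj₁ (x , refl) with trans (sym (χ-left x)) (trans c (χ-right b))
    ...   | ()

  join-tree : IsTree G → IsTree K → IsTree join
  join-tree (pos , cg , ag) (_ , ck , ak) =
    ℕ.≤-trans pos (ℕ.m≤m+n m k) ,
    star-connected (join-star (connected-star cg) (connected-star ck)) , join-acyclic ag ak

  lift-left : (X : Path G) → Σ (Path join) λ Y → verts Y ≡ map left (verts X)
  lift-left = path-map left left-injective left-adj

  lift-right : (X : Path K) → Σ (Path join) λ Y → verts Y ≡ map right (verts X)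
  lift-right = path-map right right-injective right-adj

point : Graph 1
point = record { Adj = λ _ _ → ⊥ ; sym-adj = λ () ; irr-adj = λ () }

point-tree : IsTree point
point-tree = s≤s z≤n , star-connected (λ { zero zero → ε }) , no-cycle
  where
  no-cycle : ¬ HasCycle point
  no-cycle (_ , _ , _ , _ , _ , _ , _ , ())

-- Families of paths

record Family (n : ℕ) : Set₁ where
  field
    {size} : ℕ
    {tree} : Graph size
    isTree : IsTree tree
    paths : Fin n → Path tree
open Family public

Vertex : ∀ {n} → Family n → Set
Vertex F = Fin (size F)

vertices : ∀ {n} (F : Family n) → Fin n → List (Vertex F)
vertices F x = verts (paths F x)

acyclic : ∀ {n} (F : Family n) → ¬ HasCycle (tree F)
acyclic F = proj₂ (proj₂ (isTree F))

Sub : ∀ {n} → Family n → Fin n → Fin n → Set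
Sub F x y = ∀ {v} → v ∈ vertices F x → v ∈ vertices F y

Strict : ∀ {n} → Family n → Fin n → Fin n → Set
Strict F x y = Sub F x y × ¬ Sub F y x

EndOf : ∀ {n} (F : Family n) → Fin n → Vertex F → Vertex F → Set
EndOf F x = EndAt (tree F) (vertices F x)

-- Cutting paths back at an end

module Truncation {n : ℕ} (F : Family n) {e p : Vertex F} (ep : Adj (tree F) e p)
  (A : Fin n → Set) (A? : ∀ x → Dec (A x)) (A-end : ∀ {x} → A x → EndOf F x e p) where

  open Subdivide (tree F) e p public

  image : ∀ x → Σ (Path subdivision) (Image ep (paths F x) (A x))
  image x with A? x
  ... | yes a = truncate ep (acyclic F) (paths F x) (A-end a) a
  ... | no n = subdivide ep (acyclic F) (paths F x) n

  truncated : Family n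
  truncated = record { isTree = subdivision-tree ep (isTree F) ; paths = λ x → proj₁ (image x) }

  module I x = Image (proj₂ (image x))

  new⇒end : ∀ {x} → zero ∈ vertices truncated x → e ∈ vertices F x
  new⇒end {x} z∈ = proj₁ (I.new⁻ x z∈)

  A⇒new : ∀ {x} → A x → zero ∈ vertices truncated x
  A⇒new {x} a = I.new⁺ x (end∈ (A-end a)) (next∈ (A-end a))

  -- Containment is destroyed only when `y` loses `e` and `x` still holds it. Cutting `x` alone
  -- creates no containment: the new vertex lies in the cut path of `x`, and having it in `y`
  -- already puts `e` into the old path of `y`.
  truncated-sub⁺ : ∀ {x y} → Sub truncated x y → Sub F x y × (A y → A x ⊎ e ∉ vertices F x)
  truncated-sub⁺ {x} {y} h = sub , rule
    where
    sub : Sub F x y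
    sub {v} v∈ = decide (A? x ×-dec v ≟ e)
      where
      decide : Dec (A x × v ≡ e) → v ∈ vertices F y
      decide (yes (a , refl)) = proj₁ (I.new⁻ y (h (A⇒new a)))
      decide (no n) = proj₁ (I.old⁻ y (h (I.old⁺ x v∈ n)))
    rule : A y → A x ⊎ e ∉ vertices F x
    rule ay = decide (A? x)
      where
      decide : Dec (A x) → A x ⊎ e ∉ vertices F x
      decide (yes ax) = inj₁ ax
      decide (no n) = inj₂ λ e∈ → proj₂ (I.old⁻ y (h (I.old⁺ x e∈ (n ∘ proj₁)))) (ay , refl)

  truncated-sub⁻ : ∀ {x y} → Sub F x y → (A y → A x ⊎ e ∉ vertices F x) → Sub truncated x y
  truncated-sub⁻ {x} {y} h rule {zero} z∈ =
    let e∈ , p∈ = I.new⁻ x z∈ in I.new⁺ y (h e∈) (h p∈)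
  truncated-sub⁻ {x} {y} h rule {suc v} v∈ with I.old⁻ x v∈
  ... | v∈x , n = I.old⁺ y (h v∈x) λ { (ay , refl) → excluded (rule ay) v∈x n }
    where
    excluded : A x ⊎ e ∉ vertices F x → e ∈ vertices F x → ¬ (A x × e ≡ e) → ⊥
    excluded (inj₁ ax) _ n = n (ax , refl)
    excluded (inj₂ e∉) e∈ _ = e∉ e∈

  new-end : ∀ {x} → A x → EndOf truncated x zero (suc p)
  new-end {x} a = record
    { end∈ = A⇒new a
    ; next∈ = I.old⁺ x (next∈ (A-end a)) λ { (_ , refl) → irr-adj (tree F) ep }
    ; end-adj = inj₂ refl
    ; only-next = λ { {suc v} v∈ (inj₁ refl) → ⊥-elim (proj₂ (I.old⁻ x v∈) (a , refl))
                    ; {suc v} v∈ (inj₂ refl) → refl } }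

  other-adj : ∀ {e' p'} → e' ≢ e → e' ≢ p → Adj (tree F) e' p' → Adj (tree truncated) (suc e') (suc p')
  other-adj ne np h = h , λ { (inj₁ (eq , _)) → ne eq ; (inj₂ (eq , _)) → np eq }

  other-∈⁺ : ∀ {x v} → v ≢ e → v ∈ vertices F x → suc v ∈ vertices truncated x
  other-∈⁺ {x} ne v∈ = I.old⁺ x v∈ (ne ∘ proj₂)

  old-∈⁻ : ∀ {x v} → suc v ∈ vertices truncated x → v ∈ vertices F x
  old-∈⁻ {x} v∈ = proj₁ (I.old⁻ x v∈)

  other-end : ∀ {e' p' x} → e' ≢ e → e' ≢ p → EndOf F x e' p' → EndOf truncated x (suc e') (suc p')
  other-end {x = x} ne np E = record
    { end∈ = other-∈⁺ ne (end∈ E)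
    ; next∈ = I.old⁺ x (next∈ E) λ { (a , refl) → np (only-next (A-end a) (end∈ E) (sym-adj (tree F) (end-adj E))) }
    ; end-adj = other-adj ne np (end-adj E)
    ; only-next = λ { {zero} v∈ (inj₁ eq) → ⊥-elim (ne eq)
                    ; {zero} v∈ (inj₂ eq) → ⊥-elim (np eq)
                    ; {suc v} v∈ (h , _) → cong suc (only-next E (old-∈⁻ v∈) h) } }

-- The height tells how far a path reaches into the split edge, and heights of at least `k` mean
-- that it is not cut. Inside a cut path `y` there is room only for paths that avoid `e` or are cut
-- at least as far.
Rule : ∀ {n} (F : Family n) → Vertex F → (Fin n → Set) → (Fin n → ℕ) → ℕ → Fin n → Fin n → Set
Rule F e B f k x y = B y → f y < k → e ∉ vertices F x ⊎ (B x × f x ≤ f y)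

-- Keeps track of a second end while the first one is being cut, so that the same construction can
-- be repeated there; `∈⁺` and `∈⁻` translate its `Rule` back.
record Transfer {n : ℕ} (F F' : Family n) (e p : Vertex F) : Set where
  field
    e' p' : Vertex F'
    adj' : Adj (tree F) e p → Adj (tree F') e' p'
    end' : ∀ {x} → EndOf F x e p → EndOf F' x e' p'
    ∈⁺ : ∀ {x} → e ∈ vertices F x → e' ∈ vertices F' x
    ∈⁻ : ∀ {x} → e' ∈ vertices F' x → e ∈ vertices F x

record Staircase {n : ℕ} (F : Family n) (e p : Vertex F) (B : Fin n → Set) (f : Fin n → ℕ) (k : ℕ) : Set₁ where
  field
    family : Family n
    sub⁺ : ∀ {x y} → Sub family x y → Sub F x y × Rule F e B f k x y
    sub⁻ : ∀ {x y} → Sub F x y → Rule F e B f k x y → Sub family x y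
    transfer : ∀ {e' p'} → e' ≢ e → e' ≢ p → Transfer F family e' p'

-- Paths ending at e are cut back k times, at level j those of height f < j; longer paths reach further into the split edge.
staircase : ∀ {n} k (F : Family n) {e p} → Adj (tree F) e p → (B : Fin n → Set) → (∀ x → Dec (B x)) → (f : Fin n → ℕ) →
  (∀ {x} → B x → f x < k → EndOf F x e p) → Staircase F e p B f k
staircase zero F ep B B? f B-end = record
  { family = F
  ; sub⁺ = λ h → h , λ _ ()
  ; sub⁻ = λ h _ → h
  ; transfer = λ {e'} {p'} _ _ → record
      { e' = e' ; p' = p' ; adj' = λ h → h ; end' = λ h → h ; ∈⁺ = λ h → h ; ∈⁻ = λ h → h } }
staircase {n} (suc k) F {e} {p} ep B B? f B-end = record
  { family = family
  ; sub⁺ = λ {x} {y} h → let h₁ , r₁ = sub⁺ h ; h₀ , r₀ = truncated-sub⁺ h₁ in h₀ , rule⁺ {x} {y} r₀ r₁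
  ; sub⁻ = λ {x} {y} h r → sub⁻ (truncated-sub⁻ h (rule⁻₀ {x} {y} r)) (rule⁻₁ {x} {y} r)
  ; transfer = λ {e'} {p'} ne np →
      let module R = Transfer (transfer {suc e'} {suc p'} (λ ()) (np ∘ Fin.suc-injective)) in record
      { e' = R.e' ; p' = R.p'
      ; adj' = λ h → R.adj' (other-adj ne np h)
      ; end' = λ E → R.end' (other-end ne np E)
      ; ∈⁺ = λ v∈ → R.∈⁺ (other-∈⁺ ne v∈)
      ; ∈⁻ = λ v∈ → old-∈⁻ (R.∈⁻ v∈) } }
  where
  A : Fin n → Set
  A x = B x × f x < suc k
  open Truncation F ep A (λ x → B? x ×-dec (f x ℕ.<? suc k)) (λ (b , l) → B-end b l)
  -- The next cut splits the part of the edge adjacent to `p`, where all paths cut so far now end,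
  -- and affects only the heights below `k`.
  open Staircase (staircase k truncated {zero} {suc p} (inj₂ refl) B B? f
    (λ b l → new-end (b , ℕ.m<n⇒m<1+n l)))
  rule⁺ : ∀ {x y} → (A y → A x ⊎ e ∉ vertices F x) → Rule truncated zero B f k x y → Rule F e B f (suc k) x y
  rule⁺ {x} {y} r₀ r₁ b l with r₀ (b , l)
  ... | inj₂ e∉ = inj₁ e∉
  ... | inj₁ (bx , lx) with f y ℕ.<? k
  ...   | no nl = inj₂ (bx , ℕ.≤-trans (ℕ.≤-pred lx) (ℕ.≮⇒≥ nl))
  ...   | yes ly with r₁ b ly
  ...     | inj₁ z∉ = ⊥-elim (z∉ (A⇒new (bx , lx)))
  ...     | inj₂ h = inj₂ h
  rule⁻₀ : ∀ {x y} → Rule F e B f (suc k) x y → A y → A x ⊎ e ∉ vertices F x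
  rule⁻₀ r (b , l) with r b l
  ... | inj₁ e∉ = inj₂ e∉
  ... | inj₂ (bx , le) = inj₁ (bx , ℕ.≤-<-trans le l)
  rule⁻₁ : ∀ {x y} → Rule F e B f (suc k) x y → Rule truncated zero B f k x y
  rule⁻₁ r b l with r b (ℕ.m<n⇒m<1+n l)
  ... | inj₁ e∉ = inj₁ (e∉ ∘ new⇒end)
  ... | inj₂ h = inj₂ h

record Side {n : ℕ} (F : Family n) (e p : Vertex F) : Set₁ where
  field
    adj : Adj (tree F) e p
    B : Fin n → Set
    B? : ∀ x → Dec (B x)
    height : Fin n → ℕ
    bound : ℕ
    ends : ∀ {x} → B x → height x < bound → EndOf F x e p
  Allowed : Fin n → Fin n → Set
  Allowed = Rule F e B height bound
open Side public using (Allowed)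

-- As `e'` is not on the edge split first, the cuts there leave the second end intact, and the two
-- rules act independently.
jitter : ∀ {n} (F : Family n) {e p e' p'} → e' ≢ e → e' ≢ p → (L : Side F e p) (R : Side F e' p') →
  Σ (Family n) λ F' → (∀ {x y} → Sub F' x y → Sub F x y × Allowed L x y × Allowed R x y) ×
                      (∀ {x y} → Sub F x y → Allowed L x y → Allowed R x y → Sub F' x y)
jitter F ne np L R = right.family ,
  (λ {x} {y} h → let h₁ , r₁ = right.sub⁺ h ; h₀ , r₀ = left.sub⁺ h₁ in h₀ , r₀ , back {x} {y} r₁) ,
  λ {x} {y} h a b → right.sub⁻ (left.sub⁻ h a) (forth {x} {y} b)
  where
  module L = Side L
  module R = Side R
  module left = Staircase (staircase L.bound F L.adj L.B L.B? L.height L.ends)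
  module t = Transfer (left.transfer ne np)
  module right = Staircase (staircase R.bound left.family {t.e'} {t.p'} (t.adj' R.adj) R.B R.B? R.height
    (λ b l → t.end' (R.ends b l)))
  back : ∀ {x y} → Rule left.family t.e' R.B R.height R.bound x y → Allowed R x y
  back r b l with r b l
  ... | inj₁ e∉ = inj₁ (e∉ ∘ t.∈⁺)
  ... | inj₂ h = inj₂ h
  forth : ∀ {x y} → Allowed R x y → Rule left.family t.e' R.B R.height R.bound x y
  forth r b l with r b l
  ... | inj₁ e∉ = inj₁ (e∉ ∘ t.∈⁻)
  ... | inj₂ h = inj₂ h

-- Realizers and conjugate orders

Represents : ∀ {n} → Family n → (Fin n → Set) → Rel (Fin n) 0ℓ → Set
Represents F S R = ∀ {x y} → S x → S y → (R x y → Strict F x y) × (Strict F x y → R x y)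

CPTOn : ∀ {n} → (Fin n → Set) → Rel (Fin n) 0ℓ → Set₁
CPTOn {n} S R = Σ[ F ∈ Family n ] Represents F S R

sub? : ∀ {n} (F : Family n) x y → Dec (Sub F x y)
sub? F x y = map′ (λ h v∈ → All.lookup h v∈) (λ h → All.tabulate h) (All.all? (_∈? vertices F y) (vertices F x))

strict-trans : ∀ {n} (F : Family n) {x y z} → Strict F x y → Strict F y z → Strict F x z
strict-trans F (a , b) (c , d) = (λ v∈ → c (a v∈)) , λ h → b λ v∈ → h (c v∈)

map-⊆⁻ : ∀ {A B : Set} (f : A → B) → (∀ {x y} → f x ≡ f y → x ≡ y) → ∀ {X Y : List A} →
  (∀ {v} → v ∈ map f X → v ∈ map f Y) → ∀ {v} → v ∈ X → v ∈ Y
map-⊆⁻ f inj h v∈ with ∈-map⁻ f (h (∈-map⁺ f v∈))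
... | u , u∈ , eq = subst (_∈ _) (sym (inj eq)) u∈

map-⊆ : ∀ {A B : Set} (f : A → B) {X Y : List A} → (∀ {v} → v ∈ X → v ∈ Y) → ∀ {v} → v ∈ map f X → v ∈ map f Y
map-⊆ f h v∈ with ∈-map⁻ f v∈
... | u , u∈ , refl = ∈-map⁺ f (h u∈)

union : ∀ {n} (F F' : Family n) (C : Fin n → Set) → (∀ x → Dec (C x)) → {S : Fin n → Set} {R : Rel (Fin n) 0ℓ} →
  Represents F C R → Represents F' (λ x → S x × ¬ C x) R →
  (∀ {x y} → S x → S y → C x → ¬ C y → ¬ R x y × ¬ R y x) → CPTOn S R
union {n} F F' C C? {S} {R} rep rep' cross = U , λ {x} {y} sx sy → represents x y sx sy (C? x) (C? y)
  where
  root : ∀ {m} {T : Graph m} → IsTree T → Fin m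
  root {suc m} _ = zero
  -- The position of the bridge is immaterial, since every path stays on one side of it; any vertex
  -- serves as its end.
  open Join (tree F) (tree F') (root (isTree F)) (root (isTree F'))
  place : ∀ x → Dec (C x) → Path join
  place x (yes _) = proj₁ (lift-left (paths F x))
  place x (no _) = proj₁ (lift-right (paths F' x))
  U : Family n
  U = record { isTree = join-tree (isTree F) (isTree F') ; paths = λ x → place x (C? x) }
  _⊆_ : Path join → Path join → Set
  X ⊆ Y = ∀ {v} → v ∈ verts X → v ∈ verts Y
  sub-left : ∀ x y → let X = proj₁ (lift-left (paths F x)) ; Y = proj₁ (lift-left (paths F y)) in
    (X ⊆ Y → Sub F x y) × (Sub F x y → X ⊆ Y)
  sub-left x y rewrite proj₂ (lift-left (paths F x)) | proj₂ (lift-left (paths F y)) =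
    map-⊆⁻ left left-injective , map-⊆ left
  sub-right : ∀ x y → let X = proj₁ (lift-right (paths F' x)) ; Y = proj₁ (lift-right (paths F' y)) in
    (X ⊆ Y → Sub F' x y) × (Sub F' x y → X ⊆ Y)
  sub-right x y rewrite proj₂ (lift-right (paths F' x)) | proj₂ (lift-right (paths F' y)) =
    map-⊆⁻ right right-injective , map-⊆ right
  cross-lr : ∀ x y → ¬ (proj₁ (lift-left (paths F x)) ⊆ proj₁ (lift-right (paths F' y)))
  cross-lr x y h rewrite proj₂ (lift-left (paths F x)) | proj₂ (lift-right (paths F' y)) with path-cases (paths F x)
  ... | a , l , eq with ∈-map⁻ right (h (∈-map⁺ left (subst (a ∈_) (sym eq) (here refl))))
  ...   | _ , _ , eq' = left≢right eq'
  cross-rl : ∀ x y → ¬ (proj₁ (lift-right (paths F' x)) ⊆ proj₁ (lift-left (paths F y)))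
  cross-rl x y h rewrite proj₂ (lift-right (paths F' x)) | proj₂ (lift-left (paths F y)) with path-cases (paths F' x)
  ... | a , l , eq with ∈-map⁻ left (h (∈-map⁺ right (subst (a ∈_) (sym eq) (here refl))))
  ...   | _ , _ , eq' = left≢right (sym eq')
  represents : ∀ x y → S x → S y → (dx : Dec (C x)) (dy : Dec (C y)) →
    (R x y → place x dx ⊆ place y dy × ¬ (place y dy ⊆ place x dx)) ×
    (place x dx ⊆ place y dy × ¬ (place y dy ⊆ place x dx) → R x y)
  represents x y sx sy (yes cx) (yes cy) =
    (λ r → let a , b = proj₁ (rep cx cy) r in proj₂ (sub-left x y) a , λ h → b (proj₁ (sub-left y x) h)) ,
    λ (a , b) → proj₂ (rep cx cy) (proj₁ (sub-left x y) a , λ h → b (proj₂ (sub-left y x) h))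
  represents x y sx sy (no cx) (no cy) =
    (λ r → let a , b = proj₁ (rep' (sx , cx) (sy , cy)) r in proj₂ (sub-right x y) a , λ h → b (proj₁ (sub-right y x) h)) ,
    λ (a , b) → proj₂ (rep' (sx , cx) (sy , cy)) (proj₁ (sub-right x y) a , λ h → b (proj₂ (sub-right y x) h))
  represents x y sx sy (yes cx) (no cy) =
    (λ r → ⊥-elim (proj₁ (cross sx sy cx cy) r)) , λ (h , _) → ⊥-elim (cross-lr x y h)
  represents x y sx sy (no cx) (yes cy) =
    (λ r → ⊥-elim (proj₂ (cross sy sx cy cx) r)) , λ (h , _) → ⊥-elim (cross-rl x y h)

-- Dimension at most two, as a map into a product of two chains. The map need not be injective:
-- elements with the same pair are incomparable, which lets a weak order have a constant second
-- coordinate.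
record Realizer {n : ℕ} (C : Fin n → Set) (Q : Rel (Fin n) 0ℓ) : Set where
  field
    f g : Fin n → ℕ
    bound : ℕ
    f< : ∀ x → f x < bound
    g< : ∀ x → g x < bound
    sound : ∀ {x y} → C x → C y → Q x y → f x ≤ f y × g x ≤ g y × ¬ (f y ≤ f x × g y ≤ g x)
    complete : ∀ {x y} → C x → C y → f x ≤ f y → g x ≤ g y → ¬ (f y ≤ f x × g y ≤ g x) → Q x y

-- Three vertices are the fewest for which the edges at the two ends differ, as `jitter` demands.
module Line where

  edge three : Graph _
  edge = Join.join point point zero zero
  three = Join.join edge point (suc zero) zero

  three-tree : IsTree three
  three-tree = Join.join-tree edge point (suc zero) zero
    (Join.join-tree point point zero zero point-tree point-tree) point-tree

  forward backward : List (Fin 3)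
  forward = zero ∷ suc zero ∷ suc (suc zero) ∷ []
  backward = suc (suc zero) ∷ suc zero ∷ zero ∷ []

  forward-simple : Simple three forward
  forward-simple = ((refl , refl) ∷ (refl , refl) ∷ [-]) ,
    (((λ ()) ∷ (λ ()) ∷ []) ∷ ((λ ()) ∷ []) ∷ [] ∷ [])

  backward-simple : Simple three backward
  backward-simple = ((refl , refl) ∷ (refl , refl) ∷ [-]) ,
    (((λ ()) ∷ (λ ()) ∷ []) ∷ ((λ ()) ∷ []) ∷ [] ∷ [])

  left-end : EndAt three forward zero (suc zero)
  left-end = head-endAt (proj₂ (proj₂ three-tree)) forward-simple

  right-end : EndAt three forward (suc (suc zero)) (suc zero)
  right-end = endAt-⊆ (head-endAt (proj₂ (proj₂ three-tree)) backward-simple)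
    (there (there (here refl))) (there (here refl))
    λ { (here refl) → there (there (here refl)) ; (there (here refl)) → there (here refl) ; (there (there (here refl))) → here refl }

-- All elements start from the same path, cut on the left according to `f` and on the right
-- according to `g`. Since all heights are below `bound`, both rules always apply and containment
-- becomes the product order.
realizer⇒CPT : ∀ {n} {C : Fin n → Set} {Q : Rel (Fin n) 0ℓ} → Realizer C Q → CPTOn C Q
realizer⇒CPT {n} {C} {Q} ρ = proj₁ J , λ {x} {y} cx cy →
  (λ q → let a , b , c = sound cx cy q in into {x} {y} a b , λ h → c (out {y} {x} h)) ,
  λ (s , ns) → let a , b = out {x} {y} s in complete cx cy a b λ (c , d) → ns (into {y} {x} c d)
  where
  open Realizer ρ
  open Line
  F : Family n
  F = record { isTree = three-tree ; paths = λ _ → path forward-simple }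
  L : Side F zero (suc zero)
  L = record { adj = refl , refl ; B = λ _ → ⊤ ; B? = λ _ → yes tt ; height = f ; bound = bound ; ends = λ _ _ → left-end }
  R : Side F (suc (suc zero)) (suc zero)
  R = record { adj = refl , refl ; B = λ _ → ⊤ ; B? = λ _ → yes tt ; height = g ; bound = bound ; ends = λ _ _ → right-end }
  J = jitter F (λ ()) (λ ()) L R
  into : ∀ {x y} → f x ≤ f y → g x ≤ g y → Sub (proj₁ J) x y
  into {x} {y} a b = proj₂ (proj₂ J) {x} {y} (λ v∈ → v∈) (λ _ _ → inj₂ (tt , a)) (λ _ _ → inj₂ (tt , b))
  out : ∀ {x y} → Sub (proj₁ J) x y → f x ≤ f y × g x ≤ g y
  out {x} {y} h with proj₁ (proj₂ J) {x} {y} h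
  ... | _ , a , b = low (a tt (f< y)) , high (b tt (g< y))
    where
    low : zero ∉ forward ⊎ (⊤ × f x ≤ f y) → f x ≤ f y
    low (inj₁ n) = ⊥-elim (n (here refl))
    low (inj₂ (_ , l)) = l
    high : suc (suc zero) ∉ forward ⊎ (⊤ × g x ≤ g y) → g x ≤ g y
    high (inj₁ n) = ⊥-elim (n (there (there (here refl))))
    high (inj₂ (_ , l)) = l

subset : ∀ {n} {P : Fin n → Set} → (∀ x → Dec (P x)) → Subset n
subset P? = tabulate (λ x → does (P? x))

∈-subset⁺ : ∀ {n} {P : Fin n → Set} (P? : ∀ x → Dec (P x)) {x} → P x → x ∈ˢ subset P?
∈-subset⁺ P? {x} px = Vec.lookup⇒[]= x _ (trans (Vec.lookup∘tabulate _ x) (lemma (P? x)))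
  where
  lemma : (d : Dec _) → does d ≡ true
  lemma (yes _) = refl
  lemma (no n) = ⊥-elim (n px)

∈-subset⁻ : ∀ {n} {P : Fin n → Set} (P? : ∀ x → Dec (P x)) {x} → x ∈ˢ subset P? → P x
∈-subset⁻ {P = P} P? {x} x∈ = lemma (P? x) (trans (sym (Vec.lookup∘tabulate _ x)) (Vec.[]=⇒lookup x∈))
  where
  lemma : (d : Dec (P x)) → does d ≡ true → P x
  lemma (yes px) _ = px

module Rank {n : ℕ} {C : Fin n → Set} (C? : ∀ x → Dec (C x)) {L : Rel (Fin n) 0ℓ} (L? : Decidable L) where

  below? : ∀ x t → Dec (C t × L t x)
  below? x t = C? t ×-dec L? t x

  rank : Fin n → ℕ
  rank x = ∣ subset (below? x) ∣

  rank< : ∀ x → rank x < suc n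
  rank< x = s≤s (Subset.∣p∣≤n (subset (below? x)))

  rank-≤ : ∀ {x y} → (∀ {t} → C t → L t x → L t y) → rank x ≤ rank y
  rank-≤ {x} {y} h = Subset.p⊆q⇒∣p∣≤∣q∣ λ t∈ → let ct , l = ∈-subset⁻ (below? x) t∈ in ∈-subset⁺ (below? y) (ct , h ct l)

  rank-< : ∀ {x y} → (∀ {t} → C t → L t x → L t y) → C x → L x y → ¬ L x x → rank x < rank y
  rank-< {x} {y} h cx l irr = Subset.p⊂q⇒∣p∣<∣q∣
    ((λ t∈ → let ct , l = ∈-subset⁻ (below? x) t∈ in ∈-subset⁺ (below? y) (ct , h ct l)) ,
     x , ∈-subset⁺ (below? y) (cx , l) , λ x∈ → irr (proj₂ (∈-subset⁻ (below? x) x∈)))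

-- A transitive orientation of the incomparability graph. By Dushnik and Miller it exists exactly in
-- dimension at most two. As it depends only on the comparability graph, it passes from one
-- orientation to any other.
record Conjugate {n : ℕ} (S : Fin n → Set) (R : Rel (Fin n) 0ℓ) : Set₁ where
  field
    K : Rel (Fin n) 0ℓ
    K? : Decidable K
    irrefl : ∀ {x} → S x → ¬ K x x
    transitive : ∀ {x y z} → S x → S y → S z → K x y → K y z → K x z
    incomparable : ∀ {x y} → S x → S y → K x y → ¬ R x y × ¬ R y x
    total : ∀ {x y} → S x → S y → x ≢ y → ¬ R x y → ¬ R y x → K x y ⊎ K y x

conjugate-opposite : ∀ {n} {S : Fin n → Set} {R : Rel (Fin n) 0ℓ} → Conjugate S R → Conjugate S R
conjugate-opposite c = record
  { K = flip K ; K? = flip K? ; irrefl = irrefl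
  ; transitive = λ sx sy sz a b → transitive sz sy sx b a
  ; incomparable = λ sx sy k → let a , b = incomparable sy sx k in b , a
  ; total = λ sx sy ne a b → total sy sx (ne ∘ sym) b a }
  where open Conjugate c

conjugate-resp : ∀ {n} {S : Fin n → Set} {R Q : Rel (Fin n) 0ℓ} →
  (∀ {x y} → S x → S y → R x y → Q x y ⊎ Q y x) → (∀ {x y} → S x → S y → Q x y → R x y ⊎ R y x) →
  Conjugate S R → Conjugate S Q
conjugate-resp {S = S} {R} {Q} to from c = record
  { K = K ; K? = K? ; irrefl = irrefl ; transitive = transitive
  ; incomparable = λ sx sy k → no-edge sx sy k , no-edge' sx sy k
  ; total = λ sx sy ne a b → total sx sy ne (none sx sy a b) (none sy sx b a) }
  where
  open Conjugate c
  no-edge : ∀ {x y} → S x → S y → K x y → ¬ Q x y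
  no-edge sx sy k q with from sx sy q
  ... | inj₁ r = proj₁ (incomparable sx sy k) r
  ... | inj₂ r = proj₂ (incomparable sx sy k) r
  no-edge' : ∀ {x y} → S x → S y → K x y → ¬ Q y x
  no-edge' sx sy k q with from sy sx q
  ... | inj₁ r = proj₂ (incomparable sx sy k) r
  ... | inj₂ r = proj₁ (incomparable sx sy k) r
  none : ∀ {x y} → S x → S y → ¬ Q x y → ¬ Q y x → ¬ R x y
  none sx sy a b r with to sx sy r
  ... | inj₁ q = a q
  ... | inj₂ q = b q

record StrictOrder {n : ℕ} (Q : Rel (Fin n) 0ℓ) : Set where
  field
    Q? : Decidable Q
    Q-irrefl : ∀ {x} → ¬ Q x x
    Q-trans : ∀ {x y z} → Q x y → Q y z → Q x z
  Q-asym : ∀ {x y} → Q x y → ¬ Q y x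
  Q-asym a b = Q-irrefl (Q-trans a b)

module _ {n : ℕ} {S : Fin n → Set} (S? : ∀ x → Dec (S x)) {Q : Rel (Fin n) 0ℓ} (σ : StrictOrder Q) where

  open StrictOrder σ

  module Extension (c : Conjugate S Q) where
    open Conjugate c
    L : Rel (Fin n) 0ℓ
    L x y = Q x y ⊎ K x y
    open Rank S? {L} (λ x y → Q? x y ⊎-dec K? x y) public
    -- In a mixed chain, say `Q x y` and `K y z`, the wrong directions are excluded: `Q z x` would
    -- give `Q z y`, and `K z x` would give `K y x`, both against the incomparability of `K`-related
    -- pairs.
    L-trans : ∀ {x y z} → S x → S y → S z → L x y → L y z → L x z
    L-trans sx sy sz (inj₁ a) (inj₁ b) = inj₁ (Q-trans a b)
    L-trans sx sy sz (inj₂ a) (inj₂ b) = inj₂ (transitive sx sy sz a b)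
    L-trans {x} {y} {z} sx sy sz (inj₁ a) (inj₂ b) with Q? x z | Q? z x | x ≟ z
    ... | yes h | _ | _ = inj₁ h
    ... | no _ | yes h | _ = ⊥-elim (proj₂ (incomparable sy sz b) (Q-trans h a))
    ... | no _ | no _ | yes refl = ⊥-elim (proj₂ (incomparable sy sz b) a)
    ... | no p | no q | no ne with total sx sz ne p q
    ...   | inj₁ k = inj₂ k
    ...   | inj₂ k = ⊥-elim (proj₂ (incomparable sy sx (transitive sy sz sx b k)) a)
    L-trans {x} {y} {z} sx sy sz (inj₂ a) (inj₁ b) with Q? x z | Q? z x | x ≟ z
    ... | yes h | _ | _ = inj₁ h
    ... | no _ | yes h | _ = ⊥-elim (proj₂ (incomparable sx sy a) (Q-trans b h))
    ... | no _ | no _ | yes refl = ⊥-elim (proj₂ (incomparable sx sy a) b)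
    ... | no p | no q | no ne with total sx sz ne p q
    ...   | inj₁ k = inj₂ k
    ...   | inj₂ k = ⊥-elim (proj₂ (incomparable sz sy (transitive sz sx sy k a)) b)
    L-rank : ∀ {x y} → S x → S y → L x y → rank x < rank y
    L-rank {x} {y} sx sy l = rank-< (λ st tx → L-trans st sx sy tx l) sx l
      λ { (inj₁ q) → Q-irrefl q ; (inj₂ k) → irrefl sx k }

  -- The unions of `Q` with `K` and with the opposite of `K` are linear orders on `S` whose
  -- intersection is `Q`; their ranks are the two coordinates.
  conjugate⇒realizer : Conjugate S Q → Realizer S Q
  conjugate⇒realizer c = record
    { f = E.rank ; g = E'.rank ; bound = suc n ; f< = E.rank< ; g< = E'.rank<
    ; sound = λ sx sy q → ℕ.<⇒≤ (E.L-rank sx sy (inj₁ q)) , ℕ.<⇒≤ (E'.L-rank sx sy (inj₁ q)) ,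
        λ (a , _) → ℕ.<⇒≱ (E.L-rank sx sy (inj₁ q)) a
    ; complete = complete }
    where
    open Conjugate c
    module E = Extension c
    module E' = Extension (conjugate-opposite c)
    complete : ∀ {x y} → S x → S y → E.rank x ≤ E.rank y → E'.rank x ≤ E'.rank y →
      ¬ (E.rank y ≤ E.rank x × E'.rank y ≤ E'.rank x) → Q x y
    complete {x} {y} sx sy a b n with Q? x y | Q? y x | x ≟ y
    ... | yes q | _ | _ = q
    ... | no _ | yes q | _ = ⊥-elim (ℕ.<⇒≱ (E.L-rank sy sx (inj₁ q)) a)
    ... | no _ | no _ | yes refl = ⊥-elim (n (a , b))
    ... | no p | no q | no ne with total sx sy ne p q
    ...   | inj₁ k = ⊥-elim (ℕ.<⇒≱ (E'.L-rank sy sx (inj₂ k)) b)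
    ...   | inj₂ k = ⊥-elim (ℕ.<⇒≱ (E.L-rank sy sx (inj₂ k)) a)

  module _ (inc-trans : ∀ {x y z} → S x → S y → S z → ¬ Q x y → ¬ Q y x → ¬ Q y z → ¬ Q z y → ¬ Q x z) where

    open Rank S? {Q} Q?

    weak⇒rank : ∀ {x y} → S x → S y → Q x y → rank x < rank y
    weak⇒rank sx sy q = rank-< (λ _ t → Q-trans t q) sx q Q-irrefl

    -- In a weak order, incomparable elements have the same elements below them, hence the same
    -- rank.
    rank⇒weak : ∀ {x y} → S x → S y → rank x < rank y → Q x y
    rank⇒weak {x} {y} sx sy l with Q? x y | Q? y x
    ... | yes q | _ = q
    ... | no _ | yes q = ⊥-elim (ℕ.<-asym l (weak⇒rank sy sx q))
    ... | no p | no q = ⊥-elim (ℕ.<⇒≱ l (rank-≤ below))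
      where
      below : ∀ {t} → S t → Q t y → Q t x
      below {t} st ty with Q? t x
      ... | yes tx = tx
      ... | no p' = ⊥-elim (inc-trans st sx sy p' (λ xt → p (Q-trans xt ty)) p q ty)

    -- The constant second coordinate is what allows one end of the paths to stay unsplit.
    weak⇒realizer : Σ[ ρ ∈ Realizer S Q ] (∀ x → Realizer.g ρ x ≡ 0)
    weak⇒realizer = record
      { f = rank ; g = λ _ → 0 ; bound = suc n ; f< = rank< ; g< = λ _ → s≤s z≤n
      ; sound = λ sx sy q → ℕ.<⇒≤ (weak⇒rank sx sy q) , z≤n , λ (a , _) → ℕ.<⇒≱ (weak⇒rank sx sy q) a
      ; complete = λ sx sy _ _ h → rank⇒weak sx sy (ℕ.≰⇒> λ a → h (a , z≤n)) } , λ _ → refl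

-- Segments of a path

minimum : ∀ {A : Set} (f : A → ℕ) a l → ∃[ v ] v ∈ a ∷ l × (∀ {w} → w ∈ a ∷ l → f v ≤ f w)
minimum f a [] = a , here refl , λ { (here refl) → ℕ.≤-refl }
minimum f a (b ∷ l) with minimum f b l
... | v , v∈ , h with ℕ.≤-total (f a) (f v)
...   | inj₁ le = a , here refl , λ { (here refl) → ℕ.≤-refl ; (there w∈) → ℕ.≤-trans le (h w∈) }
...   | inj₂ le = v , there v∈ , λ { (here refl) → le ; (there w∈) → h w∈ }

maximum : ∀ {A : Set} (f : A → ℕ) a l → ∃[ v ] v ∈ a ∷ l × (∀ {w} → w ∈ a ∷ l → f w ≤ f v)
maximum f a [] = a , here refl , λ { (here refl) → ℕ.≤-refl }
maximum f a (b ∷ l) with maximum f b l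
... | v , v∈ , h with ℕ.≤-total (f a) (f v)
...   | inj₁ le = v , there v∈ , λ { (here refl) → le ; (there w∈) → h w∈ }
...   | inj₂ le = a , here refl , λ { (here refl) → ℕ.≤-refl ; (there w∈) → ℕ.≤-trans (h w∈) le }

position : ∀ {m} → List (Fin m) → Fin m → ℕ
position [] v = 0
position (a ∷ l) v with v ≟ a
... | yes _ = 0
... | no _ = suc (position l v)

position-injective : ∀ {m} {l : List (Fin m)} {u v} → u ∈ l → v ∈ l → position l u ≡ position l v → u ≡ v
position-injective {l = a ∷ l} {u} {v} u∈ v∈ eq with u ≟ a | v ≟ a
... | yes refl | yes refl = refl
position-injective (here h) _ eq | no n | no _ = ⊥-elim (n h)
position-injective (there u∈) (here h) eq | no _ | no n = ⊥-elim (n h)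
position-injective (there u∈) (there v∈) eq | no _ | no _ = position-injective u∈ v∈ (ℕ.suc-injective eq)

position-second : ∀ {m} {a b : Fin m} {l} → a ≢ b → position (a ∷ b ∷ l) b ≡ 1
position-second {a = a} {b} ne with b ≟ a
... | yes refl = ⊥-elim (ne refl)
... | no _ with b ≟ b
...   | yes _ = refl
...   | no n = ⊥-elim (n refl)

position-first : ∀ {m} {a : Fin m} {l} → position (a ∷ l) a ≡ 0
position-first {a = a} with a ≟ a
... | yes _ = refl
... | no n = ⊥-elim (n refl)

position-later : ∀ {m} {a v : Fin m} {l} → a ≢ v → position (a ∷ l) v ≡ suc (position l v)
position-later {a = a} {v} ne with v ≟ a
... | yes refl = ⊥-elim (ne refl)
... | no _ = refl

Next : ℕ → ℕ → Set
Next i j = j ≡ suc i ⊎ i ≡ suc j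

-- A chord would close a cycle, so vertices of the path that are adjacent in the tree are
-- consecutive in the list.
position-adj : ∀ {m} {G : Graph m} → ¬ HasCycle G → ∀ {l u v} → Simple G l → u ∈ l → v ∈ l → Adj G u v →
  Next (position l u) (position l v)
position-adj {G = G} acyclic s (here refl) (here refl) uv = ⊥-elim (irr-adj G uv)
position-adj acyclic {a ∷ b ∷ l} s (here refl) (there v∈) uv with second-unique acyclic s v∈ uv
... | refl = inj₁ (trans (position-second (simple-head≢ s (here refl))) (cong suc (sym position-first)))
position-adj {G = G} acyclic {a ∷ b ∷ l} s (there u∈) (here refl) uv with second-unique acyclic s u∈ (sym-adj G uv)
... | refl = inj₂ (trans (position-second (simple-head≢ s (here refl))) (cong suc (sym position-first)))
position-adj acyclic {a ∷ l} s (there u∈) (there v∈) uv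
  rewrite position-later {l = l} (simple-head≢ s u∈) | position-later {l = l} (simple-head≢ s v∈)
  with position-adj acyclic (simple-tail s) u∈ v∈ uv
... | inj₁ eq = inj₁ (cong suc eq)
... | inj₂ eq = inj₂ (cong suc eq)

module Segments {m : ℕ} {G : Graph m} (noCycle : ¬ HasCycle G) {z : List (Fin m)} (sz : Simple G z) where

  pos : Fin m → ℕ
  pos = position z

  -- Positions along a path inside z change by one at each step, so no intermediate position is skipped.
  no-skip : ∀ {a l v w} → Linked (Adj G) (a ∷ l) → (∀ {u} → u ∈ a ∷ l → u ∈ z) → v ∈ a ∷ l → w ∈ z →
    (pos a ≤ pos w × pos w ≤ pos v) ⊎ (pos v ≤ pos w × pos w ≤ pos a) → w ∈ a ∷ l
  no-skip k sub (here refl) w∈ (inj₁ (le , ge)) = here (position-injective w∈ (sub (here refl)) (ℕ.≤-antisym ge le))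
  no-skip k sub (here refl) w∈ (inj₂ (le , ge)) = here (position-injective w∈ (sub (here refl)) (ℕ.≤-antisym ge le))
  no-skip {a} {b ∷ l} {v} {w} (ab ∷ k) sub (there v∈) w∈ btw with w ≟ a
  ... | yes eq = here eq
  ... | no ne = there (no-skip k (sub ∘ there) v∈ w∈ (shift btw))
    where
    differ : pos w ≢ pos a
    differ eq = ne (position-injective w∈ (sub (here refl)) eq)
    step : Next (pos a) (pos b)
    step = position-adj noCycle sz (sub (here refl)) (sub (there (here refl))) ab
    shift : (pos a ≤ pos w × pos w ≤ pos v) ⊎ (pos v ≤ pos w × pos w ≤ pos a) →
            (pos b ≤ pos w × pos w ≤ pos v) ⊎ (pos v ≤ pos w × pos w ≤ pos b)
    shift (inj₁ (le , ge)) = inj₁ (up step , ge)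
      where
      up : Next (pos a) (pos b) → pos b ≤ pos w
      up (inj₁ eq) = subst (_≤ pos w) (sym eq) (ℕ.≤∧≢⇒< le (differ ∘ sym))
      up (inj₂ eq) = ℕ.≤-trans (subst (pos b ≤_) (sym eq) (ℕ.n≤1+n _)) le
    shift (inj₂ (le , ge)) = inj₂ (le , down step)
      where
      down : Next (pos a) (pos b) → pos w ≤ pos b
      down (inj₁ eq) = ℕ.≤-trans ge (subst (pos a ≤_) (sym eq) (ℕ.n≤1+n _))
      down (inj₂ eq) = ℕ.≤-pred (subst (pos w <_) eq (ℕ.≤∧≢⇒< ge differ))

  -- The list begins on one side of `w`; whichever of `u` and `v` lies on the other side completes
  -- the pair to which `no-skip` applies.
  convex : ∀ {l u v w} → Linked (Adj G) l → (∀ {u} → u ∈ l → u ∈ z) → u ∈ l → v ∈ l → w ∈ z →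
    pos u ≤ pos w → pos w ≤ pos v → w ∈ l
  convex {a ∷ l} {u} {v} {w} k sub u∈ v∈ w∈ le ge with ℕ.≤-total (pos a) (pos w)
  ... | inj₁ h = no-skip k sub v∈ w∈ (inj₁ (h , ge))
  ... | inj₂ h = no-skip k sub u∈ w∈ (inj₂ (le , h))

  lowest : (X : Path G) → ∃[ v ] v ∈ verts X × (∀ {w} → w ∈ verts X → pos v ≤ pos w)
  lowest X with verts X | path-cases X
  ... | _ | a , l , refl = minimum pos a l

  highest : (X : Path G) → ∃[ v ] v ∈ verts X × (∀ {w} → w ∈ verts X → pos w ≤ pos v)
  highest X with verts X | path-cases X
  ... | _ | a , l , refl = maximum pos a l

  lo hi : Path G → ℕ
  lo X = pos (proj₁ (lowest X))
  hi X = pos (proj₁ (highest X))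

  module _ {X Y : Path G} (X⊆z : ∀ {v} → v ∈ verts X → v ∈ z) (Y⊆z : ∀ {v} → v ∈ verts Y → v ∈ z) where

    segment-⊆ : lo Y ≤ lo X → hi X ≤ hi Y → ∀ {v} → v ∈ verts X → v ∈ verts Y
    segment-⊆ a b v∈ = convex (linked Y) Y⊆z (proj₁ (proj₂ (lowest Y))) (proj₁ (proj₂ (highest Y))) (X⊆z v∈)
      (ℕ.≤-trans a (proj₂ (proj₂ (lowest X)) v∈)) (ℕ.≤-trans (proj₂ (proj₂ (highest X)) v∈) b)

    ⊆-segment : (∀ {v} → v ∈ verts X → v ∈ verts Y) → lo Y ≤ lo X × hi X ≤ hi Y
    ⊆-segment h = proj₂ (proj₂ (lowest Y)) (h (proj₁ (proj₂ (lowest X)))) ,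
      proj₂ (proj₂ (highest Y)) (h (proj₁ (proj₂ (highest X))))

-- Segments of one path are intervals of positions. Two of them are unrelated when one is further
-- left at both ends, which orients the pair, or when they coincide, and then the indices decide.
below-conjugate : ∀ {n} (F : Family n) {S : Fin n → Set} {R : Rel (Fin n) 0ℓ} z →
  Represents F S R → (∀ {x} → S x → Sub F x z) → Conjugate S R
below-conjugate {n} F {S} {R} z rep below = record
  { K = K
  ; K? = λ x y → (low x ℕ.<? low y ×-dec high x ℕ.<? high y) ⊎-dec (low x ℕ.≟ low y ×-dec (high x ℕ.≟ high y ×-dec toℕ x ℕ.<? toℕ y))
  ; irrefl = λ { _ (inj₁ (a , _)) → ℕ.<-irrefl refl a ; _ (inj₂ (_ , _ , a)) → ℕ.<-irrefl refl a }
  ; transitive = λ _ _ _ → K-trans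
  ; incomparable = λ sx sy k → none sx sy k , none' sx sy k
  ; total = total }
  where
  open Segments (acyclic F) (simple (paths F z))
  low high : Fin n → ℕ
  low x = lo (paths F x)
  high x = hi (paths F x)
  K : Rel (Fin n) 0ℓ
  K x y = (low x < low y × high x < high y) ⊎ (low x ≡ low y × high x ≡ high y × toℕ x < toℕ y)
  K-trans : ∀ {x y z} → K x y → K y z → K x z
  K-trans (inj₁ (a , b)) (inj₁ (c , d)) = inj₁ (ℕ.<-trans a c , ℕ.<-trans b d)
  K-trans (inj₁ (a , b)) (inj₂ (c , d , _)) = inj₁ (subst (_ <_) c a , subst (_ <_) d b)
  K-trans (inj₂ (a , b , _)) (inj₁ (c , d)) = inj₁ (subst (_< _) (sym a) c , subst (_< _) (sym b) d)
  K-trans (inj₂ (a , b , i)) (inj₂ (c , d , j)) = inj₂ (trans a c , trans b d , ℕ.<-trans i j)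
  sub⁺ : ∀ {x y} → S x → S y → Sub F x y → low y ≤ low x × high x ≤ high y
  sub⁺ {x} {y} sx sy s = ⊆-segment {paths F x} {paths F y} (below sx) (below sy) s
  sub⁻ : ∀ {x y} → S x → S y → low y ≤ low x → high x ≤ high y → Sub F x y
  sub⁻ {x} {y} sx sy a b = segment-⊆ {paths F x} {paths F y} (below sx) (below sy) a b
  none : ∀ {x y} → S x → S y → K x y → ¬ R x y
  none sx sy k r with proj₁ (rep sx sy) r
  none sx sy (inj₁ (a , _)) r | s , _ = ℕ.<⇒≱ a (proj₁ (sub⁺ sx sy s))
  none sx sy (inj₂ (a , b , _)) r | _ , ns = ns (sub⁻ sy sx (ℕ.≤-reflexive a) (ℕ.≤-reflexive (sym b)))
  none' : ∀ {x y} → S x → S y → K x y → ¬ R y x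
  none' sx sy k r with proj₁ (rep sy sx) r
  none' sx sy (inj₁ (_ , b)) r | s , _ = ℕ.<⇒≱ b (proj₂ (sub⁺ sy sx s))
  none' sx sy (inj₂ (a , b , _)) r | _ , ns = ns (sub⁻ sx sy (ℕ.≤-reflexive (sym a)) (ℕ.≤-reflexive b))
  strict : ∀ {x y} → S x → S y → low y ≤ low x → high x ≤ high y → ¬ (low x ≤ low y × high y ≤ high x) → R x y
  strict sx sy a b n = proj₂ (rep sx sy) (sub⁻ sx sy a b , λ s → n (sub⁺ sy sx s))
  total : ∀ {x y} → S x → S y → x ≢ y → ¬ R x y → ¬ R y x → K x y ⊎ K y x
  total {x} {y} sx sy ne p q with ℕ.<-cmp (low x) (low y) | ℕ.<-cmp (high x) (high y)
  ... | tri< a _ _ | tri< b _ _ = inj₁ (inj₁ (a , b))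
  ... | tri> _ _ a | tri> _ _ b = inj₂ (inj₁ (a , b))
  ... | tri< a _ _ | tri≈ _ b _ = ⊥-elim (q (strict sy sx (ℕ.<⇒≤ a) (ℕ.≤-reflexive (sym b)) λ (c , _) → ℕ.<⇒≱ a c))
  ... | tri< a _ _ | tri> _ _ b = ⊥-elim (q (strict sy sx (ℕ.<⇒≤ a) (ℕ.<⇒≤ b) λ (c , _) → ℕ.<⇒≱ a c))
  ... | tri> _ _ a | tri≈ _ b _ = ⊥-elim (p (strict sx sy (ℕ.<⇒≤ a) (ℕ.≤-reflexive b) λ (c , _) → ℕ.<⇒≱ a c))
  ... | tri> _ _ a | tri< b _ _ = ⊥-elim (p (strict sx sy (ℕ.<⇒≤ a) (ℕ.<⇒≤ b) λ (c , _) → ℕ.<⇒≱ a c))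
  ... | tri≈ _ a _ | tri< b _ _ = ⊥-elim (p (strict sx sy (ℕ.≤-reflexive (sym a)) (ℕ.<⇒≤ b) λ (_ , c) → ℕ.<⇒≱ b c))
  ... | tri≈ _ a _ | tri> _ _ b = ⊥-elim (q (strict sy sx (ℕ.≤-reflexive a) (ℕ.<⇒≤ b) λ (_ , c) → ℕ.<⇒≱ b c))
  ... | tri≈ _ a _ | tri≈ _ b _ with ℕ.<-cmp (toℕ x) (toℕ y)
  ...   | tri< c _ _ = inj₁ (inj₂ (a , b , c))
  ...   | tri> _ _ c = inj₂ (inj₂ (sym a , sym b , c))
  ...   | tri≈ _ c _ = ⊥-elim (ne (Fin.toℕ-injective c))

-- No incomparable pair has one element in `U` and the other outside, so the two conjugate orders
-- together orient all incomparable pairs.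
conjugate-union : ∀ {n} {S : Fin n → Set} {R : Rel (Fin n) 0ℓ} (U : Fin n → Set) → (∀ x → Dec (U x)) →
  Conjugate (λ x → S x × U x) R → Conjugate (λ x → S x × ¬ U x) R →
  (∀ {x y} → S x → S y → U x → ¬ U y → R x y ⊎ R y x) → Conjugate S R
conjugate-union {n} {S} {R} U U? c d cross = record
  { K = K
  ; K? = λ x y → (U? x ×-dec (U? y ×-dec C.K? x y)) ⊎-dec (¬? (U? x) ×-dec (¬? (U? y) ×-dec D.K? x y))
  ; irrefl = λ { s (inj₁ (u , _ , k)) → C.irrefl (s , u) k ; s (inj₂ (u , _ , k)) → D.irrefl (s , u) k }
  ; transitive = λ
    { sx sy sz (inj₁ (ux , uy , k)) (inj₁ (_ , uz , k')) → inj₁ (ux , uz , C.transitive (sx , ux) (sy , uy) (sz , uz) k k')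
    ; sx sy sz (inj₁ (ux , uy , k)) (inj₂ (n , _)) → ⊥-elim (n uy)
    ; sx sy sz (inj₂ (_ , n , _)) (inj₁ (uy , _)) → ⊥-elim (n uy)
    ; sx sy sz (inj₂ (ux , uy , k)) (inj₂ (_ , uz , k')) → inj₂ (ux , uz , D.transitive (sx , ux) (sy , uy) (sz , uz) k k') }
  ; incomparable = λ
    { sx sy (inj₁ (ux , uy , k)) → C.incomparable (sx , ux) (sy , uy) k
    ; sx sy (inj₂ (ux , uy , k)) → D.incomparable (sx , ux) (sy , uy) k }
  ; total = total }
  where
  module C = Conjugate c
  module D = Conjugate d
  K : Rel (Fin n) 0ℓ
  K x y = (U x × U y × C.K x y) ⊎ (¬ U x × ¬ U y × D.K x y)
  total : ∀ {x y} → S x → S y → x ≢ y → ¬ R x y → ¬ R y x → K x y ⊎ K y x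
  total {x} {y} sx sy ne p q with U? x | U? y
  ... | yes ux | no uy with cross sx sy ux uy
  ...   | inj₁ r = ⊥-elim (p r)
  ...   | inj₂ r = ⊥-elim (q r)
  total {x} {y} sx sy ne p q | no ux | yes uy with cross sy sx uy ux
  ...   | inj₁ r = ⊥-elim (q r)
  ...   | inj₂ r = ⊥-elim (p r)
  total {x} {y} sx sy ne p q | yes ux | yes uy with C.total (sx , ux) (sy , uy) ne p q
  ...   | inj₁ k = inj₁ (inj₁ (ux , uy , k))
  ...   | inj₂ k = inj₂ (inj₁ (uy , ux , k))
  total {x} {y} sx sy ne p q | no ux | no uy with D.total (sx , ux) (sy , uy) ne p q
  ...   | inj₁ k = inj₁ (inj₂ (ux , uy , k))
  ...   | inj₂ k = inj₂ (inj₂ (uy , ux , k))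

conjugate-flip : ∀ {n} {S : Fin n → Set} {R : Rel (Fin n) 0ℓ} → Conjugate S R → Conjugate S (flip R)
conjugate-flip = conjugate-resp (λ _ _ → inj₂) (λ _ _ → inj₂)

-- Elements below z are represented by segments of the path of z, and so are the elements above z in the dual.
comparable-conjugate : ∀ {n} {S T : Fin n → Set} {R : Rel (Fin n) 0ℓ} → Decidable R →
  CPTOn S R → CPTOn S (flip R) → (∀ {x} → T x → S x) → ∀ {z} → S z → (∀ {x} → T x → R x z ⊎ R z x) → Conjugate T R
comparable-conjugate {S = S} {T} {R} R? (F , rep) (F' , rep') T⊆S {z} sz cmp =
  conjugate-union (λ x → R x z) (λ x → R? x z) below above cross
  where
  below : Conjugate (λ x → T x × R x z) R
  below = below-conjugate F z (λ (a , _) (b , _) → rep (T⊆S a) (T⊆S b))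
    (λ (t , r) → proj₁ (proj₁ (rep (T⊆S t) sz) r))
  up : ∀ {x} → T x → ¬ R x z → R z x
  up t n with cmp t
  ... | inj₁ r = ⊥-elim (n r)
  ... | inj₂ r = r
  above : Conjugate (λ x → T x × ¬ R x z) R
  above = conjugate-flip (below-conjugate F' z (λ (a , _) (b , _) → rep' (T⊆S a) (T⊆S b))
    (λ (t , n) → proj₁ (proj₁ (rep' (T⊆S t) sz) (up t n))))
  cross : ∀ {x y} → T x → T y → R x z → ¬ R y z → R x y ⊎ R y x
  cross tx ty r n = inj₁ (proj₂ (rep (T⊆S tx) (T⊆S ty))
    (strict-trans F (proj₁ (rep (T⊆S tx) sz) r) (proj₁ (rep sz (T⊆S ty)) (up ty n))))

-- Substituting a module

Replace : ∀ {n} → (Fin n → Set) → Rel (Fin n) 0ℓ → Rel (Fin n) 0ℓ → Rel (Fin n) 0ℓ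
Replace C R Q x y = (C x × C y × Q x y) ⊎ (¬ (C x × C y) × R x y)

neighbour : ∀ {m} {G : Graph m} {l u v} → Linked (Adj G) l → u ∈ l → v ∈ l → v ≢ u → ∃[ w ] w ∈ l × Adj G u w
neighbour [-] (here refl) (here refl) ne = ⊥-elim (ne refl)
neighbour (e ∷ k) (here refl) _ _ = _ , there (here refl) , e
neighbour {G = G} {u = u} (_∷_ {y = b} e k) (there u∈) _ _ with b ≟ u
... | yes refl = _ , here refl , sym-adj G e
... | no ne with neighbour {G = G} k u∈ (here refl) ne
...   | w , w∈ , h = w , there w∈ , h

-- A subpath through `e` with a further vertex has to leave `e` along an edge, and the only edge at
-- `e` leads to `p`.
next-∈ : ∀ {m} {G : Graph m} {Y e p} (X : Path G) → EndAt G Y e p → (∀ {v} → v ∈ verts X → v ∈ Y) →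
  e ∈ verts X → ∃[ v ] v ∈ verts X × v ≢ e → p ∈ verts X
next-∈ {G = G} X E sub e∈ (v , v∈ , ne) with neighbour {G = G} (linked X) e∈ v∈ ne
... | w , w∈ , h = subst (_∈ verts X) (only-next E (sub w∈) h) w∈

module Module {n : ℕ} {S C : Fin n → Set} (S? : ∀ x → Dec (S x)) (C? : ∀ x → Dec (C x)) (C⊆S : ∀ {x} → C x → S x)
  {R Q : Rel (Fin n) 0ℓ} (R? : Decidable R)
  (below-all : ∀ {z x y} → S z → ¬ C z → C x → C y → R z x → R z y)
  (above-all : ∀ {z x y} → S z → ¬ C z → C x → C y → R x z → R y z)
  {c₀ c : Fin n} (cc₀ : C c₀) (cc : C c) (c₀<c : R c₀ c) where

  Below Above : Fin n → Set
  Below w = S w × ¬ C w × R w c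
  Above z = S z × ¬ C z × R c z

  below? : ∀ w → Dec (Below w)
  below? w = S? w ×-dec (¬? (C? w) ×-dec R? w c)

  above? : ∀ z → Dec (Above z)
  above? z = S? z ×-dec (¬? (C? z) ×-dec R? c z)

  -- The path H replaces all paths of C. Its end q is then split by the values of the first coordinate of a realizer of Q,
  -- and the end q' by those of the second one, unless the latter is constant.
  record Frame (F : Family n) (ρ : Realizer C Q) : Set where
    field
      H : Path (tree F)
      q p q' p' : Vertex F
      end : EndAt (tree F) (verts H) q p
      end' : EndAt (tree F) (verts H) q' p'
      q'≢q : q' ≢ q
      q'≢p : q' ≢ p
      split' : Bool
      flat : split' ≡ false → ∀ x → Realizer.g ρ x ≡ 0
      c⊆H : ∀ {v} → v ∈ vertices F c → v ∈ verts H
      H⊆above : ∀ {z} → Above z → ∀ {v} → v ∈ verts H → v ∈ vertices F z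
      H⊆ : ∀ {v} → v ∈ verts H → v ≡ q ⊎ (v ≡ q' × split' ≡ true) ⊎ v ∈ vertices F c
      below-≢ : ∀ {w} → Below w → ∃[ v ] v ∈ vertices F w × v ≢ q
      below-≢' : split' ≡ true → ∀ {w} → Below w → ∃[ v ] v ∈ vertices F w × v ≢ q'

  module Substitute (F : Family n) (rep : Represents F S R) (ρ : Realizer C Q) (frame : Frame F ρ) where

    open Frame frame
    open Realizer ρ

    place : ∀ x → Dec (C x) → Path (tree F)
    place x (yes _) = H
    place x (no _) = paths F x

    F₀ : Family n
    F₀ = record { isTree = isTree F ; paths = λ x → place x (C? x) }

    in⁺ : ∀ {x v} → C x → v ∈ verts H → v ∈ vertices F₀ x
    in⁺ {x} cx v∈ with C? x
    ... | yes _ = v∈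
    ... | no n = ⊥-elim (n cx)

    in⁻ : ∀ {x v} → C x → v ∈ vertices F₀ x → v ∈ verts H
    in⁻ {x} cx v∈ with C? x
    ... | yes _ = v∈
    ... | no n = ⊥-elim (n cx)

    out⁺ : ∀ {x v} → ¬ C x → v ∈ vertices F x → v ∈ vertices F₀ x
    out⁺ {x} nx v∈ with C? x
    ... | no _ = v∈
    ... | yes cx = ⊥-elim (nx cx)

    out⁻ : ∀ {x v} → ¬ C x → v ∈ vertices F₀ x → v ∈ vertices F x
    out⁻ {x} nx v∈ with C? x
    ... | no _ = v∈
    ... | yes cx = ⊥-elim (nx cx)

    -- Level 0 is kept for the elements below `C` that reach the split end: cut furthest, they
    -- remain inside every path of `C`.
    level : (Fin n → ℕ) → ∀ x → Dec (C x) → ℕ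
    level h x (yes _) = suc (h x)
    level h x (no _) = 0

    level-in : ∀ h {x} (d : Dec (C x)) → C x → level h x d ≡ suc (h x)
    level-in h (yes _) cx = refl
    level-in h (no n) cx = ⊥-elim (n cx)

    level-out : ∀ h {x} (d : Dec (C x)) → ¬ C x → level h x d ≡ 0
    level-out h (yes cx) nx = ⊥-elim (nx cx)
    level-out h (no _) nx = refl

    below-⊆H : ∀ {w} → Below w → ∀ {v} → v ∈ vertices F w → v ∈ verts H
    below-⊆H (sw , nw , r) v∈ = c⊆H (proj₁ (proj₁ (rep sw (C⊆S cc)) r) v∈)

    module OneEnd {e d : Vertex F} (E : EndAt (tree F) (verts H) e d) (active : Bool)
      (ne : active ≡ true → ∀ {w} → Below w → ∃[ v ] v ∈ vertices F w × v ≢ e)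
      (h : Fin n → ℕ) (h< : ∀ x → h x < bound) where

      B : Fin n → Set
      B x = C x ⊎ (Below x × e ∈ vertices F x)

      -- The value 0 leaves this end uncut; `suc bound` exceeds every level, levels being at most
      -- one more than heights.
      limit : Bool → ℕ
      limit true = suc bound
      limit false = 0

      lv : Fin n → ℕ
      lv x = level h x (C? x)

      -- An element below `C` that contains `e` is cut along with `C`. Its second vertex, from `ne`,
      -- guarantees that its path runs along the edge to be split.
      ends : (a : Bool) → (a ≡ true → ∀ {w} → Below w → ∃[ v ] v ∈ vertices F w × v ≢ e) →
        ∀ {x} → B x → lv x < limit a → EndOf F₀ x e d
      ends true ne (inj₁ cx) _ = endAt-⊆ E (in⁺ cx (end∈ E)) (in⁺ cx (next∈ E)) (in⁻ cx)
      ends true ne {x} (inj₂ (b@(_ , nx , _) , e∈)) _ = endAt-⊆ E (out⁺ nx e∈)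
        (out⁺ nx (next-∈ (paths F x) E (below-⊆H b) e∈ (ne refl b))) (λ v∈ → below-⊆H b (out⁻ nx v∈))
      ends false ne _ ()

      side : Side F₀ e d
      side = record
        { adj = end-adj E ; B = B ; B? = λ x → C? x ⊎-dec (below? x ×-dec (e ∈? vertices F x))
        ; height = lv ; bound = limit active ; ends = ends active ne }

      allowed-in : ∀ {x y} → C x → C y → h x ≤ h y → Allowed side x y
      allowed-in {x} {y} cx cy le _ _ = inj₂ (inj₁ cx ,
        ℕ.≤-trans (ℕ.≤-reflexive (level-in h (C? x) cx)) (ℕ.≤-trans (s≤s le) (ℕ.≤-reflexive (sym (level-in h (C? y) cy)))))

      level< : active ≡ true → ∀ {x} → C x → lv x < limit active
      level< refl {x} cx = subst (_< suc bound) (sym (level-in h (C? x) cx)) (s≤s (h< x))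

      allowed-in⁻ : active ≡ true → ∀ {x y} → C x → C y → Allowed side x y → h x ≤ h y
      allowed-in⁻ act {x} {y} cx cy a with a (inj₁ cy) (level< act cy)
      ... | inj₁ e∉ = ⊥-elim (e∉ (in⁺ cx (end∈ E)))
      ... | inj₂ (_ , le) = ℕ.≤-pred (subst (_≤ _) (level-in h (C? x) cx) (subst (lv x ≤_) (level-in h (C? y) cy) le))

      allowed-below : ∀ {x y} → ¬ C x → (B y → e ∈ vertices F x → Below x) → Allowed side x y
      allowed-below {x} {y} nx hb by _ with e ∈? vertices F x
      ... | no e∉ = inj₁ (e∉ ∘ out⁻ nx)
      ... | yes e∈ = inj₂ (inj₂ (hb by e∈ , e∈) , subst (_≤ lv y) (sym (level-out h (C? x) nx)) z≤n)

      excluded : active ≡ true → ∀ {x y} → C y → ¬ C x → ¬ Below x → Allowed side x y → e ∉ vertices F x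
      excluded act cy nx nb a with a (inj₁ cy) (level< act cy)
      ... | inj₁ e∉ = e∉ ∘ out⁺ nx
      ... | inj₂ (inj₁ cx , _) = ⊥-elim (nx cx)
      ... | inj₂ (inj₂ (b , _) , _) = ⊥-elim (nb b)

    module L = OneEnd end true (λ _ → below-≢) f f<
    module M = OneEnd end' split' below-≢' g g<

    J = jitter F₀ q'≢q q'≢p L.side M.side

    F' : Family n
    F' = proj₁ J

    out : ∀ {x y} → Sub F' x y → Sub F₀ x y × Allowed L.side x y × Allowed M.side x y
    out {x} {y} = proj₁ (proj₂ J) {x} {y}

    into : ∀ {x y} → Sub F₀ x y → Allowed L.side x y → Allowed M.side x y → Sub F' x y
    into {x} {y} = proj₂ (proj₂ J) {x} {y}

    in-in⁺ : ∀ {x y} → C x → C y → f x ≤ f y → g x ≤ g y → Sub F' x y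
    in-in⁺ {x} {y} cx cy a b = into {x} {y} (λ v∈ → in⁺ cy (in⁻ cx v∈)) (L.allowed-in {x} {y} cx cy a) (M.allowed-in {x} {y} cx cy b)

    in-in⁻ : ∀ {x y} → C x → C y → Sub F' x y → f x ≤ f y × g x ≤ g y
    in-in⁻ {x} {y} cx cy s with out {x} {y} s
    ... | _ , a , b = L.allowed-in⁻ refl {x} {y} cx cy a , second split' refl
      where
      second : (b : Bool) → split' ≡ b → g x ≤ g y
      second true eq = M.allowed-in⁻ eq {x} {y} cx cy b
      second false eq = subst (_≤ g y) (sym (flat eq x)) z≤n

    out-out⁺ : ∀ {x y} → S x → S y → ¬ C x → ¬ C y → Sub F x y → Sub F' x y
    out-out⁺ {x} {y} sx sy nx ny s = into {x} {y} (λ v∈ → out⁺ ny (s (out⁻ nx v∈)))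
      (L.allowed-below {x} {y} nx λ b _ → low b) (M.allowed-below {x} {y} nx λ b _ → low b)
      where
      -- An outsider `y` that is cut lies below `c`, and so does every `x` contained in it.
      low : ∀ {e} → C y ⊎ (Below y × e ∈ vertices F y) → Below x
      low (inj₁ cy) = ⊥-elim (ny cy)
      low (inj₂ ((_ , _ , r) , _)) =
        let a , b = proj₁ (rep sy (C⊆S cc)) r in
        sx , nx , proj₂ (rep sx (C⊆S cc)) ((λ v∈ → a (s v∈)) , λ h → b (λ v∈ → s (h v∈)))

    out-out⁻ : ∀ {x y} → ¬ C x → ¬ C y → Sub F' x y → Sub F x y
    out-out⁻ {x} {y} nx ny s v∈ = out⁻ ny (proj₁ (out {x} {y} s) (out⁺ nx v∈))

    asym : ∀ {x y} → S x → S y → R x y → ¬ R y x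
    asym sx sy a b = proj₂ (proj₁ (rep sx sy) a) (proj₁ (proj₁ (rep sy sx) b))

    c₀⊂c = proj₁ (rep (C⊆S cc₀) (C⊆S cc)) c₀<c

    -- Plain containment of the path of `c`, even equality, contains the path of `c₀` strictly. The
    -- module property then places all of `C` below an outsider `y`.
    above-c₀ : ∀ {y} → S y → Sub F c y → R c₀ y
    above-c₀ sy s = proj₂ (rep (C⊆S cc₀) sy) ((λ v∈ → s (proj₁ c₀⊂c v∈)) , λ h → proj₂ c₀⊂c (λ v∈ → h (s v∈)))

    -- The path of `y` may have the very vertices of `H`; containment is still strict, because `y`
    -- keeps `q` while every member of `C` loses it.
    in-out⁺ : ∀ {x y} → S y → C x → ¬ C y → R x y → Strict F' x y
    in-out⁺ {x} {y} sy cx ny r = into {x} {y} (λ v∈ → out⁺ ny (H⊆above ab (in⁻ cx v∈)))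
        (λ b _ → ⊥-elim (not-below b)) (λ b _ → ⊥-elim (not-below b)) ,
      λ s → L.excluded refl {y} {x} cx ny (λ (_ , _ , r') → asym (C⊆S cc) sy (proj₂ (proj₂ ab)) r')
        (proj₁ (proj₂ (out {y} {x} s))) (H⊆above ab (end∈ end))
      where
      ab : Above y
      ab = sy , ny , above-all sy ny cx cc r
      not-below : ∀ {e} → ¬ (C y ⊎ (Below y × e ∈ vertices F y))
      not-below (inj₁ cy) = ny cy
      not-below (inj₂ ((_ , _ , r') , _)) = asym (C⊆S cc) sy (proj₂ (proj₂ ab)) r'

    in-out⁻ : ∀ {x y} → S y → C x → ¬ C y → Sub F' x y → R x y
    in-out⁻ {x} {y} sy cx ny s = above-all sy ny cc₀ cx
      (above-c₀ sy λ v∈ → out⁻ ny (proj₁ (out {x} {y} s) (in⁺ cx (c⊆H v∈))))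

    out-in⁺ : ∀ {x y} → S x → ¬ C x → C y → R x y → Strict F' x y
    out-in⁺ {x} {y} sx nx cy r = into {x} {y} (λ v∈ → in⁺ cy (below-⊆H bx (out⁻ nx v∈)))
        (L.allowed-below {x} {y} nx λ _ _ → bx) (M.allowed-below {x} {y} nx λ _ _ → bx) ,
      λ s → proj₂ (proj₁ (rep sx (C⊆S cc)) (proj₂ (proj₂ bx)))
        (λ v∈ → out⁻ nx (proj₁ (out {y} {x} s) (in⁺ cy (c⊆H v∈))))
      where
      bx : Below x
      bx = sx , nx , below-all sx nx cy cc r

    -- If `x` were not below `c`, the cuts would bar it from `q` and from a split `q'`, so its path
    -- would lie in that of `c`. It would do so strictly, because otherwise `c₀`, and with it `c`,
    -- would be below `x`. Then `x` is below `c` after all.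
    out-in⁻ : ∀ {x y} → S x → ¬ C x → C y → Sub F' x y → R x y
    out-in⁻ {x} {y} sx nx cy s with R? x c
    ... | yes r = below-all sx nx cc cy r
    ... | no nr with out {x} {y} s
    ...   | s₀ , a , b = ⊥-elim (nr (proj₂ (rep sx (C⊆S cc)) (x⊆c , c⊈x)))
      where
      not-below : ¬ Below x
      not-below (_ , _ , r) = nr r
      x⊆c : Sub F x c
      x⊆c v∈ with H⊆ (in⁻ cy (s₀ (out⁺ nx v∈)))
      ... | inj₁ refl = ⊥-elim (L.excluded refl {x} {y} cy nx not-below a v∈)
      ... | inj₂ (inj₁ (refl , act)) = ⊥-elim (M.excluded act {x} {y} cy nx not-below b v∈)
      ... | inj₂ (inj₂ v∈c) = v∈c
      c⊈x : ¬ Sub F c x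
      c⊈x h = proj₂ (proj₁ (rep (C⊆S cc) sx) (above-all sx nx cc₀ cc (above-c₀ sx h))) x⊆c

    substituted : Represents F' S (Replace C R Q)
    substituted {x} {y} sx sy = cases (C? x) (C? y)
      where
      cases : Dec (C x) → Dec (C y) → (Replace C R Q x y → Strict F' x y) × (Strict F' x y → Replace C R Q x y)
      cases (yes cx) (yes cy) =
        (λ { (inj₁ (_ , _ , r)) → let a , b , n = sound cx cy r in
               in-in⁺ cx cy a b , λ s → n (in-in⁻ cy cx s)
           ; (inj₂ (n , _)) → ⊥-elim (n (cx , cy)) }) ,
        λ (s , n) → let a , b = in-in⁻ cx cy s in
          inj₁ (cx , cy , complete cx cy a b λ (d , e) → n (in-in⁺ cy cx d e))
      cases (no nx) (no ny) =
        (λ { (inj₁ (cx , _)) → ⊥-elim (nx cx)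
           ; (inj₂ (_ , r)) → let a , b = proj₁ (rep sx sy) r in
               out-out⁺ sx sy nx ny a , λ s → b (out-out⁻ ny nx s) }) ,
        λ (s , n) → inj₂ ((λ (cx , _) → nx cx) ,
          proj₂ (rep sx sy) (out-out⁻ nx ny s , λ h → n (out-out⁺ sy sx ny nx h)))
      cases (yes cx) (no ny) =
        (λ { (inj₁ (_ , cy , _)) → ⊥-elim (ny cy) ; (inj₂ (_ , r)) → in-out⁺ sy cx ny r }) ,
        λ (s , _) → inj₂ ((λ (_ , cy) → ny cy) , in-out⁻ sy cx ny s)
      cases (no nx) (yes cy) =
        (λ { (inj₁ (cx , _)) → ⊥-elim (nx cx) ; (inj₂ (_ , r)) → out-in⁺ sx nx cy r }) ,
        λ (s , _) → inj₂ ((λ (cx , _) → nx cx) , out-in⁻ sx nx cy s)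

-- Paths sharing an end, prolongations and pendant vertices

position-last : ∀ {m} {G : Graph m} {l b v} → Simple G l → Last l b → v ∈ l → position l v ≤ position l b
position-last s last-one (here refl) = ℕ.≤-refl
position-last {l = a ∷ l} s (last-more la) (here refl) = ℕ.≤-trans (ℕ.≤-reflexive (position-first {a = a} {l = l})) z≤n
position-last {l = a ∷ l} s (last-more la) (there v∈)
  rewrite position-later {l = l} (simple-head≢ s v∈) | position-later {l = l} (simple-head≢ s (last-∈ la)) =
  s≤s (position-last (simple-tail s) la v∈)

span-all : ∀ {m} {G : Graph m} → ¬ HasCycle G → ∀ {a l b} → Simple G (a ∷ l) → Last (a ∷ l) b → (X : Path G) →
  (∀ {v} → v ∈ verts X → v ∈ a ∷ l) → a ∈ verts X → b ∈ verts X → ∀ {v} → v ∈ a ∷ l → v ∈ verts X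
span-all noCycle {a} {l} s la X sub a∈ b∈ v∈ =
  convex (linked X) sub a∈ b∈ v∈ (ℕ.≤-trans (ℕ.≤-reflexive (position-first {a = a} {l = l})) z≤n) (position-last s la v∈)
  where open Segments noCycle s

next-next : ∀ {i u x y} → Next i u → Next i x → Next i y → u ≢ x → u ≢ y → x ≡ y
next-next (inj₁ refl) (inj₁ refl) _ n _ = ⊥-elim (n refl)
next-next (inj₁ refl) (inj₂ refl) (inj₁ refl) _ n = ⊥-elim (n refl)
next-next (inj₁ refl) (inj₂ refl) (inj₂ eq) _ _ = ℕ.suc-injective eq
next-next (inj₂ refl) (inj₁ refl) (inj₁ refl) _ _ = refl
next-next (inj₂ refl) (inj₁ refl) (inj₂ eq) _ n = ⊥-elim (n (ℕ.suc-injective eq))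
next-next (inj₂ refl) (inj₂ eq) _ n _ = ⊥-elim (n (ℕ.suc-injective eq))

two-neighbours : ∀ {m} {G : Graph m} → ¬ HasCycle G → ∀ {z v u x y} → Simple G z → v ∈ z → u ∈ z → x ∈ z → y ∈ z →
  Adj G v u → Adj G v x → Adj G v y → u ≢ x → u ≢ y → x ≡ y
two-neighbours {G = G} noCycle {z} {v} s v∈ u∈ x∈ y∈ vu vx vy u≢x u≢y = position-injective x∈ y∈
  (next-next (adj u∈ vu) (adj x∈ vx) (adj y∈ vy) (u≢x ∘ position-injective u∈ x∈) (u≢y ∘ position-injective u∈ y∈))
  where
  adj : ∀ {w} → w ∈ z → Adj G v w → Next (position z v) (position z w)
  adj w∈ h = position-adj noCycle s v∈ w∈ h

-- Within the path `z` no vertex has three neighbours. After the common edge there is at each vertex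
-- only one way to go on, so the lists agree until one of them stops.
common-start : ∀ {m} {G : Graph m} → ¬ HasCycle G → ∀ {z} → Simple G z → ∀ {u v} r r' →
  Simple G (u ∷ v ∷ r) → Simple G (u ∷ v ∷ r') →
  (∀ {w} → w ∈ u ∷ v ∷ r → w ∈ z) → (∀ {w} → w ∈ u ∷ v ∷ r' → w ∈ z) →
  (∀ {w} → w ∈ r → w ∈ r') ⊎ (∀ {w} → w ∈ r' → w ∈ r)
common-start noCycle sz [] r' s s' sub sub' = inj₁ λ ()
common-start noCycle sz (x ∷ r) [] s s' sub sub' = inj₂ λ ()
common-start {G = G} noCycle sz (x ∷ r) (y ∷ r') s@((uv ∷ vx ∷ _) , _) s'@((_ ∷ vy ∷ _) , _) sub sub'
  with two-neighbours noCycle sz (sub (there (here refl))) (sub (here refl)) (sub (there (there (here refl))))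
         (sub' (there (there (here refl)))) (sym-adj G uv) vx vy
         (simple-head≢ s (there (here refl))) (simple-head≢ s' (there (here refl)))
... | refl with common-start noCycle sz r r' (simple-tail s) (simple-tail s') (sub ∘ there) (sub' ∘ there)
...   | inj₁ h = inj₁ λ { (here refl) → here refl ; (there w∈) → there (h w∈) }
...   | inj₂ h = inj₂ λ { (here refl) → here refl ; (there w∈) → there (h w∈) }

nested : ∀ {n} (F : Family n) {b b₁ x y z} → EndOf F x b b₁ → EndOf F y b b₁ → Sub F x z → Sub F y z → Sub F x y ⊎ Sub F y x
nested F {x = x} {y} {z} Ex Ey xz yz with endAt-head (paths F x) Ex | endAt-head (paths F y) Ey
... | r , s , to , from | r' , s' , to' , from'
  with common-start (acyclic F) (simple (paths F z)) r r' s s' (xz ∘ from) (yz ∘ from')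
... | inj₁ h = inj₁ λ v∈ → from' (grow (to v∈))
  where
  grow : ∀ {v} → v ∈ _ ∷ _ ∷ r → v ∈ _ ∷ _ ∷ r'
  grow (here refl) = here refl
  grow (there (here refl)) = there (here refl)
  grow (there (there v∈)) = there (there (h v∈))
... | inj₂ h = inj₂ λ v∈ → from (grow (to' v∈))
  where
  grow : ∀ {v} → v ∈ _ ∷ _ ∷ r' → v ∈ _ ∷ _ ∷ r
  grow (here refl) = here refl
  grow (there (here refl)) = there (here refl)
  grow (there (there v∈)) = there (there (h v∈))

record Prolonged {m : ℕ} {G : Graph m} (H : Path G) (b v : Fin m) : Set where
  field
    longer : Path G
    end : EndAt G (verts longer) v b
    ⊆⁺ : ∀ {w} → w ∈ verts H → w ∈ verts longer
    ⊆⁻ : ∀ {w} → w ∈ verts longer → w ≡ v ⊎ w ∈ verts H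
    other : ∀ {q p} → q ≢ b → EndAt G (verts H) q p → EndAt G (verts longer) q p

-- In a tree the new vertex is adjacent to no vertex of `H` but `b`, so every end of `H` other than
-- `b` remains an end.
prolong : ∀ {m} {G : Graph m} → ¬ HasCycle G → (H : Path G) → ∀ {b b₁ v} → EndAt G (verts H) b b₁ → Adj G b v → v ∉ verts H →
  Prolonged H b v
prolong {G = G} noCycle H {b} {b₁} {v} E bv v∉ with endAt-head H E
... | r , s , to , from = record
  { longer = path {G = G} s⁺
  ; end = head-endAt noCycle s⁺
  ; ⊆⁺ = there ∘ to
  ; ⊆⁻ = λ { (here refl) → inj₁ refl ; (there w∈) → inj₂ (from w∈) }
  ; other = λ {q} {p} ne E' → record
      { end∈ = there (to (end∈ E')) ; next∈ = there (to (next∈ E')) ; end-adj = end-adj E'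
      ; only-next = λ { (here refl) qv → ⊥-elim (ne (head-neighbour noCycle s⁺ (there (to (end∈ E'))) (sym-adj G qv)))
                      ; (there w∈) h → only-next E' (from w∈) h } } }
  where
  s⁺ : Simple G (v ∷ b ∷ b₁ ∷ r)
  s⁺ = simple-∷ (sym-adj G bv) s (v∉ ∘ from)

-- A pendant vertex at `a` makes room for prolonging a path there; as no path of the family contains
-- it, no containment changes.
module Attach {n : ℕ} (F : Family n) (a : Vertex F) where

  open Join (tree F) point a zero public

  attached : Family n
  attached = record { isTree = join-tree (isTree F) point-tree ; paths = λ x → proj₁ (lift-left (paths F x)) }

  leaf : Vertex attached
  leaf = right zero

  leaf-adj : Adj (tree attached) (left a) leaf
  leaf-adj = bridge-adj

  lift⁺ : ∀ {x v} → v ∈ vertices F x → left v ∈ vertices attached x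
  lift⁺ {x} v∈ = subst (_ ∈_) (sym (proj₂ (lift-left (paths F x)))) (∈-map⁺ left v∈)

  lift⁻ : ∀ {x v} → v ∈ vertices attached x → ∃[ u ] u ∈ vertices F x × v ≡ left u
  lift⁻ {x} v∈ = ∈-map⁻ left (subst (_ ∈_) (proj₂ (lift-left (paths F x))) v∈)

  lift-∈⁻ : ∀ {x v} → left v ∈ vertices attached x → v ∈ vertices F x
  lift-∈⁻ {x} v∈ with lift⁻ {x} v∈
  ... | u , u∈ , eq = subst (_∈ vertices F x) (sym (left-injective eq)) u∈

  leaf-∉ : ∀ {x} → leaf ∉ vertices attached x
  leaf-∉ {x} v∈ with lift⁻ {x} v∈
  ... | _ , _ , eq = left≢right (sym eq)

  attached-sub⁺ : ∀ {x y} → Sub F x y → Sub attached x y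
  attached-sub⁺ {x} {y} h v∈ with lift⁻ {x} v∈
  ... | u , u∈ , refl = lift⁺ {y} (h u∈)

  attached-sub⁻ : ∀ {x y} → Sub attached x y → Sub F x y
  attached-sub⁻ {x} {y} h v∈ = lift-∈⁻ {y} (h (lift⁺ {x} v∈))

  attached-end : ∀ {x e p} → EndOf F x e p → EndOf attached x (left e) (left p)
  attached-end {x} E = record
    { end∈ = lift⁺ {x} (end∈ E) ; next∈ = lift⁺ {x} (next∈ E) ; end-adj = left-adj (end-adj E)
    ; only-next = λ v∈ h → only v∈ h }
    where
    only : ∀ {v} → v ∈ vertices attached x → Adj (tree attached) (left _) v → v ≡ left _
    only v∈ h with lift⁻ {x} v∈
    ... | u , u∈ , refl = cong left (only-next E u∈ (left-adj⁻ h))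

represents-resp : ∀ {n} {F F' : Family n} {S : Fin n → Set} {R : Rel (Fin n) 0ℓ} →
  (∀ {x y} → Sub F x y → Sub F' x y) → (∀ {x y} → Sub F' x y → Sub F x y) → Represents F S R → Represents F' S R
represents-resp to from rep {x} {y} sx sy =
  (λ r → let a , b = proj₁ (rep sx sy) r in to {x} {y} a , λ h → b (from {y} {x} h)) ,
  λ (a , b) → proj₂ (rep sx sy) (from {x} {y} a , λ h → b (to {y} {x} h))

-- Choosing the path that replaces a module

module Substitution {n : ℕ} {S C : Fin n → Set} (S? : ∀ x → Dec (S x)) (C? : ∀ x → Dec (C x)) (C⊆S : ∀ {x} → C x → S x)
  {R Q : Rel (Fin n) 0ℓ} (R? : Decidable R)
  (below-all : ∀ {z x y} → S z → ¬ C z → C x → C y → R z x → R z y)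
  (above-all : ∀ {z x y} → S z → ¬ C z → C x → C y → R x z → R y z)
  {c₀ c : Fin n} (cc₀ : C c₀) (cc : C c) (c₀<c : R c₀ c)
  (σ : StrictOrder Q)
  (same⁺ : ∀ {x y} → C x → C y → R x y → Q x y ⊎ Q y x)
  (same⁻ : ∀ {x y} → C x → C y → Q x y → R x y ⊎ R y x)
  (conj : Conjugate C R) where

  open Module S? C? C⊆S {Q = Q} R? below-all above-all cc₀ cc c₀<c

  -- The inequalities say that the path of `c` has at least three vertices, so that splitting at one
  -- end does not touch the edge at the other.
  record Ends (F : Family n) (a a₁ b b₁ : Vertex F) : Set where
    field
      endₐ : EndOf F c a a₁
      endᵦ : EndOf F c b b₁
      a≢b : a ≢ b
      b≢a₁ : b ≢ a₁
      a≢b₁ : a ≢ b₁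
      span : ∀ {x} → Sub F x c → a ∈ vertices F x → b ∈ vertices F x → Sub F c x

  ends-swap : ∀ {F a a₁ b b₁} → Ends F a a₁ b b₁ → Ends F b b₁ a a₁
  ends-swap E = record { endₐ = endᵦ ; endᵦ = endₐ ; a≢b = a≢b ∘ sym ; b≢a₁ = a≢b₁ ; a≢b₁ = b≢a₁ ; span = λ h x y → span h y x }
    where open Ends E

  ends : (F : Family n) → ∀ {x y z r} → vertices F c ≡ x ∷ y ∷ z ∷ r → ∃[ a ] ∃[ a₁ ] ∃[ b ] ∃[ b₁ ] Ends F a a₁ b b₁
  ends F eq with vertices F c in eq' | simple (paths F c)
  ends F {x} {y} {z} {r} refl | _ | s with last-exists z r
  ... | b , la with reverse-from-last s (last-more (last-more la))
  ...   | [] , _ , last-one , _ = ⊥-elim (unique-head (unique s) (there (last-∈ la)))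
  ...   | b₁ ∷ r' , s' , _ , to , from = x , y , b , b₁ , record
    { endₐ = E ; endᵦ = E'
    ; a≢b = a≢b ; b≢a₁ = λ { refl → unique-head (unique-tail (unique s)) (last-∈ la) }
    ; a≢b₁ = λ { refl → b≢a₁ (only-next E (end∈ E') (sym-adj (tree F) (end-adj E'))) }
    ; span = λ {t} h a∈ b∈ v∈ → span-all (acyclic F) s (last-more (last-more la)) (paths F t)
        (λ u∈ → subst (_ ∈_) eq' (h u∈)) a∈ b∈ (subst (_ ∈_) eq' v∈) }
    where
    a≢b : x ≢ b
    a≢b refl = unique-head (unique s) (there (last-∈ la))
    b≢a₁ : b ≢ y
    b≢a₁ refl = unique-head (unique-tail (unique s)) (last-∈ la)
    E : EndOf F c x y
    E = subst (λ l → EndAt (tree F) l x y) (sym eq') (head-endAt (acyclic F) s)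
    E' : EndOf F c b b₁
    E' = subst (λ l → EndAt (tree F) l b b₁) (sym eq')
      (endAt-⊆ (head-endAt (acyclic F) s') (from (here refl)) (from (there (here refl))) to)

  asym : ∀ {F} → Represents F S R → ∀ {x y} → S x → S y → R x y → ¬ R y x
  asym rep sx sy a b = proj₂ (proj₁ (rep sx sy) a) (proj₁ (proj₁ (rep sy sx) b))

  -- c is not minimal, so its path has an edge; splitting that edge gives it a third vertex.
  thicken : (F : Family n) → Represents F S R →
    Σ[ F' ∈ Family n ] Represents F' S R × ∃[ x ] ∃[ y ] ∃[ z ] ∃[ r ] vertices F' c ≡ x ∷ y ∷ z ∷ r
  thicken F rep with vertices F c in eq | simple (paths F c) | path-cases (paths F c)
  ... | _ | s | a , [] , refl = ⊥-elim (proj₂ c₀⊂c λ v∈ → single (subst (_ ∈_) eq v∈))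
    where
    c₀⊂c = proj₁ (rep (C⊆S cc₀) (C⊆S cc)) c₀<c
    single : ∀ {v} → v ∈ a ∷ [] → v ∈ vertices F c₀
    single (here refl) with path-cases (paths F c₀)
    ... | u , _ , eq₀ with u∈ ← subst (u ∈_) (sym eq₀) (here refl) with subst (u ∈_) eq (proj₁ c₀⊂c u∈)
    ...   | here refl = u∈
  ... | _ | s@((ab ∷ _) , _) | a , b ∷ r , refl = T.truncated ,
    represents-resp {F = F} {T.truncated} (λ {x} {y} h → T.truncated-sub⁻ {x} {y} h λ ())
      (λ {x} {y} h → proj₁ (T.truncated-sub⁺ {x} {y} h)) rep ,
    three (path-cases (paths T.truncated c)) (T.I.new⁺ c a∈ b∈) (T.I.old⁺ c a∈ (λ ())) (T.I.old⁺ c b∈ (λ ()))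
    where
    -- With no path to cut, truncation is plain subdivision and leaves all containments unchanged.
    module T = Truncation F ab (λ _ → ⊥) (λ _ → no λ ()) (λ ())
    a∈ : a ∈ vertices F c
    a∈ = subst (a ∈_) (sym eq) (here refl)
    b∈ : b ∈ vertices F c
    b∈ = subst (b ∈_) (sym eq) (there (here refl))
    three : ∀ {l : List (Fin (suc (size F)))} → ∃[ x ] ∃[ r ] l ≡ x ∷ r → zero ∈ l → suc a ∈ l → suc b ∈ l →
      ∃[ x ] ∃[ y ] ∃[ z ] ∃[ r ] l ≡ x ∷ y ∷ z ∷ r
    three (x , y ∷ z ∷ r , refl) _ _ _ = x , y , z , r , refl
    three (x , [] , refl) (here refl) (here ()) _
    three (x , y ∷ [] , refl) (here refl) (there (here refl)) (there (here refl)) = ⊥-elim (irr-adj (tree F) ab)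
    three (x , y ∷ [] , refl) (there (here refl)) (there (here ())) _
    three (x , y ∷ [] , refl) (there (here refl)) (here refl) (there (here ()))
    three (x , y ∷ [] , refl) (there (here refl)) (here refl) (here refl) = ⊥-elim (irr-adj (tree F) ab)

  -- Two ways to cut at `a`: back from `a` itself, if every path below `C` also has another vertex,
  -- or back from a new end `v` beyond `a` that all paths above `C` contain.
  data Room (F : Family n) (a : Vertex F) : Set where
    inward : (∀ {w} → Below w → ∃[ v ] v ∈ vertices F w × v ≢ a) → Room F a
    outward : ∀ v → Adj (tree F) a v → v ∉ vertices F c → (∀ {z} → Above z → v ∈ vertices F z) → Room F a

  Blocked : (F : Family n) → Vertex F → Vertex F → Set
  Blocked F a a₁ = ∀ {x} → C x → EndOf F x a a₁

  -- Without inward room some path below `C` is just `a`, so every path of `C` contains `a`. If one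
  -- of them has a neighbour of `a` off the path of `c`, that vertex lies in all paths above `C` and
  -- gives outward room. Otherwise they all leave `a` through `a₁`, hence end at `a`.
  room : ∀ {F} → Represents F S R → ∀ {a a₁} → EndOf F c a a₁ → Room F a ⊎ Blocked F a a₁
  room {F} rep {a} {a₁} E with Fin.any? (λ w → below? w ×-dec ¬? (any? (λ v → ¬? (v ≟ a)) (vertices F w)))
  ... | no none = inj₁ (inward λ {w} bw → find bw (any? (λ v → ¬? (v ≟ a)) (vertices F w)))
    where
    find : ∀ {w} → Below w → Dec (Any.Any (λ v → v ≢ a) (vertices F w)) → ∃[ v ] v ∈ vertices F w × v ≢ a
    find bw (yes p) = find-∈ p
    find bw (no p) = ⊥-elim (none (_ , bw , p))
  ... | yes (w , bw@(sw , nw , rw) , only-a) with Fin.any? (λ x → C? x ×-dec any? (λ v → adj? (isTree F) a v ×-dec ¬? (v ∈? vertices F c)) (vertices F x))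
  ...   | yes (x , cx , p) with find-∈ p
  ...     | v , v∈ , av , v∉ = inj₁ (outward v av v∉ λ (sz , nz , r) → proj₁ (proj₁ (rep (C⊆S cx) sz) (above-all sz nz cc cx r)) v∈)
  room {F} rep {a} {a₁} E | yes (w , bw@(sw , nw , rw) , only-a) | no none = inj₂ λ {x} cx →
    let r = below-all sw nw cc cx rw
        w⊂x = proj₁ (rep sw (C⊆S cx)) r in
    record
    { end∈ = proj₁ w⊂x a∈w
    ; next∈ = a₁∈ cx w⊂x
    ; end-adj = end-adj E
    ; only-next = λ v∈ av → only-next E (near cx v∈ av) av }
    where
    is-a : ∀ {v} → v ∈ vertices F w → v ≡ a
    is-a {v} v∈ with v ≟ a
    ... | yes eq = eq
    ... | no ne = ⊥-elim (only-a (lose v∈ ne))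
    a∈w : a ∈ vertices F w
    a∈w with path-cases (paths F w)
    ... | u , _ , eq with u∈ ← subst (u ∈_) (sym eq) (here refl) = subst (_∈ vertices F w) (is-a u∈) u∈
    near : ∀ {x v} → C x → v ∈ vertices F x → Adj (tree F) a v → v ∈ vertices F c
    near {x} {v} cx v∈ av with v ∈? vertices F c
    ... | yes v∈c = v∈c
    ... | no v∉ = ⊥-elim (none (x , cx , lose v∈ (av , v∉)))
    a₁∈ : ∀ {x} → C x → Strict F w x → a₁ ∈ vertices F x
    a₁∈ {x} cx (w⊆x , x⊈w) with any? (λ v → ¬? (v ≟ a)) (vertices F x)
    ... | yes p with find-∈ p
    ...   | v , v∈ , ne with neighbour {G = tree F} (linked (paths F x)) (w⊆x a∈w) v∈ ne
    ...     | u , u∈ , au = subst (_∈ vertices F x) (only-next E (near cx u∈ au) au) u∈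
    a₁∈ {x} cx (w⊆x , x⊈w) | no p = ⊥-elim (x⊈w all-a)
      where
      all-a : Sub F x w
      all-a {v} v∈ with v ≟ a
      ... | yes refl = a∈w
      ... | no ne = ⊥-elim (p (lose v∈ ne))

  record Grown (F : Family n) (b b₁ : Vertex F) : Set where
    field
      H : Path (tree F)
      q p : Vertex F
      end : EndAt (tree F) (verts H) q p
      endᵦ : EndAt (tree F) (verts H) b b₁
      b≢q : b ≢ q
      b≢p : b ≢ p
      c⊆H : ∀ {v} → v ∈ vertices F c → v ∈ verts H
      H⊆above : ∀ {z} → Above z → ∀ {v} → v ∈ verts H → v ∈ vertices F z
      H⊆ : ∀ {v} → v ∈ verts H → v ≡ q ⊎ v ∈ vertices F c
      below-≢ : ∀ {w} → Below w → ∃[ v ] v ∈ vertices F w × v ≢ q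

  c⊆above : ∀ {F} → Represents F S R → ∀ {z} → Above z → Sub F c z
  c⊆above rep (sz , _ , r) = proj₁ (proj₁ (rep (C⊆S cc) sz) r)

  below-≢-outside : ∀ {F} → Represents F S R → ∀ {v} → v ∉ vertices F c → ∀ {w} → Below w → ∃[ u ] u ∈ vertices F w × u ≢ v
  below-≢-outside {F} rep v∉ {w} (sw , _ , r) with path-cases (paths F w)
  ... | u , _ , eq with u∈ ← subst (u ∈_) (sym eq) (here refl) =
    u , u∈ , λ { refl → v∉ (proj₁ (proj₁ (rep sw (C⊆S cc)) r) u∈) }

  grow : ∀ {F} → Represents F S R → ∀ {a a₁ b b₁} → Ends F a a₁ b b₁ → Room F a → Grown F b b₁
  grow {F} rep {a} {a₁} E (inward h) = record
    { H = paths F c ; q = a ; p = a₁ ; end = endₐ ; endᵦ = endᵦ ; b≢q = a≢b ∘ sym ; b≢p = b≢a₁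
    ; c⊆H = λ v∈ → v∈ ; H⊆above = c⊆above {F} rep ; H⊆ = inj₂ ; below-≢ = h }
    where open Ends E
  grow {F} rep {a} {a₁} {b} E (outward v av v∉ h) = record
    { H = P.longer ; q = v ; p = a ; end = P.end ; endᵦ = P.other (a≢b ∘ sym) endᵦ
    ; b≢q = λ { refl → v∉ (end∈ endᵦ) } ; b≢p = a≢b ∘ sym
    ; c⊆H = P.⊆⁺
    ; H⊆above = λ ab v∈ → above-∈ ab (P.⊆⁻ v∈)
    ; H⊆ = P.⊆⁻
    ; below-≢ = below-≢-outside {F} rep v∉ }
    where
    open Ends E
    module P = Prolonged (prolong (acyclic F) (paths F c) endₐ av v∉)
    above-∈ : ∀ {z} → Above z → ∀ {u} → u ≡ v ⊎ u ∈ vertices F c → u ∈ vertices F z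
    above-∈ ab (inj₁ refl) = h ab
    above-∈ ab (inj₂ u∈) = c⊆above {F} rep ab u∈

  realizer : Realizer C Q
  realizer = conjugate⇒realizer C? σ (conjugate-resp same⁺ same⁻ conj)

  complete-frame : ∀ {F} → Represents F S R → ∀ {b b₁} → EndOf F c b b₁ → Grown F b b₁ → Room F b → Frame F realizer
  complete-frame rep {b} {b₁} E grown (inward h) = record
    { H = H ; q = q ; p = p ; q' = b ; p' = b₁ ; end = end ; end' = endᵦ ; q'≢q = b≢q ; q'≢p = b≢p
    ; split' = true ; flat = λ () ; c⊆H = c⊆H ; H⊆above = H⊆above
    ; H⊆ = λ v∈ → weaken (H⊆ v∈) ; below-≢ = below-≢ ; below-≢' = λ _ → h }
    where
    open Grown grown
    weaken : ∀ {A B D : Set} → A ⊎ B → A ⊎ D ⊎ B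
    weaken (inj₁ a) = inj₁ a
    weaken (inj₂ b) = inj₂ (inj₂ b)
  complete-frame {F} rep {b} {b₁} E grown (outward v bv v∉ h) = record
    { H = P.longer ; q = q ; p = p ; q' = v ; p' = b ; end = P.other (b≢q ∘ sym) end ; end' = P.end
    ; q'≢q = λ { refl → v∉H (end∈ end) } ; q'≢p = λ { refl → v∉H (next∈ end) }
    ; split' = true ; flat = λ () ; c⊆H = λ v∈ → P.⊆⁺ (c⊆H v∈)
    ; H⊆above = λ ab u∈ → above-∈ ab (P.⊆⁻ u∈)
    ; H⊆ = λ u∈ → inside (P.⊆⁻ u∈)
    ; below-≢ = below-≢ ; below-≢' = λ _ → below-≢-outside {F} rep v∉ }
    where
    open Grown grown
    -- `H` may already have grown at its other end, but the only neighbour of `b` on it is `b₁`,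
    -- which belongs to the path of `c`.
    v∉H : v ∉ verts H
    v∉H v∈ = v∉ (subst (_∈ vertices F c) (sym (only-next endᵦ v∈ bv)) (next∈ E))
    module P = Prolonged (prolong (acyclic F) H endᵦ bv v∉H)
    above-∈ : ∀ {z} → Above z → ∀ {u} → u ≡ v ⊎ u ∈ verts H → u ∈ vertices F z
    above-∈ ab (inj₁ refl) = h ab
    above-∈ ab (inj₂ u∈) = H⊆above ab u∈
    inside : ∀ {u} → u ≡ v ⊎ u ∈ verts H → u ≡ q ⊎ (u ≡ v × true ≡ true) ⊎ u ∈ vertices F c
    inside (inj₁ eq) = inj₂ (inj₁ (eq , refl))
    inside (inj₂ u∈) with H⊆ u∈
    ... | inj₁ eq = inj₁ eq
    ... | inj₂ u∈c = inj₂ (inj₂ u∈c)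

  -- Paths that share an end edge and lie within the path of `z` form a chain. Incomparable members
  -- of `C` therefore have the same vertex set, which makes incomparability transitive.
  module Flat {F : Family n} (rep : Represents F S R) {b b₁ : Vertex F} (all-end : ∀ {x} → C x → EndOf F x b b₁)
    {z : Fin n} (az : Above z) where

    Same : Fin n → Fin n → Set
    Same x y = Sub F x y × Sub F y x

    ⊆z : ∀ {x} → C x → Sub F x z
    ⊆z cx = let sz , nz , r = az in proj₁ (proj₁ (rep (C⊆S cx) sz) (above-all sz nz cc cx r))

    incomparable⇒same : ∀ {x y} → C x → C y → ¬ Q x y → ¬ Q y x → Same x y
    incomparable⇒same {x} {y} cx cy p q with sub? F x y | sub? F y x
    ... | yes h | yes k = h , k
    ... | yes h | no k = ⊥-elim (conflict (same⁺ cx cy (proj₂ (rep (C⊆S cx) (C⊆S cy)) (h , k))))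
      where
      conflict : Q x y ⊎ Q y x → ⊥
      conflict (inj₁ a) = p a
      conflict (inj₂ a) = q a
    ... | no h | yes k = ⊥-elim (conflict (same⁺ cy cx (proj₂ (rep (C⊆S cy) (C⊆S cx)) (k , h))))
      where
      conflict : Q y x ⊎ Q x y → ⊥
      conflict (inj₁ a) = q a
      conflict (inj₂ a) = p a
    ... | no h | no k with nested F (all-end cx) (all-end cy) (⊆z cx) (⊆z cy)
    ...   | inj₁ a = ⊥-elim (h a)
    ...   | inj₂ a = ⊥-elim (k a)

    same⇒incomparable : ∀ {x y} → C x → C y → Same x y → ¬ Q x y
    same⇒incomparable cx cy (h , k) a with same⁻ cx cy a
    ... | inj₁ r = proj₂ (proj₁ (rep (C⊆S cx) (C⊆S cy)) r) k
    ... | inj₂ r = proj₂ (proj₁ (rep (C⊆S cy) (C⊆S cx)) r) h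

    inc-trans : ∀ {x y z} → C x → C y → C z → ¬ Q x y → ¬ Q y x → ¬ Q y z → ¬ Q z y → ¬ Q x z
    inc-trans cx cy cz p q p' q' =
      let h , k = incomparable⇒same cx cy p q
          h' , k' = incomparable⇒same cy cz p' q' in
      same⇒incomparable cx cz ((λ v∈ → h' (h v∈)) , λ v∈ → k (k' v∈))

    flat-realizer = weak⇒realizer C? σ inc-trans

    flat-frame : Grown F b b₁ → Frame F (proj₁ flat-realizer)
    flat-frame grown = record
      { H = H ; q = q ; p = p ; q' = b ; p' = b₁ ; end = end ; end' = endᵦ ; q'≢q = b≢q ; q'≢p = b≢p
      ; split' = false ; flat = λ _ → proj₂ flat-realizer ; c⊆H = c⊆H ; H⊆above = H⊆above
      ; H⊆ = λ v∈ → weaken (H⊆ v∈) ; below-≢ = below-≢ ; below-≢' = λ () }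
      where
      open Grown grown
      weaken : ∀ {A B D : Set} → A ⊎ B → A ⊎ D ⊎ B
      weaken (inj₁ a) = inj₁ a
      weaken (inj₂ b) = inj₂ (inj₂ b)

  -- The path of `c₀` would contain both ends of the path of `c`, hence all of it.
  both-blocked : ∀ {F} → Represents F S R → ∀ {a a₁ b b₁} → Ends F a a₁ b b₁ →
    Blocked F a a₁ → Blocked F b b₁ → ⊥
  both-blocked rep E h k = let c₀⊆c , c⊈c₀ = proj₁ (rep (C⊆S cc₀) (C⊆S cc)) c₀<c in
    c⊈c₀ (Ends.span E c₀⊆c (end∈ (h cc₀)) (end∈ (k cc₀)))

  replaced : ∀ {F} → Represents F S R → (ρ : Realizer C Q) → Frame F ρ → CPTOn S (Replace C R Q)
  replaced {F} rep ρ frame = Substitute.F' F rep ρ frame , Substitute.substituted F rep ρ frame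

  below-some : ∀ {F} → Represents F S R → ∃ Above → ∀ {a a₁ b b₁} → Ends F a a₁ b b₁ → CPTOn S (Replace C R Q)
  below-some {F} rep (z , az) {a} {a₁} {b} {b₁} E = cases (room rep (Ends.endₐ E)) (room rep (Ends.endᵦ E))
    where
    cases : Room F a ⊎ Blocked F a a₁ → Room F b ⊎ Blocked F b b₁ → CPTOn S (Replace C R Q)
    cases (inj₁ r) (inj₁ r') = replaced rep realizer (complete-frame rep (Ends.endᵦ E) (grow rep E r) r')
    cases (inj₁ r) (inj₂ h) = replaced rep _ (Flat.flat-frame rep h az (grow rep E r))
    cases (inj₂ h) (inj₁ r) = replaced rep _ (Flat.flat-frame rep h az (grow rep (ends-swap E) r))
    cases (inj₂ h) (inj₂ h') = ⊥-elim (both-blocked rep E h h')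

  attached-ends : ∀ {F} d {a a₁ b b₁} → Ends F a a₁ b b₁ →
    Ends (Attach.attached F d) (Attach.left F d a) (Attach.left F d a₁) (Attach.left F d b) (Attach.left F d b₁)
  attached-ends {F} d E = record
    { endₐ = attached-end endₐ ; endᵦ = attached-end endᵦ
    ; a≢b = a≢b ∘ left-injective ; b≢a₁ = b≢a₁ ∘ left-injective ; a≢b₁ = a≢b₁ ∘ left-injective
    ; span = λ {x} h a∈ b∈ → attached-sub⁺ {c} {x} (span (attached-sub⁻ {x} {c} h) (lift-∈⁻ {x} a∈) (lift-∈⁻ {x} b∈)) }
    where
    open Attach F d
    open Ends E

  -- With nothing above `C`, pendant vertices hung on both ends of the path of `c` give outward
  -- room: there is no path that would have to contain them.
  below-none : ∀ {F} → Represents F S R → ¬ ∃ Above → ∀ {a a₁ b b₁} → Ends F a a₁ b b₁ → CPTOn S (Replace C R Q)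
  below-none {F} rep none {a} {a₁} {b} {b₁} E =
    replaced rep₂ realizer (complete-frame rep₂ (Ends.endᵦ E₂) (grow rep₂ E₂ roomₐ) roomᵦ)
    where
    module A = Attach F a
    module B = Attach A.attached (A.left b)
    rep₂ : Represents B.attached S R
    rep₂ = represents-resp {F = A.attached} {B.attached} (λ {x} {y} → B.attached-sub⁺ {x} {y}) (λ {x} {y} → B.attached-sub⁻ {x} {y})
      (represents-resp {F = F} {A.attached} (λ {x} {y} → A.attached-sub⁺ {x} {y}) (λ {x} {y} → A.attached-sub⁻ {x} {y}) rep)
    E₂ : Ends B.attached (B.left (A.left a)) (B.left (A.left a₁)) (B.left (A.left b)) (B.left (A.left b₁))
    E₂ = attached-ends (A.left b) (attached-ends a E)
    roomₐ : Room B.attached (B.left (A.left a))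
    roomₐ = outward (B.left A.leaf) (B.left-adj A.leaf-adj) (λ v∈ → A.leaf-∉ {c} (B.lift-∈⁻ {c} v∈)) λ ab → ⊥-elim (none (_ , ab))
    roomᵦ : Room B.attached (B.left (A.left b))
    roomᵦ = outward B.leaf B.leaf-adj (B.leaf-∉ {c}) λ ab → ⊥-elim (none (_ , ab))

  substitute : CPTOn S R → CPTOn S (Replace C R Q)
  substitute (F , rep) with thicken F rep
  ... | F' , rep' , _ , _ , _ , _ , eq with ends F' eq | Fin.any? above?
  ...   | _ , _ , _ , _ , E | yes az = below-some rep' az E
  ...   | _ , _ , _ , _ , E | no none = below-none rep' none E

-- Gallai colourings

module Reach {n : ℕ} {L : Rel (Fin n) 0ℓ} (L? : Decidable L) (x : Fin n) where

  Reached : Subset n → Set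
  Reached T = (∀ {v} → v ∈ˢ T → Star L x v) × x ∈ˢ T

  saturate : ∀ T → Acc Sets._⊃_ T → Reached T → Σ[ T' ∈ Subset n ] Reached T' × (∀ {u v} → u ∈ˢ T' → L u v → v ∈ˢ T')
  saturate T (acc rs) (h , x∈)
    with Fin.any? (λ u → Fin.any? (λ v → u ∈ˢ? T ×-dec (¬? (v ∈ˢ? T) ×-dec L? u v)))
  ... | yes (u , v , u∈ , v∉ , l) = saturate (T ∪ ⁅ v ⁆)
      (rs (Subset.p⊆p∪q ⁅ v ⁆ , v , Subset.q⊆p∪q T ⁅ v ⁆ (Subset.x∈⁅x⁆ v) , v∉))
      ((λ w∈ → star (Subset.x∈p∪q⁻ T ⁅ v ⁆ w∈)) , Subset.p⊆p∪q ⁅ v ⁆ x∈)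
    where
    star : ∀ {w} → w ∈ˢ T ⊎ w ∈ˢ ⁅ v ⁆ → Star L x w
    star (inj₁ w∈) = h w∈
    star (inj₂ w∈) with Subset.x∈⁅y⁆⇒x≡y v w∈
    ... | refl = h u∈ ◅◅ (l ◅ ε)
  ... | no none = T , (h , x∈) , closed
    where
    closed : ∀ {u v} → u ∈ˢ T → L u v → v ∈ˢ T
    closed {u} {v} u∈ l with v ∈ˢ? T
    ... | yes v∈ = v∈
    ... | no v∉ = ⊥-elim (none (u , v , u∈ , v∉ , l))

  star? : ∀ v → Dec (Star L x v)
  star? v with saturate ⁅ x ⁆ (⊃-wellFounded _) (start , Subset.x∈⁅x⁆ x)
    where
    start : ∀ {v} → v ∈ˢ ⁅ x ⁆ → Star L x v
    start v∈ with Subset.x∈⁅y⁆⇒x≡y x v∈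
    ... | refl = ε
  ... | T , (h , x∈) , closed = map′ h (λ s → follow s x∈) (v ∈ˢ? T)
    where
    follow : ∀ {u v} → Star L u v → u ∈ˢ T → v ∈ˢ T
    follow ε u∈ = u∈
    follow (l ◅ s) u∈ = follow s (closed u∈ l)

star-invariant : ∀ {A : Set} {L : Rel A 0ℓ} (P : A → Set) → (∀ {u v} → P u → L u v → P v) → ∀ {u v} → Star L u v → P u → P v
star-invariant P step ε p = p
star-invariant P step (l ◅ s) p = star-invariant P step s (step p l)

data Colour : Set where
  agree disagree apart : Colour

_≟ᶜ_ : Decidable {A = Colour} _≡_
agree ≟ᶜ agree = yes refl
agree ≟ᶜ disagree = no λ ()
agree ≟ᶜ apart = no λ ()
disagree ≟ᶜ agree = no λ ()
disagree ≟ᶜ disagree = yes refl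
disagree ≟ᶜ apart = no λ ()
apart ≟ᶜ agree = no λ ()
apart ≟ᶜ disagree = no λ ()
apart ≟ᶜ apart = yes refl

other-colours : (k : Colour) → ∃[ k₂ ] ∃[ k₃ ] k₂ ≢ k × k₃ ≢ k × k₂ ≢ k₃
other-colours agree = disagree , apart , (λ ()) , (λ ()) , λ ()
other-colours disagree = agree , apart , (λ ()) , (λ ()) , λ ()
other-colours apart = agree , disagree , (λ ()) , (λ ()) , λ ()

module Gallai {n : ℕ} (col : Fin n → Fin n → Colour) (col-sym : ∀ x y → col x y ≡ col y x)
  (no-rainbow : ∀ x y z → col x y ≢ col x z → col x y ≢ col y z → col x z ≢ col y z → ⊥) where

  Edge : Colour → Subset n → Rel (Fin n) 0ℓ
  Edge k S u v = u ∈ˢ S × v ∈ˢ S × col u v ≡ k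

  edge? : ∀ k S → Decidable (Edge k S)
  edge? k S u v = u ∈ˢ? S ×-dec (v ∈ˢ? S ×-dec (col u v ≟ᶜ k))

  edge-sym : ∀ {k S u v} → Edge k S u v → Edge k S v u
  edge-sym (u∈ , v∈ , eq) = v∈ , u∈ , trans (col-sym _ _) eq

  Disconnected : Subset n → Set
  Disconnected S = ∃[ k ] ∃[ a ] ∃[ b ] a ∈ˢ S × b ∈ˢ S × ¬ Star (Edge k S) a b

  isolated : ∀ {S v u k} → u ∈ˢ S → v ∈ˢ S → u ≢ v → (∀ {w} → w ∈ˢ S → w ≢ v → col v w ≢ k) → Disconnected S
  isolated {S} {v} {u} {k} u∈ v∈ ne h = k , v , u , v∈ , u∈ ,
    λ s → ne (star-invariant (_≡ v) step s refl)
    where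
    step : ∀ {w w'} → w ≡ v → Edge k S w w' → w' ≡ v
    step {w' = w'} refl (_ , w'∈ , eq) with w' ≟ v
    ... | yes p = p
    ... | no np = ⊥-elim (h w'∈ np eq)

  module Extend {S : Subset n} {v : Fin n} (v∈ : v ∈ˢ S) where

    S' : Subset n
    S' = subset (λ u → u ∈ˢ? S ×-dec ¬? (u ≟ v))

    S'⁺ : ∀ {u} → u ∈ˢ S → u ≢ v → u ∈ˢ S'
    S'⁺ u∈ ne = ∈-subset⁺ (λ u → u ∈ˢ? S ×-dec ¬? (u ≟ v)) (u∈ , ne)

    S'⁻ : ∀ {u} → u ∈ˢ S' → u ∈ˢ S × u ≢ v
    S'⁻ = ∈-subset⁻ (λ u → u ∈ˢ? S ×-dec ¬? (u ≟ v))

    S'⊂S : S' ⊂ S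
    S'⊂S = (proj₁ ∘ S'⁻) , v , v∈ , λ v∈' → proj₂ (S'⁻ v∈') refl

    module _ (k : Colour) where

      Comp : Rel (Fin n) 0ℓ
      Comp = Star (Edge k S')

      comp? : Decidable Comp
      comp? u = Reach.star? (edge? k S') u

      comp-sym : ∀ {u w} → Comp u w → Comp w u
      comp-sym = Star.reverse edge-sym

      comp-∈ : ∀ {u w} → u ∈ˢ S' → Comp u w → w ∈ˢ S'
      comp-∈ u∈ s = star-invariant (_∈ˢ S') (λ _ (_ , w∈ , _) → w∈) s u∈

      unattached : ∀ {u} → u ∈ˢ S' → (∀ {w} → Comp u w → col v w ≢ k) → Disconnected S
      unattached {u} u∈ h = k , u , v , proj₁ (S'⁻ u∈) , v∈ , λ s →
        proj₂ (S'⁻ (proj₁ (star-invariant (λ w → w ∈ˢ S' × Comp u w) step s (u∈ , ε)))) refl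
        where
        step : ∀ {w w'} → w ∈ˢ S' × Comp u w → Edge k S w w' → w' ∈ˢ S' × Comp u w'
        step {w} {w'} (w∈ , c) (_ , w'∈ , eq) with w' ≟ v
        ... | yes refl = ⊥-elim (h c (trans (col-sym v w) eq))
        ... | no ne = S'⁺ w'∈ ne , c ◅◅ ((w∈ , S'⁺ w'∈ ne , eq) ◅ ε)

      -- The edges from `z` to another `k`-component avoid `k`. If their colour changed along a
      -- `k`-edge of that component, the triangle would be rainbow.
      uniform : ∀ {z u w} → z ∈ˢ S' → u ∈ˢ S' → ¬ Comp u z → Comp u w → col z w ≡ col z u
      uniform {z} {u} z∈ u∈ nc c = proj₂ (proj₂ (star-invariant (λ w → w ∈ˢ S' × Comp u w × col z w ≡ col z u) step c (u∈ , ε , refl)))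
        where
        differ : ∀ {w} → w ∈ˢ S' → Comp u w → col z w ≢ k
        differ w∈ c eq = nc (c ◅◅ (edge-sym (z∈ , w∈ , eq) ◅ ε))
        step : ∀ {w w'} → w ∈ˢ S' × Comp u w × col z w ≡ col z u → Edge k S' w w' → w' ∈ˢ S' × Comp u w' × col z w' ≡ col z u
        step {w} {w'} (w∈ , c , eq) e@(_ , w'∈ , ek) with col z w ≟ᶜ col z w'
        ... | yes same = w'∈ , c ◅◅ (e ◅ ε) , trans (sym same) eq
        ... | no ne = ⊥-elim (no-rainbow z w w' ne (λ p → differ w∈ c (trans p ek))
          (λ p → differ w'∈ (c ◅◅ (e ◅ ε)) (trans p ek)))

      module _ (attached : ∀ {u} → u ∈ˢ S' → ∃[ w ] Comp u w × col v w ≡ k) where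

        -- The component of `d` contains some `d'` joined to `v` in colour `k`. In the triangle `v`,
        -- `a`, `d'` neither `va` nor `ad'` has colour `k`, so they have the same colour, and
        -- `uniform` carries it from `d'` to `d`.
        outside-colour : ∀ {a d} → a ∈ˢ S' → d ∈ˢ S' → col v a ≢ k → ¬ Comp a d → col a d ≡ col v a
        outside-colour {a} {d} a∈ d∈ ne nc with attached d∈
        ... | d' , c , eq with col v a ≟ᶜ col a d'
        ...   | yes p = trans (sym (uniform a∈ d∈ (nc ∘ comp-sym) c)) (sym p)
        ...   | no np = ⊥-elim (no-rainbow v a d' (λ p → ne (trans p eq)) np
          λ p → nc ((a∈ , comp-∈ d∈ c , trans (sym p) eq) ◅ comp-sym c))

        -- Seen from a, everything outside the component of a has the colour of va; likewise for b.
        two-attachments : ∀ {a b x y} → a ∈ˢ S' → b ∈ˢ S' → col v a ≢ k → col v b ≢ k → col v a ≢ col v b →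
          x ∈ˢ S' → y ∈ˢ S' → ¬ Comp x y → ⊥
        two-attachments {a} {b} {x} {y} a∈ b∈ na nb ne x∈ y∈ nc with comp? a b
        ... | no ab = ne (trans (sym (outside-colour a∈ b∈ na ab))
          (trans (col-sym a b) (outside-colour b∈ a∈ nb (ab ∘ comp-sym))))
        ... | yes ab with comp? a x | comp? a y
        ...   | yes ax | yes ay = nc (comp-sym ax ◅◅ ay)
        ...   | no ax | _ = clash x∈ ax
          where
          clash : ∀ {d} → d ∈ˢ S' → ¬ Comp a d → ⊥
          clash {d} d∈ nd = ne (trans (sym (outside-colour a∈ d∈ na nd)) (trans (col-sym a d)
            (trans (sym (uniform d∈ a∈ nd ab)) (trans (col-sym d b) (outside-colour b∈ d∈ nb λ bd → nd (ab ◅◅ bd))))))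
        ...   | yes _ | no ay = clash y∈ ay
          where
          clash : ∀ {d} → d ∈ˢ S' → ¬ Comp a d → ⊥
          clash {d} d∈ nd = ne (trans (sym (outside-colour a∈ d∈ na nd)) (trans (col-sym a d)
            (trans (sym (uniform d∈ a∈ nd ab)) (trans (col-sym d b) (outside-colour b∈ d∈ nb λ bd → nd (ab ◅◅ bd))))))

      -- Colour `k` is disconnected before `v` is added. Either `v` has no `k`-edge to some
      -- component, which then stays separate, or `v` lacks one of the other colours and is isolated
      -- in it; `two-attachments` excludes the rest.
      extend : ∀ {u x y} → u ∈ˢ S' → x ∈ˢ S' → y ∈ˢ S' → ¬ Comp x y → Disconnected S
      extend {u} u∈ x∈ y∈ nc with other-colours k
      ... | k₂ , k₃ , n₂ , n₃ , n₂₃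
        with Fin.any? (λ u → u ∈ˢ? S' ×-dec ¬? (Fin.any? (λ w → comp? u w ×-dec (col v w ≟ᶜ k))))
           | Fin.any? (λ w → w ∈ˢ? S' ×-dec (col v w ≟ᶜ k₂))
           | Fin.any? (λ w → w ∈ˢ? S' ×-dec (col v w ≟ᶜ k₃))
      ... | yes (u , u∈ , none) | _ | _ = unattached u∈ λ c eq → none (_ , c , eq)
      ... | no _ | no none | _ = isolated (proj₁ (S'⁻ u∈)) v∈ (proj₂ (S'⁻ u∈)) λ w∈ ne eq → none (_ , S'⁺ w∈ ne , eq)
      ... | no _ | yes _ | no none = isolated (proj₁ (S'⁻ u∈)) v∈ (proj₂ (S'⁻ u∈)) λ w∈ ne eq → none (_ , S'⁺ w∈ ne , eq)
      ... | no all | yes (a , a∈ , va) | yes (b , b∈ , vb) = ⊥-elim (two-attachments attached a∈ b∈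
        (λ p → n₂ (trans (sym va) p)) (λ p → n₃ (trans (sym vb) p)) (λ p → n₂₃ (trans (sym va) (trans p vb))) x∈ y∈ nc)
        where
        attached : ∀ {u} → u ∈ˢ S' → ∃[ w ] Comp u w × col v w ≡ k
        attached {u} u∈ with Fin.any? (λ w → comp? u w ×-dec (col v w ≟ᶜ k))
        ... | yes p = p
        ... | no p = ⊥-elim (all (u , u∈ , p))

  -- Gallai's theorem for three colours, by removing one vertex at a time.
  gallai : ∀ S → Acc _⊂_ S → ∀ {v} → v ∈ˢ S → (∀ {u} → u ∈ˢ S → u ≡ v) ⊎ Disconnected S
  gallai S (acc rs) {v} v∈ with Subset.nonempty? S'
    where open Extend v∈
  ... | no empty = inj₁ only
    where
    open Extend v∈
    only : ∀ {u} → u ∈ˢ S → u ≡ v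
    only {u} u∈ with u ≟ v
    ... | yes eq = eq
    ... | no ne = ⊥-elim (empty (u , S'⁺ u∈ ne))
  ... | yes (u , u∈) with gallai (Extend.S' v∈) (rs (Extend.S'⊂S v∈)) u∈
  ...   | inj₂ (k , x , y , x∈ , y∈ , nc) = inj₂ (Extend.extend v∈ k u∈ x∈ y∈ nc)
  ...   | inj₁ single with other-colours (col v u)
  -- Only `u` and `v` are left, so any colour different from that of their edge is disconnected.
  ...     | k , _ , ne , _ = inj₂ (isolated (proj₁ (S'⁻ u∈)) v∈ (proj₂ (S'⁻ u∈)) avoid)
    where
    open Extend v∈
    avoid : ∀ {w} → w ∈ˢ S → w ≢ v → col v w ≢ k
    avoid w∈ nw eq with single (S'⁺ w∈ nw)
    ... | refl = ne (sym eq)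

-- Two orientations of one comparability graph

CPTOn-resp : ∀ {n} {S : Fin n → Set} {R R' : Rel (Fin n) 0ℓ} → (∀ {x y} → S x → S y → R x y → R' x y) →
  (∀ {x y} → S x → S y → R' x y → R x y) → CPTOn S R → CPTOn S R'
CPTOn-resp to from (F , rep) = F , λ sx sy → (λ r → proj₁ (rep sx sy) (from sx sy r)) , λ s → to sx sy (proj₂ (rep sx sy) s)

CPTOn-⊆ : ∀ {n} {S T : Fin n → Set} {R : Rel (Fin n) 0ℓ} → (∀ {x} → T x → S x) → CPTOn S R → CPTOn T R
CPTOn-⊆ h (F , rep) = F , λ tx ty → rep (h tx) (h ty)

CPTOn-trans : ∀ {n} {S : Fin n → Set} {R : Rel (Fin n) 0ℓ} → CPTOn S R → ∀ {x y z} → S x → S y → S z → R x y → R y z → R x z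
CPTOn-trans (F , rep) sx sy sz a b = proj₂ (rep sx sz) (strict-trans F (proj₁ (rep sx sy) a) (proj₁ (rep sy sz) b))

CPTOn-asym : ∀ {n} {S : Fin n → Set} {R : Rel (Fin n) 0ℓ} → CPTOn S R → ∀ {x y} → S x → S y → R x y → ¬ R y x
CPTOn-asym (F , rep) sx sy a b = proj₂ (proj₁ (rep sx sy) a) (proj₁ (proj₁ (rep sy sx) b))

strictOrder-flip : ∀ {n} {Q : Rel (Fin n) 0ℓ} → StrictOrder Q → StrictOrder (flip Q)
strictOrder-flip σ = record { Q? = flip Q? ; Q-irrefl = Q-irrefl ; Q-trans = flip Q-trans }
  where open StrictOrder σ

record SameOn {n : ℕ} (S : Subset n) (R Q : Rel (Fin n) 0ℓ) : Set where
  field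
    to : ∀ {x y} → x ∈ˢ S → y ∈ˢ S → R x y → Q x y ⊎ Q y x
    from : ∀ {x y} → x ∈ˢ S → y ∈ˢ S → Q x y → R x y ⊎ R y x

sameOn-flip : ∀ {n} {S : Subset n} {R Q : Rel (Fin n) 0ℓ} → SameOn S R Q → SameOn S (flip R) (flip Q)
sameOn-flip same = record { to = λ sx sy r → to sy sx r ; from = λ sx sy q → from sy sx q }
  where open SameOn same

sameOn-flipˡ : ∀ {n} {S : Subset n} {R Q : Rel (Fin n) 0ℓ} → SameOn S R Q → SameOn S (flip R) Q
sameOn-flipˡ same = record { to = λ sx sy r → swap (to sy sx r) ; from = λ sx sy q → swap (from sx sy q) }
  where open SameOn same

Disagree Agree : ∀ {n} → Subset n → Rel (Fin n) 0ℓ → Rel (Fin n) 0ℓ → Rel (Fin n) 0ℓ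
Disagree S R Q x y = x ∈ˢ S × y ∈ˢ S × ((R x y × Q y x) ⊎ (R y x × Q x y))
Agree S R Q x y = x ∈ˢ S × y ∈ˢ S × ((R x y × Q x y) ⊎ (R y x × Q y x))

disagree-sym : ∀ {n} {S : Subset n} {R Q x y} → Disagree S R Q x y → Disagree S R Q y x
disagree-sym (x∈ , y∈ , h) = y∈ , x∈ , swap h

agree-sym : ∀ {n} {S : Subset n} {R Q x y} → Agree S R Q x y → Agree S R Q y x
agree-sym (x∈ , y∈ , h) = y∈ , x∈ , swap h

module Colouring {n : ℕ} {S : Subset n} {R Q : Rel (Fin n) 0ℓ} (R? : Decidable R) (σ : StrictOrder Q)
  (same : SameOn S R Q) (cpt : CPTOn (_∈ˢ S) R) where

  open StrictOrder σ
  open SameOn same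

  D A : Rel (Fin n) 0ℓ
  D = Disagree S R Q
  A = Agree S R Q

  D? : Decidable D
  D? x y = x ∈ˢ? S ×-dec (y ∈ˢ? S ×-dec ((R? x y ×-dec Q? y x) ⊎-dec (R? y x ×-dec Q? x y)))

  A? : Decidable A
  A? x y = x ∈ˢ? S ×-dec (y ∈ˢ? S ×-dec ((R? x y ×-dec Q? x y) ⊎-dec (R? y x ×-dec Q? y x)))

  exclusive : ∀ {x y} → D x y → ¬ A x y
  exclusive (_ , _ , inj₁ (_ , q)) (_ , _ , inj₁ (_ , q')) = Q-asym q q'
  exclusive (x∈ , y∈ , inj₁ (r , _)) (_ , _ , inj₂ (r' , _)) = CPTOn-asym cpt x∈ y∈ r r'
  exclusive (x∈ , y∈ , inj₂ (r , _)) (_ , _ , inj₁ (r' , _)) = CPTOn-asym cpt x∈ y∈ r' r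
  exclusive (_ , _ , inj₂ (_ , q)) (_ , _ , inj₂ (_ , q')) = Q-asym q q'

  colour : ∀ {x y} → Dec (D x y) → Dec (A x y) → Colour
  colour (yes _) _ = disagree
  colour (no _) (yes _) = agree
  colour (no _) (no _) = apart

  col : Fin n → Fin n → Colour
  col x y = colour (D? x y) (A? x y)

  col-D : ∀ {x y} → D x y → col x y ≡ disagree
  col-D {x} {y} d with D? x y
  ... | yes _ = refl
  ... | no n = ⊥-elim (n d)

  col-A : ∀ {x y} → A x y → col x y ≡ agree
  col-A {x} {y} a with D? x y | A? x y
  ... | yes d | _ = ⊥-elim (exclusive d a)
  ... | no _ | yes _ = refl
  ... | no _ | no n = ⊥-elim (n a)

  col-apart : ∀ {x y} → ¬ D x y → ¬ A x y → col x y ≡ apart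
  col-apart {x} {y} nd na with D? x y | A? x y
  ... | yes d | _ = ⊥-elim (nd d)
  ... | no _ | yes a = ⊥-elim (na a)
  ... | no _ | no _ = refl

  D-col : ∀ {x y} → col x y ≡ disagree → D x y
  D-col {x} {y} eq with D? x y | A? x y
  D-col eq | yes d | _ = d
  D-col () | no _ | yes _
  D-col () | no _ | no _

  A-col : ∀ {x y} → col x y ≡ agree → A x y
  A-col {x} {y} eq with D? x y | A? x y
  A-col () | yes d | _
  A-col eq | no _ | yes a = a
  A-col () | no _ | no _

  col-sym : ∀ x y → col x y ≡ col y x
  col-sym x y with D? x y | A? x y
  ... | yes d | _ = sym (col-D (disagree-sym {R = R} {Q} d))
  ... | no nd | yes a = sym (col-A (agree-sym {R = R} {Q} a))
  ... | no nd | no na = sym (col-apart (nd ∘ disagree-sym {R = R} {Q}) (na ∘ agree-sym {R = R} {Q}))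

  R-not-apart : ∀ {x y} → x ∈ˢ S → y ∈ˢ S → R x y → col x y ≢ apart
  R-not-apart {x} {y} x∈ y∈ r eq with to x∈ y∈ r
  ... | inj₁ q with trans (sym eq) (col-A (x∈ , y∈ , inj₁ (r , q)))
  ...   | ()
  R-not-apart {x} {y} x∈ y∈ r eq | inj₂ q with trans (sym eq) (col-D (x∈ , y∈ , inj₁ (r , q)))
  ...   | ()

  Q-not-apart : ∀ {x y} → x ∈ˢ S → y ∈ˢ S → Q x y → col x y ≢ apart
  Q-not-apart {x} {y} x∈ y∈ q eq with from x∈ y∈ q
  ... | inj₁ r = R-not-apart x∈ y∈ r eq
  ... | inj₂ r = R-not-apart y∈ x∈ r (trans (col-sym y x) eq)

  -- At `x` the two edges run head to tail in one of `R` and `Q`, because exactly one of the edges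
  -- is reversed between them. Transitivity of that order makes `y` and `z` comparable.
  disagree-agree : ∀ x y z → col x y ≡ disagree → col x z ≡ agree → col y z ≢ apart
  disagree-agree x y z d a with D-col d | A-col a
  ... | x∈ , y∈ , inj₁ (r , q) | _ , z∈ , inj₁ (r' , q') = Q-not-apart y∈ z∈ (Q-trans q q')
  ... | x∈ , y∈ , inj₁ (r , q) | _ , z∈ , inj₂ (r' , q') = λ eq → R-not-apart z∈ y∈ (CPTOn-trans cpt z∈ x∈ y∈ r' r) (trans (col-sym z y) eq)
  ... | x∈ , y∈ , inj₂ (r , q) | _ , z∈ , inj₁ (r' , q') = R-not-apart y∈ z∈ (CPTOn-trans cpt y∈ x∈ z∈ r r')
  ... | x∈ , y∈ , inj₂ (r , q) | _ , z∈ , inj₂ (r' , q') = λ eq → Q-not-apart z∈ y∈ (Q-trans q' q) (trans (col-sym z y) eq)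

  no-rainbow : ∀ x y z → col x y ≢ col x z → col x y ≢ col y z → col x z ≢ col y z → ⊥
  no-rainbow x y z n₁ n₂ n₃ with col x y in e₁ | col x z in e₂ | col y z in e₃
  ... | disagree | disagree | _ = n₁ refl
  ... | agree | agree | _ = n₁ refl
  ... | apart | apart | _ = n₁ refl
  ... | disagree | _ | disagree = n₂ refl
  ... | agree | _ | agree = n₂ refl
  ... | apart | _ | apart = n₂ refl
  ... | _ | disagree | disagree = n₃ refl
  ... | _ | agree | agree = n₃ refl
  ... | _ | apart | apart = n₃ refl
  ... | disagree | agree | apart = disagree-agree x y z e₁ e₂ e₃
  ... | agree | disagree | apart = disagree-agree x z y e₂ e₁ (trans (col-sym z y) e₃)
  ... | disagree | apart | agree = disagree-agree y x z (trans (col-sym y x) e₁) e₃ e₂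
  ... | agree | apart | disagree = disagree-agree y z x e₃ (trans (col-sym y x) e₁) (trans (col-sym z x) e₂)
  ... | apart | disagree | agree = disagree-agree z x y (trans (col-sym z x) e₂) (trans (col-sym z y) e₃) e₁
  ... | apart | agree | disagree = disagree-agree z y x (trans (col-sym z y) e₃) (trans (col-sym z x) e₂) (trans (col-sym y x) e₁)

  open Gallai col col-sym no-rainbow public

  -- A component C of the disagreement graph is a module: edges from outside to C are agreeing, and moving along a
  -- disagreeing edge inside C cannot turn z < w into anything else without producing a disagreeing edge at z.
  module Component (x : Fin n) {y : Fin n} (xy : D x y) where

    C : Subset n
    C = subset (Reach.star? D? x)

    C⁺ : ∀ {v} → Star D x v → v ∈ˢ C
    C⁺ = ∈-subset⁺ (Reach.star? D? x)

    C⁻ : ∀ {v} → v ∈ˢ C → Star D x v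
    C⁻ = ∈-subset⁻ (Reach.star? D? x)

    C⊆S : ∀ {v} → v ∈ˢ C → v ∈ˢ S
    C⊆S v∈ = star-invariant (_∈ˢ S) (λ _ (_ , w∈ , _) → w∈) (C⁻ v∈) (proj₁ xy)

    closed : ∀ {u v} → u ∈ˢ C → D u v → v ∈ˢ C
    closed u∈ d = C⁺ (C⁻ u∈ ◅◅ (d ◅ ε))

    connected : ∀ {u v} → u ∈ˢ C → v ∈ˢ C → Star D u v
    connected u∈ v∈ = Star.reverse (disagree-sym {R = R} {Q}) (C⁻ u∈) ◅◅ C⁻ v∈

    module _ {z : Fin n} (z∈ : z ∈ˢ S) (z∉ : z ∉ˢ C) where

      below-agree : ∀ {w} → w ∈ˢ C → R z w → Q z w
      below-agree w∈ r with to z∈ (C⊆S w∈) r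
      ... | inj₁ q = q
      ... | inj₂ q = ⊥-elim (z∉ (closed w∈ (C⊆S w∈ , z∈ , inj₂ (r , q))))

      above-agree : ∀ {w} → w ∈ˢ C → R w z → Q w z
      above-agree w∈ r with to (C⊆S w∈) z∈ r
      ... | inj₁ q = q
      ... | inj₂ q = ⊥-elim (z∉ (closed w∈ (C⊆S w∈ , z∈ , inj₁ (r , q))))

      below-step : ∀ {w w'} → w ∈ˢ C × R z w → D w w' → w' ∈ˢ C × R z w'
      below-step (w∈ , r) d@(_ , w'∈ , inj₁ (ww' , _)) = closed w∈ d , CPTOn-trans cpt z∈ (C⊆S w∈) w'∈ r ww'
      below-step (w∈ , r) d@(_ , w'∈ , inj₂ (_ , ww'))
        with q ← Q-trans (below-agree w∈ r) ww' with from z∈ w'∈ q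
      ... | inj₁ r' = closed w∈ d , r'
      ... | inj₂ r' = ⊥-elim (z∉ (closed (closed w∈ d) (w'∈ , z∈ , inj₁ (r' , q))))

      above-step : ∀ {w w'} → w ∈ˢ C × R w z → D w w' → w' ∈ˢ C × R w' z
      above-step (w∈ , r) d@(_ , w'∈ , inj₂ (w'w , _)) = closed w∈ d , CPTOn-trans cpt w'∈ (C⊆S w∈) z∈ w'w r
      above-step (w∈ , r) d@(_ , w'∈ , inj₁ (_ , w'w))
        with q ← Q-trans w'w (above-agree w∈ r) with from w'∈ z∈ q
      ... | inj₁ r' = closed w∈ d , r'
      ... | inj₂ r' = ⊥-elim (z∉ (closed (closed w∈ d) (w'∈ , z∈ , inj₂ (r' , q))))

      below-all : ∀ {u v} → u ∈ˢ C → v ∈ˢ C → R z u → R z v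
      below-all u∈ v∈ r = proj₂ (star-invariant (λ w → w ∈ˢ C × R z w) below-step (connected u∈ v∈) (u∈ , r))

      above-all : ∀ {u v} → u ∈ˢ C → v ∈ˢ C → R u z → R v z
      above-all u∈ v∈ r = proj₂ (star-invariant (λ w → w ∈ˢ C × R w z) above-step (connected u∈ v∈) (u∈ , r))

-- `R` ranges over decidable relations rather than posets because each replacement changes it; its
-- transitivity and asymmetry on `S` come from the representation.
Hereditary : ∀ {n} → Subset n → Set₁
Hereditary {n} S = ∀ {R Q : Rel (Fin n) 0ℓ} → Decidable R → StrictOrder Q → SameOn S R Q →
  CPTOn (_∈ˢ S) R → CPTOn (_∈ˢ S) (flip R) → CPTOn (_∈ˢ S) Q

replace : ∀ {n} {S C : Subset n} → (∀ {v} → v ∈ˢ C → v ∈ˢ S) → Hereditary C → ∀ {R Q : Rel (Fin n) 0ℓ} →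
  Decidable R → StrictOrder Q → SameOn S R Q → CPTOn (_∈ˢ S) R → CPTOn (_∈ˢ S) (flip R) →
  (∀ {z x y} → z ∈ˢ S → z ∉ˢ C → x ∈ˢ C → y ∈ˢ C → R z x → R z y) →
  (∀ {z x y} → z ∈ˢ S → z ∉ˢ C → x ∈ˢ C → y ∈ˢ C → R x z → R y z) →
  ∀ {c₀ c} → c₀ ∈ˢ C → c ∈ˢ C → R c₀ c → CPTOn (_∈ˢ S) (Replace (_∈ˢ C) R Q)
replace {n} {S} {C} C⊆S hered {R} {Q} R? σ same cpt cptᵈ below-all above-all {c₀} {c} c₀∈ c∈ r
  -- `C` being a module, testing comparability of `z` with the single element `c` settles it for all
  -- of `C`.
  with Fin.any? (λ z → z ∈ˢ? S ×-dec (¬? (z ∈ˢ? C) ×-dec (R? z c ⊎-dec R? c z)))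
... | yes (z , z∈ , z∉ , zc) = Substitution.substitute (λ v → v ∈ˢ? S) (λ v → v ∈ˢ? C) C⊆S {Q = Q} R? below-all above-all c₀∈ c∈ r σ
    (λ x∈ y∈ → to (C⊆S x∈) (C⊆S y∈)) (λ x∈ y∈ → from (C⊆S x∈) (C⊆S y∈))
    (comparable-conjugate R? cpt cptᵈ C⊆S z∈ λ x∈ → all x∈ zc) cpt
  where
  open SameOn same
  all : ∀ {x} → x ∈ˢ C → R z c ⊎ R c z → R x z ⊎ R z x
  all x∈ (inj₁ h) = inj₂ (below-all z∈ z∉ c∈ x∈ h)
  all x∈ (inj₂ h) = inj₁ (above-all z∈ z∉ c∈ x∈ h)
... | no none = union (proj₁ inner) (proj₁ cpt) (_∈ˢ C) (λ v → v ∈ˢ? C)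
    (λ x∈ y∈ → (λ { (inj₁ (_ , _ , q)) → proj₁ (proj₂ inner x∈ y∈) q ; (inj₂ (n , _)) → ⊥-elim (n (x∈ , y∈)) }) ,
               λ s → inj₁ (x∈ , y∈ , proj₂ (proj₂ inner x∈ y∈) s))
    (λ (x∈ , x∉) (y∈ , _) → (λ { (inj₁ (x∈C , _)) → ⊥-elim (x∉ x∈C) ; (inj₂ (_ , h)) → proj₁ (proj₂ cpt x∈ y∈) h }) ,
               λ s → inj₂ ((λ (x∈C , _) → x∉ x∈C) , proj₂ (proj₂ cpt x∈ y∈) s))
    λ x∈ y∈ x∈C y∉C → (λ { (inj₁ (_ , y∈C , _)) → y∉C y∈C
                         ; (inj₂ (_ , h)) → none (_ , y∈ , y∉C , inj₂ (above-all y∈ y∉C x∈C c∈ h)) }) ,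
                      λ { (inj₁ (y∈C , _)) → y∉C y∈C
                        ; (inj₂ (_ , h)) → none (_ , y∈ , y∉C , inj₁ (below-all y∈ y∉C x∈C c∈ h)) }
  where
  open SameOn same
  inner : CPTOn (_∈ˢ C) Q
  inner = hered R? σ (record { to = λ x∈ y∈ → to (C⊆S x∈) (C⊆S y∈) ; from = λ x∈ y∈ → from (C⊆S x∈) (C⊆S y∈) })
    (CPTOn-⊆ C⊆S cpt) (CPTOn-⊆ C⊆S cptᵈ)

module _ {n : ℕ} {S : Subset n} (hered : ∀ {C} → C ⊂ S → Hereditary C) {Q : Rel (Fin n) 0ℓ} (σ : StrictOrder Q)
  {a b : Fin n} (a∈ : a ∈ˢ S) (b∈ : b ∈ˢ S) where

  open StrictOrder σ

  -- `xs` covers the vertices that still lie on a disagreeing edge. Once the component of its head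
  -- is replaced, no such edge is left at the head. Disagreement only shrinks, so `a` and `b` stay
  -- separated for the later rounds.
  replace-components : ∀ xs {R : Rel (Fin n) 0ℓ} → Decidable R → SameOn S R Q → CPTOn (_∈ˢ S) R → CPTOn (_∈ˢ S) (flip R) →
    ¬ Star (Disagree S R Q) a b → (∀ {x y} → Disagree S R Q x y → x ∈ xs) → CPTOn (_∈ˢ S) Q
  replace-components [] {R} R? same cpt cptᵈ cut cover = CPTOn-resp to-Q from-Q cpt
    where
    open SameOn same
    to-Q : ∀ {x y} → x ∈ˢ S → y ∈ˢ S → R x y → Q x y
    to-Q x∈ y∈ r with to x∈ y∈ r
    ... | inj₁ q = q
    ... | inj₂ q with cover (x∈ , y∈ , inj₁ (r , q))
    ...   | ()
    from-Q : ∀ {x y} → x ∈ˢ S → y ∈ˢ S → Q x y → R x y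
    from-Q x∈ y∈ q with from x∈ y∈ q
    ... | inj₁ r = r
    ... | inj₂ r with cover (x∈ , y∈ , inj₂ (r , q))
    ...   | ()
  replace-components (x ∷ xs) {R} R? same cpt cptᵈ cut cover with Fin.any? (Colouring.D? R? σ same cpt x)
  ... | no none = replace-components xs R? same cpt cptᵈ cut λ d → later d (cover d)
    where
    later : ∀ {u v} → Disagree S R Q u v → u ∈ x ∷ xs → u ∈ xs
    later d (here refl) = ⊥-elim (none (_ , d))
    later d (there u∈) = u∈
  ... | yes (y , xy) = replace-components xs {R₁} R₁? same₁
      (replace C⊆S (hered C⊂S) R? σ same cpt cptᵈ (λ z∈ z∉ → below-all z∈ z∉) (λ z∈ z∉ → above-all z∈ z∉) c₀∈ c∈ c₀<c)
      -- The dual undergoes the same replacement, with below and above exchanged, so that both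
      -- representations are available in the next round.
      (CPTOn-resp
        (λ { _ _ (inj₁ (u , v , q)) → inj₁ (v , u , q) ; _ _ (inj₂ (n , r)) → inj₂ ((λ (v , u) → n (u , v)) , r) })
        (λ { _ _ (inj₁ (u , v , q)) → inj₁ (v , u , q) ; _ _ (inj₂ (n , r)) → inj₂ ((λ (v , u) → n (u , v)) , r) })
        (replace C⊆S (hered C⊂S) (flip R?) (strictOrder-flip σ) (sameOn-flip same) cptᵈ cpt
          (λ z∈ z∉ → above-all z∈ z∉) (λ z∈ z∉ → below-all z∈ z∉) c∈ c₀∈ c₀<c))
      (λ s → cut (Star.map (proj₁ ∘ shrink) s))
      λ d → later d (cover (proj₁ (shrink d)))
    where
    open Colouring R? σ same cpt using (module Component)
    open Component x xy
    open SameOn same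
    R₁ : Rel (Fin n) 0ℓ
    R₁ = Replace (_∈ˢ C) R Q
    C? : ∀ v → Dec (v ∈ˢ C)
    C? v = v ∈ˢ? C
    R₁? : Decidable R₁
    R₁? u v = (C? u ×-dec (C? v ×-dec Q? u v)) ⊎-dec (¬? (C? u ×-dec C? v) ×-dec R? u v)
    x∈C : x ∈ˢ C
    x∈C = C⁺ ε
    y∈C : y ∈ˢ C
    y∈C = closed x∈C xy
    pair : ∃[ c₀ ] ∃[ c ] c₀ ∈ˢ C × c ∈ˢ C × R c₀ c
    pair = oriented xy
      where
      oriented : Disagree S R Q x y → ∃[ c₀ ] ∃[ c ] c₀ ∈ˢ C × c ∈ˢ C × R c₀ c
      oriented (_ , _ , inj₁ (r , _)) = x , y , x∈C , y∈C , r
      oriented (_ , _ , inj₂ (r , _)) = y , x , y∈C , x∈C , r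
    c₀∈ = proj₁ (proj₂ (proj₂ pair))
    c∈ = proj₁ (proj₂ (proj₂ (proj₂ pair)))
    c₀<c = proj₂ (proj₂ (proj₂ (proj₂ pair)))
    -- A component that contained both `a` and `b` would join them by disagreeing edges.
    C⊂S : C ⊂ S
    C⊂S with C? a
    ... | no a∉ = C⊆S , a , a∈ , a∉
    ... | yes a∈C = C⊆S , b , b∈ , λ b∈C → cut (connected a∈C b∈C)
    same₁ : SameOn S R₁ Q
    same₁ = record
      { to = λ { _ _ (inj₁ (_ , _ , q)) → inj₁ q ; u∈ v∈ (inj₂ (_ , r)) → to u∈ v∈ r }
      ; from = from₁ }
      where
      from₁ : ∀ {u v} → u ∈ˢ S → v ∈ˢ S → Q u v → R₁ u v ⊎ R₁ v u
      from₁ {u} {v} u∈ v∈ q with C? u ×-dec C? v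
      ... | yes (cu , cv) = inj₁ (inj₁ (cu , cv , q))
      ... | no n with from u∈ v∈ q
      ...   | inj₁ r = inj₁ (inj₂ (n , r))
      ...   | inj₂ r = inj₂ (inj₂ ((λ (cv , cu) → n (cu , cv)) , r))
    shrink : ∀ {u v} → Disagree S R₁ Q u v → Disagree S R Q u v × ¬ (u ∈ˢ C × v ∈ˢ C)
    shrink (_ , _ , inj₁ (inj₁ (_ , _ , q) , q')) = ⊥-elim (Q-asym q q')
    shrink (u∈ , v∈ , inj₁ (inj₂ (n , r) , q)) = (u∈ , v∈ , inj₁ (r , q)) , n
    shrink (_ , _ , inj₂ (inj₁ (_ , _ , q) , q')) = ⊥-elim (Q-asym q q')
    shrink (u∈ , v∈ , inj₂ (inj₂ (n , r) , q)) = (u∈ , v∈ , inj₂ (r , q)) , λ (cu , cv) → n (cv , cu)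
    later : ∀ {u v} → Disagree S R₁ Q u v → u ∈ x ∷ xs → u ∈ xs
    later d (here refl) = ⊥-elim (proj₂ (shrink d) (x∈C , closed x∈C (proj₁ (shrink d))))
    later d (there u∈) = u∈

hereditary : ∀ {n} (S : Subset n) → Acc _⊂_ S → Hereditary S
hereditary {n} S (acc rs) {R} {Q} R? σ same cpt cptᵈ with Subset.nonempty? S
... | no empty = proj₁ cpt , λ {x} x∈ → ⊥-elim (empty (x , x∈))
... | yes (v , v∈) = cases (gallai S (⊂-wellFounded S) v∈)
  where
  open Colouring R? σ same cpt
  open StrictOrder σ
  open SameOn same
  cases : (∀ {u} → u ∈ˢ S → u ≡ v) ⊎ Disconnected S → CPTOn (_∈ˢ S) Q
  cases (inj₁ single) = CPTOn-resp
    (λ x∈ y∈ r → let x≡y = trans (single x∈) (sym (single y∈)) in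
      ⊥-elim (CPTOn-asym cpt x∈ y∈ r (subst (λ y → R y _) x≡y (subst (R _) (sym x≡y) r))))
    (λ x∈ y∈ q → ⊥-elim (Q-irrefl (subst (Q _) (trans (single y∈) (sym (single x∈))) q))) cpt
  cases (inj₂ (disagree , a , b , a∈ , b∈ , cut)) =
    replace-components (λ C⊂S → hereditary _ (rs C⊂S)) σ a∈ b∈ (allFin n) R? same cpt cptᵈ
      (λ s → cut (Star.map (λ d@(x∈ , y∈ , _) → x∈ , y∈ , col-D d) s)) (λ _ → ∈-allFin _)
  cases (inj₂ (agree , a , b , a∈ , b∈ , cut)) =
    replace-components (λ C⊂S → hereditary _ (rs C⊂S)) σ a∈ b∈ (allFin n) (flip R?) (sameOn-flipˡ same) cptᵈ cpt
      (λ s → cut (Star.map (λ (x∈ , y∈ , h) → x∈ , y∈ , col-A (x∈ , y∈ , swap h)) s)) (λ _ → ∈-allFin _)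
  -- `U` is the component of `a` in the graph of non-edges. Its elements are comparable to `b`, all
  -- others to `a`, and any two elements on different sides to each other.
  cases (inj₂ (apart , a , b , a∈ , b∈ , cut)) = realizer⇒CPT (conjugate⇒realizer (λ v → v ∈ˢ? S) σ (conjugate-resp to from
    (conjugate-union U U? (comparable-conjugate R? cpt cptᵈ proj₁ b∈ λ (x∈ , u) → comparable x∈ b∈ u cut)
      (comparable-conjugate R? cpt cptᵈ proj₁ a∈ λ (x∈ , nu) → swap (comparable a∈ x∈ ε nu))
      λ x∈ y∈ u nu → comparable x∈ y∈ u nu)))
    where
    U : Fin n → Set
    U = Star (Edge apart S) a
    U? : ∀ v → Dec (U v)
    U? = Reach.star? (edge? apart S) a
    comparable : ∀ {x y} → x ∈ˢ S → y ∈ˢ S → U x → ¬ U y → R x y ⊎ R y x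
    comparable {x} {y} x∈ y∈ u nu with R? x y | R? y x
    ... | yes r | _ = inj₁ r
    ... | no _ | yes r = inj₂ r
    ... | no p | no q = ⊥-elim (nu (u ◅◅ ((x∈ , y∈ , col-apart
      (λ { (_ , _ , inj₁ (r , _)) → p r ; (_ , _ , inj₂ (r , _)) → q r })
      (λ { (_ , _ , inj₁ (r , _)) → p r ; (_ , _ , inj₂ (r , _)) → q r })) ◅ ε)))

-- Passing between posets and represented relations

⊊⇒strict : ∀ {n} (F : Family n) {x y} → paths F x ⊊ᵥ paths F y → Strict F x y
⊊⇒strict F (sub , v , v∈ , v∉) = (λ {u} → sub u) , λ h → v∉ (h v∈)

strict⇒⊊ : ∀ {n} (F : Family n) {x y} → Strict F x y → paths F x ⊊ᵥ paths F y
strict⇒⊊ F {x} {y} (sub , n) with any? (λ v → ¬? (v ∈? vertices F x)) (vertices F y)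
... | yes p = (λ _ → sub) , find-∈ p
... | no none = ⊥-elim (n back)
  where
  back : Sub F y x
  back {v} v∈ with v ∈? vertices F x
  ... | yes v∈x = v∈x
  ... | no v∉ = ⊥-elim (none (lose v∈ v∉))

CPT⇒CPTOn : ∀ {n} {P : Poset n} {S : Fin n → Set} → CPT P → CPTOn S (_≺_ P)
CPT⇒CPTOn (_ , T , tree , W , h) = F , λ {x} {y} _ _ →
  (λ r → ⊊⇒strict F (Equivalence.to (h x y) r)) , λ s → Equivalence.from (h x y) (strict⇒⊊ F s)
  where
  F = record { isTree = tree ; paths = W }

CPTOn⇒CPT : ∀ {n} {P : Poset n} → CPTOn (_∈ˢ Sets.⊤) (_≺_ P) → CPT P
CPTOn⇒CPT (F , rep) = size F , tree F , isTree F , paths F , λ x y → mk⇔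
  (λ r → strict⇒⊊ F (proj₁ (rep Subset.∈⊤ Subset.∈⊤) r)) (λ s → proj₂ (rep Subset.∈⊤ Subset.∈⊤) (⊊⇒strict F s))

-- The relation of a `Poset` comes without a decision procedure; containment of finite vertex lists
-- supplies one.
CPT-decidable : ∀ {n} {P : Poset n} → CPT P → Decidable (_≺_ P)
CPT-decidable {P = P} cpt x y with CPT⇒CPTOn {P = P} {S = _∈ˢ Sets.⊤} cpt
... | F , rep = map′ (proj₂ (rep Subset.∈⊤ Subset.∈⊤)) (proj₁ (rep Subset.∈⊤ Subset.∈⊤)) (sub? F x y ×-dec ¬? (sub? F y x))

-- `P` decides whether a pair is comparable. The equivalence of the graphs then yields a direction
-- in `Q`, and asymmetry refutes the opposite one.
same-decidable : ∀ {n} {P Q : Poset n} → SameComparabilityGraph P Q → Decidable (_≺_ P) → Decidable (_≺_ Q)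
same-decidable {P = P} {Q} same P? x y with P? x y ⊎-dec P? y x
... | no n = no λ q → n (Equivalence.to (same x y) (inj₁ q))
... | yes c with Equivalence.from (same x y) c
...   | inj₁ q = yes q
...   | inj₂ q = no λ q' → Q.irrefl refl (Q.trans q q')
  where module Q = IsStrictPartialOrder (isStrict Q)

theorem1 : ∀ (n : ℕ) (P : Poset n) → StronglyCPT P ⇔ DuallyCPT P
theorem1 n P = mk⇔ strongly⇒dually dually⇒strongly
  where
  strongly⇒dually : StronglyCPT P → DuallyCPT P
  strongly⇒dually h = h P (λ _ _ → mk⇔ (λ c → c) (λ c → c)) , h (dual P) (λ _ _ → mk⇔ swap swap)
  dually⇒strongly : DuallyCPT P → StronglyCPT P
  dually⇒strongly (cpt , cptᵈ) Q same = CPTOn⇒CPT {P = Q} (hereditary Sets.⊤ (⊂-wellFounded _) P?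
    (record { Q? = same-decidable {P = P} {Q} same P? ; Q-irrefl = Q.irrefl refl ; Q-trans = Q.trans })
    (record { to = λ {x} {y} _ _ r → Equivalence.from (same x y) (inj₁ r)
            ; from = λ {x} {y} _ _ q → Equivalence.to (same x y) (inj₁ q) })
    (CPT⇒CPTOn {P = P} cpt) (CPT⇒CPTOn {P = dual P} cptᵈ))
    where
    P? : Decidable (_≺_ P)
    P? = CPT-decidable {P = P} cpt
    module Q = IsStrictPartialOrder (isStrict Q)
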